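{- Let $i,k,\ell\in\mathbb{Z}$ with $k\ge 1$ and $0\le i\le k$. Then $$\frac{(-q^{1/2})_\infty}{(q)_\infty}\left(\sum_{n\ge|\ell|}-\sum_{n\le-|\ell|-1}\right)q^{\left(k+\frac12\right)\left(n+\frac{i}{2k+1}\right)^2-\frac{(2k\ell+i+\ell)^2}{4k+2}}$$ $$=\sum_{n_1,n_2,\dots,n_k\ge0}\frac{q^{\frac{N_1(N_1+1)}{2}+N_2^2+N_3^2+\cdots+N_k^2+\left(\ell+\frac12\right)N_1+(2\ell+1)(N_2+N_3+\cdots+N_k)-N_1-N_2-\cdots-N_{k-i}}\,(-q^{1/2})_{N_1+\ell}}{(q)_{n_1}(q)_{n_2}\cdots(q)_{n_k}\,(q)_{n_k+2\ell}},$$ where $N_j:=n_j+n_{j+1}+\cdots+n_k$ for $1\le j\le k$.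
   Context: Conventions: $q=e^{2\pi i\tau}$ with $\operatorname{Im}\tau>0$ (so $|q|<1$), and $q^r:=e^{2\pi i r\tau}$ for rational $r$ (here, in $e^{2\pi i\tau}$, $i$ is the imaginary unit; elsewhere $i$ is an integer index). The $q$-Pochhammer symbols are $(a)_n=(a;q)_n:=\prod_{j=1}^n(1-aq^{j-1})$ for $n\ge0$, $(a)_\infty:=\prod_{j\ge1}(1-aq^{j-1})$. By convention $1/(q)_m=0$ for integers $m<0$, so that summands on the right with $n_k+2\ell<0$ are zero. The expression $-N_1-N_2-\cdots-N_{k-i}$ means $-\sum_{j=1}^{k-i}N_j$, which is empty (zero) when $i=k$; likewise $N_2^2+\cdots+N_k^2$ and $N_2+\cdots+N_k$ are zero when $k=1$. The notation $\left(\sum_{n\ge|\ell|}-\sum_{n\le-|\ell|-1}\right)f(n)$ means $\sum_{n\ge|\ell|}f(n)-\sum_{n\le-|\ell|-1}f(n)$ with $n\in\mathbb{Z}$. -}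

module Defs where

open import Level using (Level; _⊔_) renaming (suc to lsuc)
open import Algebra.Apartness.Bundles using (HeytingField)
open import Algebra.Bundles.Raw using (RawMonoid; RawRing)
open import Algebra.Bundles using (Ring)
import Algebra.Definitions.RawMonoid as RawMonoidDefs
import Algebra.Definitions.RawSemiring as RawSemiringDefs
import Algebra.Properties.Ring as RingProperties
open import Data.Integer.Base as ℤ using (ℤ; +_; -[1+_])
open import Data.List.Base as List using (List)
open import Data.Nat.ListAction using (sum)
open import Data.List.Relation.Binary.Subset.Propositional using (_⊆_)
open import Data.List.Relation.Unary.Unique.Propositional using (Unique)
open import Data.Nat.Base as ℕ using (ℕ; zero; suc; NonZero; _!)
open import Data.Nat.Properties using (_!≢0)
open import Data.Product.Base using (Σ; ∃-syntax; _×_; _,_; proj₁; proj₂)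
open import Data.Rational.Base as ℚ using (ℚ; ↥_; ↧ₙ_; ½)
open import Data.Sum.Base using (_⊎_; inj₁; inj₂)
open import Data.Vec.Base using (Vec; []; _∷_; toList)
open import Relation.Binary.Core using (Rel)
open import Relation.Binary.Structures using (IsStrictPartialOrder)

-- The real numbers, axiomatised as a Cauchy-complete Archimedean ordered
-- field.  Constructively apartness plays the role of "≠"; x ≤ y is ¬ (y < x).
-- Classically the axioms determine the field up to isomorphism.

record RealNumbers (c ℓ₁ ℓ₂ ℓ₃ : Level) : Set (lsuc (c ⊔ ℓ₁ ⊔ ℓ₂ ⊔ ℓ₃)) where
  infix 4 _<_
  field
    heytingField : HeytingField c ℓ₁ ℓ₂

  open HeytingField heytingField public

  field
    _<_                  : Rel Carrier ℓ₃
    isStrictPartialOrder : IsStrictPartialOrder _≈_ _<_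
    #⇒<⊎>                : ∀ {x y} → x # y → (x < y) ⊎ (y < x)
    <⇒#                  : ∀ {x y} → x < y → x # y
    +-monoˡ-<            : ∀ z {x y} → x < y → x + z < y + z
    *-pos                : ∀ {x y} → 0# < x → 0# < y → 0# < x * y

  +-rawMonoid : RawMonoid c ℓ₁
  +-rawMonoid = record { _≈_ = _≈_ ; _∙_ = _+_ ; ε = 0# }

  open RawMonoidDefs +-rawMonoid using () renaming (_×_ to _·_)

  fromℕ : ℕ → Carrier
  fromℕ n = n · 1#

  Within : Carrier → Carrier → Carrier → Set ℓ₃
  Within ε x y = (x < y + ε) × (y < x + ε)

  field
    archimedean : ∀ x → ∃[ n ] (x < fromℕ n)
    complete    : (a : ℕ → Carrier) →
                  (∀ ε → 0# < ε → ∃[ M ] (∀ m n → M ℕ.≤ m → M ℕ.≤ n → Within ε (a m) (a n))) →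
                  ∃[ L ] (∀ ε → 0# < ε → ∃[ M ] (∀ n → M ℕ.≤ n → Within ε (a n) L))

module Analysis {c ℓ₁ ℓ₂ ℓ₃ : Level} (ℛ : RealNumbers c ℓ₁ ℓ₂ ℓ₃) where

  open RealNumbers ℛ public renaming (Carrier to ℝ)
  open IsStrictPartialOrder isStrictPartialOrder public
    using (<-respˡ-≈; <-respʳ-≈)
    renaming (trans to <-trans; irrefl to <-irrefl)

  private
    ring : Ring c ℓ₁
    ring = record { isRing = isRing }

    open RingProperties ring using (-‿distribˡ-*; -‿involutive; -0#≈0#)

  0<1 : 0# < 1#
  0<1 with #⇒<⊎> (invertible⇒# {1#} {0#} (1# , 1*[1-0] , [1-0]*1))
    where
      1-0 : 1# - 0# ≈ 1#
      1-0 = trans (+-congˡ -0#≈0#) (+-identityʳ 1#)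
      1*[1-0] = trans (*-identityˡ _) 1-0
      [1-0]*1 = trans (*-identityʳ _) 1-0
  ... | inj₂ 0<1 = 0<1
  ... | inj₁ 1<0 = <-respʳ-≈ -1*-1 (*-pos 0<-1 0<-1)
    where
      0<-1 : 0# < - 1#
      0<-1 = <-respˡ-≈ (-‿inverseʳ 1#) (<-respʳ-≈ (+-identityˡ _) (+-monoˡ-< (- 1#) 1<0))
      -1*-1 : - 1# * - 1# ≈ 1#
      -1*-1 = trans (sym (-‿distribˡ-* 1# (- 1#)))
                    (trans (-‿cong (*-identityˡ _)) (-‿involutive 1#))

  fromℕ-pos : ∀ n → 0# < fromℕ (suc n)
  fromℕ-pos zero    = <-respʳ-≈ (sym (+-identityʳ 1#)) 0<1
  fromℕ-pos (suc n) = <-trans (fromℕ-pos n)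
    (<-respˡ-≈ (+-identityˡ _) (+-monoˡ-< (fromℕ (suc n)) 0<1))

  fromℕ#0 : ∀ n .{{_ : NonZero n}} → fromℕ n # 0#
  fromℕ#0 (suc n) = #-sym (<⇒# (fromℕ-pos n))

  -- The library supplies y with y * (x - 0#) ≈ 1#.
  invℝ : ∀ x → x # 0# → ℝ
  invℝ x x#0 = proj₁ (#⇒invertible x#0)

  recipℕ : ∀ n .{{_ : NonZero n}} → ℝ
  recipℕ n = invℝ (fromℕ n) (fromℕ#0 n)

  fromℤ : ℤ → ℝ
  fromℤ (+ n)    = fromℕ n
  fromℤ -[1+ n ] = - fromℕ (suc n)

  fromℚ : ℚ → ℝ
  fromℚ r = fromℤ (↥ r) * recipℕ (↧ₙ r)

  record ℂ : Set c where
    constructor _+i_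
    field
      re im : ℝ
  open ℂ public

  infix  5 _+i_
  infix  4 _≈ᶜ_
  infixl 6 _+ᶜ_ _-ᶜ_
  infixl 7 _*ᶜ_
  infix  8 -ᶜ_

  _≈ᶜ_ : Rel ℂ ℓ₁
  z ≈ᶜ w = (re z ≈ re w) × (im z ≈ im w)

  ofℝ : ℝ → ℂ
  ofℝ x = x +i 0#

  0ᶜ 1ᶜ : ℂ
  0ᶜ = ofℝ 0#
  1ᶜ = ofℝ 1#

  -ᶜ_ : ℂ → ℂ
  -ᶜ z = (- re z) +i (- im z)

  _+ᶜ_ _-ᶜ_ _*ᶜ_ : ℂ → ℂ → ℂ
  z +ᶜ w = (re z + re w) +i (im z + im w)
  z *ᶜ w = (re z * re w - im z * im w) +i (re z * im w + im z * re w)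
  z -ᶜ w = z +ᶜ (-ᶜ w)

  ℂ-rawRing : RawRing c ℓ₁
  ℂ-rawRing = record
    { _≈_ = _≈ᶜ_ ; _+_ = _+ᶜ_ ; _*_ = _*ᶜ_ ; -_ = -ᶜ_ ; 0# = 0ᶜ ; 1# = 1ᶜ }

  open RawSemiringDefs (RawRing.rawSemiring ℂ-rawRing) public
    using () renaming (_^_ to _^ᶜ_)

  ∣_∣² : ℂ → ℝ
  ∣ z ∣² = re z * re z + im z * im z

  NonZeroᶜ : ℂ → Set ℓ₂
  NonZeroᶜ z = ∣ z ∣² # 0#

  invᶜ : ∀ z → NonZeroᶜ z → ℂ
  invᶜ z z≠0 = (re z +i (- im z)) *ᶜ ofℝ (invℝ ∣ z ∣² z≠0)

  -- For ε > 0 this says ∣ z - w ∣ < ε.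
  Close : ℝ → ℂ → ℂ → Set ℓ₃
  Close ε z w = ∣ z -ᶜ w ∣² < ε * ε

  infix 4 _⟶_
  _⟶_ : (ℕ → ℂ) → ℂ → Set (c ⊔ ℓ₃)
  a ⟶ L = ∀ ε → 0# < ε → ∃[ M ] (∀ n → M ℕ.≤ n → Close ε (a n) L)

  partialSum : (ℕ → ℂ) → ℕ → ℂ
  partialSum f zero    = 0ᶜ
  partialSum f (suc n) = partialSum f n +ᶜ f n

  IsSeriesSum : (ℕ → ℂ) → ℂ → Set (c ⊔ ℓ₃)
  IsSeriesSum f S = partialSum f ⟶ S

  -- Unconditional convergence of a family: the net of sums over finite
  -- subsets (duplicate-free lists), directed by inclusion, tends to S.
  HasSum : {I : Set} → (I → ℂ) → ℂ → Set (c ⊔ ℓ₃)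
  HasSum {I} f S = ∀ ε → 0# < ε →
    Σ (List I) λ F → ∀ G → Unique G → F ⊆ G →
      Close ε (List.foldr (λ x s → f x +ᶜ s) 0ᶜ G) S

  IsExp : (ℂ → ℂ) → Set (c ⊔ ℓ₃)
  IsExp exp = ∀ z →
    IsSeriesSum (λ n → ofℝ (recipℕ (n !) {{n !≢0}}) *ᶜ (z ^ᶜ n)) (exp z)

  -- π is the least positive zero of sin x = im (exp (ix)).
  record IsPi (exp : ℂ → ℂ) (π : ℝ) : Set (c ⊔ ℓ₁ ⊔ ℓ₃) where
    field
      positive : 0# < π
      sinπ≈0   : im (exp (0# +i π)) ≈ 0#
      least    : ∀ x → 0# < x → x < π → 0# < im (exp (0# +i x))

-- n ⟨ j ⟩ is the component n_j of (n_1, …, n_k); it is 0 for j outside 1, …, k.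
infix 9 _⟨_⟩
_⟨_⟩ : ∀ {k} → Vec ℕ k → ℕ → ℕ
[]       ⟨ _ ⟩           = 0
(x ∷ xs) ⟨ zero ⟩        = 0
(x ∷ xs) ⟨ suc zero ⟩    = x
(x ∷ xs) ⟨ suc (suc j) ⟩ = xs ⟨ suc j ⟩

-- f a + f (a + 1) + ⋯ + f b, which is 0 when b < a.
∑[_⋯_] : ℕ → ℕ → (ℕ → ℕ) → ℕ
∑[ a ⋯ b ] f = sum (List.applyUpTo (λ j → f (a ℕ.+ j)) (suc b ℕ.∸ a))

N : ∀ {k} → Vec ℕ k → ℕ → ℕ
N {k} n j = ∑[ j ⋯ k ] (n ⟨_⟩)

ℤ⇒ℚ : ℤ → ℚ
ℤ⇒ℚ m = m ℚ./ 1

ℕ⇒ℚ : ℕ → ℚ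
ℕ⇒ℚ m = ℤ⇒ℚ (+ m)

thetaExponent : (k i : ℕ) (ℓ n : ℤ) → ℚ
thetaExponent k i ℓ n =
  (ℕ⇒ℚ k ℚ.+ ½) ℚ.* (x ℚ.* x) ℚ.- (y ℤ.* y) ℚ./ (2 ℕ.+ 4 ℕ.* k)
  where
    x = ℤ⇒ℚ n ℚ.+ (+ i) ℚ./ (1 ℕ.+ 2 ℕ.* k)
    y = + 2 ℤ.* + k ℤ.* ℓ ℤ.+ + i ℤ.+ ℓ

multisumExponent : (k i : ℕ) (ℓ : ℤ) → Vec ℕ k → ℚ
multisumExponent k i ℓ n =
  (+ (N₁ ℕ.* (N₁ ℕ.+ 1))) ℚ./ 2
    ℚ.+ ℕ⇒ℚ (∑[ 2 ⋯ k ] (λ j → N n j ℕ.* N n j))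
    ℚ.+ (ℤ⇒ℚ ℓ ℚ.+ ½) ℚ.* ℕ⇒ℚ N₁
    ℚ.+ ℤ⇒ℚ (+ 2 ℤ.* ℓ ℤ.+ + 1) ℚ.* ℕ⇒ℚ (∑[ 2 ⋯ k ] (N n))
    ℚ.- ℕ⇒ℚ (∑[ 1 ⋯ k ℕ.∸ i ] (N n))
  where
    N₁ = N n 1

module QSeries {c ℓ₁ ℓ₂ ℓ₃ : Level} (ℛ : RealNumbers c ℓ₁ ℓ₂ ℓ₃)
               (exp : Analysis.ℂ ℛ → Analysis.ℂ ℛ)
               (π : Analysis.ℝ ℛ) (τ : Analysis.ℂ ℛ) where

  open Analysis ℛ

  q^ : ℚ → ℂ
  q^ r = exp ((0# +i (π + π)) *ᶜ ofℝ (fromℚ r) *ᶜ τ)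

  q : ℂ
  q = q^ ℚ.1ℚ

  -q½ : ℂ
  -q½ = -ᶜ q^ ½

  poch : ℂ → ℕ → ℂ
  poch a zero    = 1ᶜ
  poch a (suc n) = poch a n *ᶜ (1ᶜ -ᶜ a *ᶜ (q ^ᶜ n))

  -- The value at negative indices is a dummy: in the multisum, N₁ + ℓ < 0
  -- forces n_k + 2ℓ < 0, and such summands vanish by 1/pochℤ.
  pochℤ : ℂ → ℤ → ℂ
  pochℤ a (+ n)    = poch a n
  pochℤ a -[1+ _ ] = 0ᶜ

  module _ (qₙ≠0 : ∀ m → NonZeroᶜ (poch q m)) where

    1/poch : ℕ → ℂ
    1/poch m = invᶜ (poch q m) (qₙ≠0 m)

    1/pochℤ : ℤ → ℂ
    1/pochℤ (+ m)    = 1/poch m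
    1/pochℤ -[1+ _ ] = 0ᶜ

    multisumTerm : (k i : ℕ) (ℓ : ℤ) → Vec ℕ k → ℂ
    multisumTerm k i ℓ n =
      q^ (multisumExponent k i ℓ n)
        *ᶜ pochℤ -q½ (+ N n 1 ℤ.+ ℓ)
        *ᶜ List.foldr (λ m p → 1/poch m *ᶜ p) 1ᶜ (toList n)
        *ᶜ 1/pochℤ (+ (n ⟨ k ⟩) ℤ.+ + 2 ℤ.* ℓ)

  thetaTerm : (k i : ℕ) (ℓ n : ℤ) → ℂ
  thetaTerm k i ℓ n = q^ (thetaExponent k i ℓ n)

module Submission where

-- Put h = q^(1/2), e n = 1/(q)_n (zero for n < 0) and let ℓ ≥ 0.  The argument runs through the bilateral
-- Bailey lattice with the kernel U r n = e (n - r) e (n + r + 2ℓ).  It starts from the innermost factor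
-- 1/((q)_n (q)_(n+2ℓ)) of the multisum, which is U 0 n.
--
-- Summing in the variables N_1 ≥ N_2 ≥ ⋯ ≥ N_k, each summation over some N_j is a convolution with e, and
-- two cases of the q-Chu-Vandermonde sum (qVandermonde) say that such a convolution preserves the kernel:
-- with weight q^(N² + 2ℓN) it multiplies U r by q^(r² + 2ℓr) (q-step), and with the weight
-- h^(N² + 2ℓN) (-h)_(N+ℓ) of the outermost variable it multiplies U r by h^(r² + 2ℓr) (-h)_(L+ℓ) (h-step).
-- Without further factors U 0 would simply reproduce itself.  The i innermost variables carry an
-- additional q^N, and here the theta series enters: U 0 telescopes into a sum of multiples of
-- U r - q^(2r+2ℓ+1) U (r + 1), and multiplying such a difference by q^N yields q^r (U r - U (r + 1))
-- (U-shift), which the next step turns back into a multiple of a difference of the first kind.  The result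
-- is a finite identity (finiteIdentity), valid in every commutative ring containing the e n: the multisum,
-- with every summand multiplied by 1/(q)_(L-N_1), equals
--   (-h)_(L+ℓ) times the sum over s ≥ 0 of h^(upper s) U s L - h^(lower s) U (s + 1) L,
-- where upper s and lower s are the doubled theta exponents at n = ℓ + s and n = - ℓ - 1 - s.
--
-- For L → ∞ both kernels tend to 1/(q)_∞², and (-h)_(L+ℓ) to (-h)_∞; dividing by 1/(q)_∞ gives the
-- proposition.  All limits are geometric.  Since Im τ > 0, the norm of h is at most t² for some t < 1
-- (exp-bound), every summand of the multisum is O(t^(2 N_1)) and 1/(q)_n differs from its limit by O(t^n), so
-- replacing 1/(q)_(L-N_1) by 1/(q)_∞ costs O(t^L) (dominated-cube); the same bound gives unconditional
-- convergence (unconditional).  The infinite products converge because partial products of factors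
-- 1 + O(t^n) are bounded by an exponential (product-converges).  The functional equation of exp, needed to
-- write q^r as a power of h and to bound h, is another instance of dominated convergence, applied to the
-- Cauchy product of the two series (exp-+).
--
-- For ℓ < 0, only summands with n_k ≥ -2ℓ contribute.  Lowering n_k by -2ℓ turns the multisum for ℓ into
-- the one for -ℓ times h^(-4iℓ), and the theta series changes by the same factor; both signs are treated at
-- once with the shift σ ℓ = ∣ℓ∣ - ℓ.

open import Defs
import Algebra.Apartness.Bundles as Apartness
open import Algebra.Bundles using (CommutativeRing)
import Algebra.Properties.AbelianGroup
import Algebra.Properties.Ring
import Algebra.Properties.Semiring.Exp
import Algebra.Properties.Semiring.Mult
import Algebra.Properties.Semiring.Mult.TCOptimised
import Algebra.Solver.Ring
open import Algebra.Solver.Ring.AlmostCommutativeRing using (AlmostCommutativeRing; _-Raw-AlmostCommutative⟶_; fromCommutativeRing)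
open import Data.Bool.Base using (false; if_then_else_; true)
open import Data.Integer.Base as ℤ using (+0; +[1+_]; +_; -[1+_]; ℤ; ∣_∣)
import Data.Integer.GCD as ℤ
import Data.Integer.Properties as ℤₚ
open import Data.List.Base as List using (List)
open import Data.List.Membership.Propositional using (_∈_; _∉_)
import Data.List.Membership.Propositional.Properties as ∈ₚ
open import Data.List.Relation.Binary.Permutation.Propositional as Perm using (_↭_; ↭-sym; ↭-trans; ↭⇒↭ₛ)
import Data.List.Relation.Binary.Permutation.Propositional.Properties as ↭ₚ
import Data.List.Relation.Binary.Permutation.Setoid.Properties as ↭ₛₚ
open import Data.List.Relation.Binary.Subset.Propositional using (_⊆_)
import Data.List.Relation.Unary.All as All
import Data.List.Relation.Unary.AllPairs as AllPairs
open import Data.List.Relation.Unary.Any using (here; there)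
open import Data.List.Relation.Unary.Unique.Propositional using (Unique)
import Data.List.Relation.Unary.Unique.Propositional.Properties as Uniqueₚ
open import Data.Maybe.Base as Maybe using (Maybe; just; nothing)
open import Data.Nat.Base as ℕ using (_!; suc; s≤s; zero; z≤n; ℕ)
import Data.Nat.Properties as ℕₚ
open import Data.Nat.Tactic.RingSolver using () renaming (solve to solveℕ)
open import Data.Product.Base using (_,_; _×_; proj₁; proj₂; Σ; ∃-syntax)
open import Data.Rational.Base as ℚ using (mkℚ; ℚ; ↥_; ↧_; ↧ₙ_)
import Data.Rational.Properties as ℚₚ
open import Data.Sum.Base using ([_,_]′; _⊎_; inj₁; inj₂)
open import Data.Vec.Base as Vec using (Vec)
import Data.Vec.Properties as Vecₚ
open import Level using (Level; _⊔_) renaming (suc to lsuc)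
open import Relation.Binary.PropositionalEquality as ≡ using (_≡_)
import Relation.Binary.Reasoning.Setoid
open import Relation.Nullary using (contradiction; no; yes; ¬_)

-- Ring identities with integer coefficients

-- The canonical map from the integers to a commutative ring is a homomorphism;
-- it provides the coefficients of a normalisation procedure for ring identities.
module IntegerCoefficients {c ℓ : Level} (R : CommutativeRing c ℓ) where

  open CommutativeRing R
  open Algebra.Properties.Ring ring using (-‿distribˡ-*; -‿involutive; -0#≈0#)
  open Algebra.Properties.AbelianGroup +-abelianGroup using (⁻¹-∙-comm)
  open Algebra.Properties.Semiring.Mult.TCOptimised semiring using (×1-homo-*; ×-homo-+; 1+×) renaming (_×_ to _×′_)
  open Relation.Binary.Reasoning.Setoid setoid

  fromInteger : ℤ → Carrier
  fromInteger (+ n)    = n ×′ 1#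
  fromInteger -[1+ n ] = - (suc n ×′ 1#)

  fromInteger-neg : ∀ x → fromInteger (ℤ.- x) ≈ - fromInteger x
  fromInteger-neg +0       = sym -0#≈0#
  fromInteger-neg +[1+ n ] = refl
  fromInteger-neg -[1+ n ] = sym (-‿involutive _)

  private
    cancel : ∀ a b → (1# + a) - (1# + b) ≈ a - b
    cancel a b = begin
      (1# + a) - (1# + b)       ≈⟨ +-congˡ (⁻¹-∙-comm 1# b) ⟨
      (1# + a) + (- 1# + - b)   ≈⟨ +-assoc _ _ _ ⟨
      (1# + a) + - 1# + - b     ≈⟨ +-congʳ (+-congʳ (+-comm 1# a)) ⟩
      (a + 1#) + - 1# + - b     ≈⟨ +-congʳ (+-assoc _ _ _) ⟩
      a + (1# + - 1#) + - b     ≈⟨ +-congʳ (+-congˡ (-‿inverseʳ 1#)) ⟩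
      a + 0# + - b              ≈⟨ +-congʳ (+-identityʳ a) ⟩
      a - b                     ∎

  fromInteger-⊖ : ∀ m n → fromInteger (m ℤ.⊖ n) ≈ m ×′ 1# - n ×′ 1#
  fromInteger-⊖ m       zero    = sym (trans (+-congˡ -0#≈0#) (+-identityʳ _))
  fromInteger-⊖ zero    (suc n) = sym (+-identityˡ _)
  fromInteger-⊖ (suc m) (suc n) = begin
    fromInteger (suc m ℤ.⊖ suc n)    ≡⟨ ≡.cong fromInteger (ℤₚ.[1+m]⊖[1+n]≡m⊖n m n) ⟩
    fromInteger (m ℤ.⊖ n)            ≈⟨ fromInteger-⊖ m n ⟩
    m ×′ 1# - n ×′ 1#                ≈⟨ cancel _ _ ⟨
    (1# + m ×′ 1#) - (1# + n ×′ 1#)  ≈⟨ +-cong (1+× m 1#) (-‿cong (1+× n 1#)) ⟨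
    suc m ×′ 1# - suc n ×′ 1#        ∎

  fromInteger-+ : ∀ x y → fromInteger (x ℤ.+ y) ≈ fromInteger x + fromInteger y
  fromInteger-+ (+ m)    (+ n)    = ×-homo-+ 1# m n
  fromInteger-+ (+ m)    -[1+ n ] = fromInteger-⊖ m (suc n)
  fromInteger-+ -[1+ m ] (+ n)    = trans (fromInteger-⊖ n (suc m)) (+-comm _ _)
  fromInteger-+ -[1+ m ] -[1+ n ] = begin
    - (suc (suc (m ℕ.+ n)) ×′ 1#)     ≡⟨ ≡.cong (λ j → - (suc j ×′ 1#)) (ℕₚ.+-suc m n) ⟨
    - ((suc m ℕ.+ suc n) ×′ 1#)       ≈⟨ -‿cong (×-homo-+ 1# (suc m) (suc n)) ⟩
    - (suc m ×′ 1# + suc n ×′ 1#)     ≈⟨ ⁻¹-∙-comm _ _ ⟨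
    - (suc m ×′ 1#) - (suc n ×′ 1#)   ∎

  private
    pos* : ∀ m n → fromInteger (+ m ℤ.* + n) ≈ fromInteger (+ m) * fromInteger (+ n)
    pos* m n = trans (reflexive (≡.cong fromInteger (≡.sym (ℤₚ.pos-* m n)))) (×1-homo-* m n)

    -- Multiplicativity for x implies multiplicativity for - x.
    negˡ : ∀ x y → fromInteger (x ℤ.* y) ≈ fromInteger x * fromInteger y →
           fromInteger (ℤ.- x ℤ.* y) ≈ fromInteger (ℤ.- x) * fromInteger y
    negˡ x y eq = begin
      fromInteger (ℤ.- x ℤ.* y)          ≡⟨ ≡.cong fromInteger (ℤₚ.neg-distribˡ-* x y) ⟨
      fromInteger (ℤ.- (x ℤ.* y))        ≈⟨ fromInteger-neg (x ℤ.* y) ⟩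
      - fromInteger (x ℤ.* y)            ≈⟨ -‿cong eq ⟩
      - (fromInteger x * fromInteger y)  ≈⟨ -‿distribˡ-* _ _ ⟩
      - fromInteger x * fromInteger y    ≈⟨ *-congʳ (fromInteger-neg x) ⟨
      fromInteger (ℤ.- x) * fromInteger y ∎

    pos*any : ∀ m y → fromInteger (+ m ℤ.* y) ≈ fromInteger (+ m) * fromInteger y
    pos*any m (+ n)    = pos* m n
    pos*any m -[1+ n ] = begin
      fromInteger (+ m ℤ.* -[1+ n ])       ≡⟨ ≡.cong fromInteger (ℤₚ.*-comm (+ m) -[1+ n ]) ⟩
      fromInteger (-[1+ n ] ℤ.* + m)       ≈⟨ negˡ +[1+ n ] (+ m) (pos* (suc n) m) ⟩
      fromInteger -[1+ n ] * fromInteger (+ m) ≈⟨ *-comm _ _ ⟩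
      fromInteger (+ m) * fromInteger -[1+ n ] ∎

  fromInteger-* : ∀ x y → fromInteger (x ℤ.* y) ≈ fromInteger x * fromInteger y
  fromInteger-* (+ m)    y = pos*any m y
  fromInteger-* -[1+ m ] y = negˡ +[1+ m ] y (pos*any (suc m) y)

  private
    coefficient≟ : ∀ x y → Maybe (fromInteger x ≈ fromInteger y)
    coefficient≟ x y with x ℤₚ.≟ y
    ... | yes ≡.refl = just refl
    ... | no  _      = nothing

  almostCommutativeRing : AlmostCommutativeRing c ℓ
  almostCommutativeRing = fromCommutativeRing R

  homomorphism : ℤ.+-*-rawRing -Raw-AlmostCommutative⟶ almostCommutativeRing
  homomorphism = record
    { ⟦_⟧    = fromInteger
    ; +-homo = fromInteger-+
    ; *-homo = fromInteger-*
    ; -‿homo = fromInteger-neg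
    ; 0-homo = refl
    ; 1-homo = refl
    }

  module Solver = Algebra.Solver.Ring ℤ.+-*-rawRing almostCommutativeRing homomorphism coefficient≟

-- Finite sums

module FiniteSums {c ℓ : Level} (R : CommutativeRing c ℓ) where

  open CommutativeRing R
  open Relation.Binary.Reasoning.Setoid setoid
  open IntegerCoefficients R using (module Solver)
  open Solver using (solve; _:=_; _:+_; _:-_; :-_)

  -- f 0 + f 1 + ⋯ + f (n - 1).
  ∑ : ℕ → (ℕ → Carrier) → Carrier
  ∑ zero    f = 0#
  ∑ (suc n) f = ∑ n f + f n

  ∑-cong : ∀ n {f g : ℕ → Carrier} → (∀ j → j ℕ.< n → f j ≈ g j) → ∑ n f ≈ ∑ n g
  ∑-cong zero    eq = refl
  ∑-cong (suc n) eq = +-cong (∑-cong n λ j j<n → eq j (ℕₚ.m<n⇒m<1+n j<n)) (eq n (ℕₚ.n<1+n n))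

  ∑-zero : ∀ n {f : ℕ → Carrier} → (∀ j → j ℕ.< n → f j ≈ 0#) → ∑ n f ≈ 0#
  ∑-zero zero    eq = refl
  ∑-zero (suc n) eq =
    trans (+-cong (∑-zero n λ j j<n → eq j (ℕₚ.m<n⇒m<1+n j<n)) (eq n (ℕₚ.n<1+n n))) (+-identityˡ 0#)

  ∑-+ : ∀ n (f g : ℕ → Carrier) → ∑ n (λ j → f j + g j) ≈ ∑ n f + ∑ n g
  ∑-+ zero    f g = sym (+-identityˡ 0#)
  ∑-+ (suc n) f g = trans (+-congʳ (∑-+ n f g))
    (solve 4 (λ a b x y → (a :+ b) :+ (x :+ y) := (a :+ x) :+ (b :+ y)) refl _ _ _ _)

  ∑-minus : ∀ n (f g : ℕ → Carrier) → ∑ n (λ j → f j - g j) ≈ ∑ n f - ∑ n g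
  ∑-minus zero    f g = sym (-‿inverseʳ 0#)
  ∑-minus (suc n) f g = trans (+-congʳ (∑-minus n f g))
    (solve 4 (λ a b x y → (a :- b) :+ (x :- y) := (a :+ x) :- (b :+ y)) refl _ _ _ _)

  ∑-*ˡ : ∀ n x (f : ℕ → Carrier) → ∑ n (λ j → x * f j) ≈ x * ∑ n f
  ∑-*ˡ zero    x f = sym (zeroʳ x)
  ∑-*ˡ (suc n) x f = trans (+-congʳ (∑-*ˡ n x f)) (sym (distribˡ x _ _))

  ∑-front : ∀ n (f : ℕ → Carrier) → ∑ (suc n) f ≈ f 0 + ∑ n (λ j → f (suc j))
  ∑-front zero    f = +-comm _ _
  ∑-front (suc n) f = trans (+-congʳ (∑-front n f)) (+-assoc _ _ _)

  ∑-swap : ∀ m n (f : ℕ → ℕ → Carrier) → ∑ m (λ i → ∑ n (f i)) ≈ ∑ n (λ j → ∑ m (λ i → f i j))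
  ∑-swap m zero    f = ∑-zero m (λ _ _ → refl)
  ∑-swap m (suc n) f = trans (∑-+ m _ _) (+-congʳ (∑-swap m n f))

  ∑-telescope : ∀ n (f : ℕ → Carrier) → ∑ n (λ j → f j - f (suc j)) ≈ f 0 - f n
  ∑-telescope zero    f = sym (-‿inverseʳ (f 0))
  ∑-telescope (suc n) f = trans (+-congʳ (∑-telescope n f))
    (solve 3 (λ a b x → (a :- b) :+ (b :- x) := a :- x) refl _ _ _)

  -- The sum of f a b over a + b ≡ n.
  conv : ℕ → (ℕ → ℕ → Carrier) → Carrier
  conv zero    f = f 0 0
  conv (suc n) f = f 0 (suc n) + conv n (λ a b → f (suc a) b)

  conv-cong : ∀ n {f g : ℕ → ℕ → Carrier} → (∀ a b → a ℕ.+ b ≡ n → f a b ≈ g a b) → conv n f ≈ conv n g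
  conv-cong zero    eq = eq 0 0 ≡.refl
  conv-cong (suc n) eq = +-cong (eq 0 (suc n) ≡.refl) (conv-cong n λ a b a+b≡n → eq (suc a) b (≡.cong suc a+b≡n))

  conv-+ : ∀ n (f g : ℕ → ℕ → Carrier) → conv n (λ a b → f a b + g a b) ≈ conv n f + conv n g
  conv-+ zero    f g = refl
  conv-+ (suc n) f g = trans (+-congˡ (conv-+ n _ _))
    (solve 4 (λ a b x y → (a :+ b) :+ (x :+ y) := (a :+ x) :+ (b :+ y)) refl _ _ _ _)

  conv-*ˡ : ∀ n x (f : ℕ → ℕ → Carrier) → conv n (λ a b → x * f a b) ≈ x * conv n f
  conv-*ˡ zero    x f = refl
  conv-*ˡ (suc n) x f = trans (+-congˡ (conv-*ˡ n x _)) (sym (distribˡ x _ _))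

  conv-back : ∀ n (f : ℕ → ℕ → Carrier) → conv (suc n) f ≈ conv n (λ a b → f a (suc b)) + f (suc n) 0
  conv-back zero    f = refl
  conv-back (suc n) f = trans (+-congˡ (conv-back n (λ a b → f (suc a) b))) (sym (+-assoc _ _ _))

  -- delay a n r is a (n - r), and 0 when n < r.
  delay : (ℕ → Carrier) → ℕ → ℕ → Carrier
  delay a n       zero    = a n
  delay a zero    (suc r) = 0#
  delay a (suc n) (suc r) = delay a n r

  delay-diag : ∀ a r m → delay a (r ℕ.+ m) r ≡ a m
  delay-diag a zero    m = ≡.refl
  delay-diag a (suc r) m = delay-diag a r m

  delay-vanish : ∀ a {n r} → n ℕ.< r → delay a n r ≡ 0#
  delay-vanish a {zero}  (s≤s _)   = ≡.refl
  delay-vanish a {suc n} (s≤s n<r) = delay-vanish a n<r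

  -- Summation against a delayed sequence is a convolution.
  ∑-delay : ∀ M L a (f : ℕ → Carrier) → L ℕ.< M → ∑ M (λ n → delay a L n * f n) ≈ conv L (λ i j → a j * f i)
  ∑-delay (suc M) zero    a f _         = trans (∑-front M _) (trans (+-congˡ (∑-zero M λ _ _ → zeroˡ _)) (+-identityʳ _))
  ∑-delay (suc M) (suc L) a f (s≤s L<M) = trans (∑-front M _) (+-congˡ (∑-delay M L a (λ n → f (suc n)) L<M))

  -- Summation over the vectors with all components below M.
  ∑cube : ∀ k → ℕ → (Vec ℕ k → Carrier) → Carrier
  ∑cube zero    M f = f Vec.[]
  ∑cube (suc k) M f = ∑ M λ n → ∑cube k M λ v → f (n Vec.∷ v)

  ∑cube-cong : ∀ k M {f g : Vec ℕ k → Carrier} → (∀ v → f v ≈ g v) → ∑cube k M f ≈ ∑cube k M g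
  ∑cube-cong zero    M eq = eq Vec.[]
  ∑cube-cong (suc k) M eq = ∑-cong M λ n _ → ∑cube-cong k M λ v → eq (n Vec.∷ v)

  ∑cube-+ : ∀ k M (f g : Vec ℕ k → Carrier) → ∑cube k M (λ v → f v + g v) ≈ ∑cube k M f + ∑cube k M g
  ∑cube-+ zero    M f g = refl
  ∑cube-+ (suc k) M f g = trans (∑-cong M λ n _ → ∑cube-+ k M _ _) (∑-+ M _ _)

  ∑cube-*ˡ : ∀ k M x (f : Vec ℕ k → Carrier) → ∑cube k M (λ v → x * f v) ≈ x * ∑cube k M f
  ∑cube-*ˡ zero    M x f = refl
  ∑cube-*ˡ (suc k) M x f = trans (∑-cong M λ n _ → ∑cube-*ˡ k M x _) (∑-*ˡ M x _)

  ∑cube-∑ : ∀ k M n (f : ℕ → Vec ℕ k → Carrier) →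
            ∑cube k M (λ v → ∑ n (λ j → f j v)) ≈ ∑ n (λ j → ∑cube k M (f j))
  ∑cube-∑ k M zero    f = trans (∑cube-cong k M λ _ → sym (zeroˡ 0#)) (trans (∑cube-*ˡ k M 0# (λ _ → 0#)) (zeroˡ _))
  ∑cube-∑ k M (suc n) f = trans (∑cube-+ k M _ _) (+-congʳ (∑cube-∑ k M n f))

-- The q-Chu-Vandermonde sum

-- The sequence e n = 1/(q)_n in a commutative ring, given by its recurrence.
record QFactorialReciprocals {c ℓ : Level} (R : CommutativeRing c ℓ) (q : CommutativeRing.Carrier R) : Set (c ⊔ ℓ) where
  open CommutativeRing R
  open Algebra.Properties.Semiring.Exp semiring using (_^_)
  field
    e      : ℕ → Carrier
    e-zero : e 0 ≈ 1#
    e-step : ∀ n → e n ≈ (1# - q ^ suc n) * e (suc n)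

-- q-Pochhammer symbols and the q-Vandermonde summation in a commutative ring.
module QVandermonde {c ℓ : Level} (R : CommutativeRing c ℓ) (q : CommutativeRing.Carrier R)
  (reciprocals : QFactorialReciprocals R q) where

  open CommutativeRing R
  open QFactorialReciprocals reciprocals
  open Algebra.Properties.Semiring.Exp semiring using (_^_)
  open Algebra.Properties.Semiring.Exp semiring using (^-homo-*; ^-congʳ)
  open Relation.Binary.Reasoning.Setoid setoid
  open IntegerCoefficients R using (module Solver)
  open Solver using (solve; _:=_; _:+_; _:*_; _:-_; :-_; con)
  open FiniteSums R

  -- The q-Pochhammer symbol (a)_n.
  poch : Carrier → ℕ → Carrier
  poch a zero    = 1#
  poch a (suc n) = poch a n * (1# - a * q ^ n)

  poch-cong : ∀ n {a b} → a ≈ b → poch a n ≈ poch b n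
  poch-cong zero    eq = refl
  poch-cong (suc n) eq = *-cong (poch-cong n eq) (+-congˡ (-‿cong (*-congʳ eq)))

  poch-+ : ∀ a m n → poch a (m ℕ.+ n) ≈ poch a m * poch (a * q ^ m) n
  poch-+ a m zero    rewrite ℕₚ.+-identityʳ m = sym (*-identityʳ _)
  poch-+ a m (suc n) rewrite ℕₚ.+-suc m n = begin
    poch a (m ℕ.+ n) * (1# - a * q ^ (m ℕ.+ n))
      ≈⟨ *-cong (poch-+ a m n) (+-congˡ (-‿cong (*-congˡ (^-homo-* q m n)))) ⟩
    poch a m * poch (a * q ^ m) n * (1# - a * (q ^ m * q ^ n))
      ≈⟨ solve 5 (λ x y a u v → x :* y :* (con (+ 1) :- a :* (u :* v)) := x :* (y :* (con (+ 1) :- a :* u :* v))) refl _ _ a _ _ ⟩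
    poch a m * (poch (a * q ^ m) n * (1# - a * q ^ m * q ^ n)) ∎

  -- (q^(n+1))_b divided by (q)_(n+b) is 1/(q)_n.
  poch-e : ∀ n b → poch (q ^ suc n) b * e (n ℕ.+ b) ≈ e n
  poch-e n zero    rewrite ℕₚ.+-identityʳ n = *-identityˡ _
  poch-e n (suc b) = begin
    poch (q ^ suc n) b * (1# - q ^ suc n * q ^ b) * e (n ℕ.+ suc b)
      ≡⟨ ≡.cong (λ m → poch (q ^ suc n) b * (1# - q ^ suc n * q ^ b) * e m) (ℕₚ.+-suc n b) ⟩
    poch (q ^ suc n) b * (1# - q ^ suc n * q ^ b) * e (suc (n ℕ.+ b))
      ≈⟨ *-assoc _ _ _ ⟩
    poch (q ^ suc n) b * ((1# - q ^ suc n * q ^ b) * e (suc (n ℕ.+ b)))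
      ≈⟨ *-congˡ (*-congʳ (+-congˡ (-‿cong (^-homo-* q (suc n) b)))) ⟨
    poch (q ^ suc n) b * ((1# - q ^ suc (n ℕ.+ b)) * e (suc (n ℕ.+ b)))
      ≈⟨ *-congˡ (e-step (n ℕ.+ b)) ⟨
    poch (q ^ suc n) b * e (n ℕ.+ b)
      ≈⟨ poch-e n b ⟩
    e n ∎

  -- The product of x q^j - z over j < s.
  rise : Carrier → Carrier → ℕ → Carrier
  rise x z zero    = 1#
  rise x z (suc s) = rise x z s * (x * q ^ s - z)

  rise-front : ∀ x z s → rise x z (suc s) ≈ (x - z) * rise (x * q) z s
  rise-front x z zero    = solve 2 (λ x z → con (+ 1) :* (x :* con (+ 1) :- z) := (x :- z) :* con (+ 1)) refl x z
  rise-front x z (suc s) = begin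
    rise x z (suc s) * (x * (q * q ^ s) - z)
      ≈⟨ *-cong (rise-front x z s) (+-congʳ (sym (*-assoc x q _))) ⟩
    (x - z) * rise (x * q) z s * (x * q * q ^ s - z)
      ≈⟨ *-assoc _ _ _ ⟩
    (x - z) * rise (x * q) z (suc s) ∎

  -- s (s - 1)/2.
  tri : ℕ → ℕ
  tri zero    = 0
  tri (suc s) = tri s ℕ.+ s

  private
    -- The q-Pascal rule (1 - q^(a+b)) = q^b (1 - q^a) + (1 - q^b), summed over a + b = n + 1.
    pascal : ∀ n (G : ℕ → ℕ → Carrier) → (1# - q ^ suc n) * conv (suc n) (λ a b → e a * e b * G a b)
                   ≈ conv n (λ a b → e a * e b * (q ^ b * G (suc a) b + G a (suc b)))
    pascal n G = begin
      (1# - q ^ suc n) * conv (suc n) (λ a b → e a * e b * G a b)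
        ≈⟨ conv-*ˡ (suc n) _ (λ a b → e a * e b * G a b) ⟨
      conv (suc n) (λ a b → (1# - q ^ suc n) * (e a * e b * G a b))
        ≈⟨ conv-cong (suc n) split ⟩
      conv (suc n) (λ a b → (1# - q ^ a) * (q ^ b * (e a * e b * G a b)) + (1# - q ^ b) * (e a * e b * G a b))
        ≈⟨ conv-+ (suc n) (λ a b → (1# - q ^ a) * (q ^ b * (e a * e b * G a b))) (λ a b → (1# - q ^ b) * (e a * e b * G a b)) ⟩
      conv (suc n) (λ a b → (1# - q ^ a) * (q ^ b * (e a * e b * G a b))) + conv (suc n) (λ a b → (1# - q ^ b) * (e a * e b * G a b))
        ≈⟨ +-cong left right ⟩
      conv n (λ a b → e a * e b * (q ^ b * G (suc a) b)) + conv n (λ a b → e a * e b * G a (suc b))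
        ≈⟨ conv-+ n _ _ ⟨
      conv n (λ a b → e a * e b * (q ^ b * G (suc a) b) + e a * e b * G a (suc b))
        ≈⟨ conv-cong n (λ a b _ → distribˡ _ _ _) ⟨
      conv n (λ a b → e a * e b * (q ^ b * G (suc a) b + G a (suc b))) ∎
      where
      kill : ∀ x → (1# - q ^ 0) * x ≈ 0#
      kill x = trans (*-congʳ (-‿inverseʳ 1#)) (zeroˡ x)
      split : ∀ a b → a ℕ.+ b ≡ suc n → (1# - q ^ suc n) * (e a * e b * G a b)
              ≈ (1# - q ^ a) * (q ^ b * (e a * e b * G a b)) + (1# - q ^ b) * (e a * e b * G a b)
      split a b eq = begin
        (1# - q ^ suc n) * (e a * e b * G a b)
          ≈⟨ *-congʳ (+-congˡ (-‿cong (trans (^-congʳ q (≡.sym eq)) (^-homo-* q a b)))) ⟩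
        (1# - q ^ a * q ^ b) * (e a * e b * G a b)
          ≈⟨ solve 3 (λ x y g → (con (+ 1) :- x :* y) :* g := (con (+ 1) :- x) :* (y :* g) :+ (con (+ 1) :- y) :* g) refl _ _ _ ⟩
        (1# - q ^ a) * (q ^ b * (e a * e b * G a b)) + (1# - q ^ b) * (e a * e b * G a b) ∎
      left : conv (suc n) (λ a b → (1# - q ^ a) * (q ^ b * (e a * e b * G a b)))
           ≈ conv n (λ a b → e a * e b * (q ^ b * G (suc a) b))
      left = trans (+-congʳ (kill _)) (trans (+-identityˡ _) (conv-cong n λ a b _ → begin
        (1# - q ^ suc a) * (q ^ b * (e (suc a) * e b * G (suc a) b))
          ≈⟨ solve 5 (λ x y z u v → x :* (y :* (z :* u :* v)) := (x :* z) :* u :* (y :* v)) refl _ _ _ _ _ ⟩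
        (1# - q ^ suc a) * e (suc a) * e b * (q ^ b * G (suc a) b)
          ≈⟨ *-congʳ (*-congʳ (e-step a)) ⟨
        e a * e b * (q ^ b * G (suc a) b) ∎))
      right : conv (suc n) (λ a b → (1# - q ^ b) * (e a * e b * G a b))
            ≈ conv n (λ a b → e a * e b * G a (suc b))
      right = trans (conv-back n (λ a b → (1# - q ^ b) * (e a * e b * G a b))) (trans (+-congˡ (kill _)) (trans (+-identityʳ _) (conv-cong n λ a b _ → begin
        (1# - q ^ suc b) * (e a * e (suc b) * G a (suc b))
          ≈⟨ solve 4 (λ x y z u → x :* (y :* z :* u) := y :* (x :* z) :* u) refl _ _ _ _ ⟩
        e a * ((1# - q ^ suc b) * e (suc b)) * G a (suc b)
          ≈⟨ *-congʳ (*-congˡ (e-step b)) ⟨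
        e a * e b * G a (suc b) ∎)))

    -- e n is a unit, hence so is 1 - q^(n+1).
    unit : ∀ n → ((poch q n) * e (suc n)) * (1# - q ^ suc n) ≈ 1#
    unit n = begin
      poch q n * e (suc n) * (1# - q ^ suc n)
        ≈⟨ solve 3 (λ x y z → x :* y :* z := x :* (z :* y)) refl _ _ _ ⟩
      poch q n * ((1# - q ^ suc n) * e (suc n))
        ≈⟨ *-congˡ (e-step n) ⟨
      poch q n * e n
        ≈⟨ *-congʳ (poch-cong n (sym (*-identityʳ q))) ⟩
      poch (q ^ 1) n * e n
        ≈⟨ poch-e 0 n ⟩
      e 0 ≈⟨ e-zero ⟩
      1# ∎

    cancel : ∀ n {x y} → (1# - q ^ suc n) * x ≈ (1# - q ^ suc n) * y → x ≈ y
    cancel n {x} {y} eq = begin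
      x                                  ≈⟨ *-identityˡ x ⟨
      1# * x                             ≈⟨ *-congʳ (unit n) ⟨
      poch q n * e (suc n) * (1# - q ^ suc n) * x ≈⟨ *-assoc _ _ _ ⟩
      poch q n * e (suc n) * ((1# - q ^ suc n) * x) ≈⟨ *-congˡ eq ⟩
      poch q n * e (suc n) * ((1# - q ^ suc n) * y) ≈⟨ *-assoc _ _ _ ⟨
      poch q n * e (suc n) * (1# - q ^ suc n) * y ≈⟨ *-congʳ (unit n) ⟩
      1# * y                             ≈⟨ *-identityˡ y ⟩
      y ∎

  -- The q-Chu-Vandermonde sum in a form polynomial in x and z.  With a q-binomial coefficient in place of
  -- e a e b / e n, both sides are polynomials; the induction combines the sums for x and for x q.
  qVandermonde : ∀ n x z →
    conv n (λ a b → e a * e b * (rise x z a * q ^ tri a * poch (x * q ^ a) b)) ≈ e n * poch z n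
  qVandermonde zero    x z = trans
    (solve 1 (λ e → e :* e :* (con (+ 1) :* con (+ 1) :* con (+ 1)) := e :* e) refl _) (*-congˡ e-zero)
  qVandermonde (suc n) x z = cancel n (begin
    (1# - q ^ suc n) * conv (suc n) (λ a b → e a * e b * G x a b)
      ≈⟨ pascal n (G x) ⟩
    conv n (λ a b → e a * e b * (q ^ b * G x (suc a) b + G x a (suc b)))
      ≈⟨ conv-cong n termwise ⟩
    conv n (λ a b → q ^ n * (x - z) * (e a * e b * G (x * q) a b) + (1# - x * q ^ n) * (e a * e b * G x a b))
      ≈⟨ trans (conv-+ n _ _) (+-cong (conv-*ˡ n _ _) (conv-*ˡ n _ _)) ⟩
    q ^ n * (x - z) * conv n (λ a b → e a * e b * G (x * q) a b) + (1# - x * q ^ n) * conv n (λ a b → e a * e b * G x a b)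
      ≈⟨ +-cong (*-congˡ (qVandermonde n (x * q) z)) (*-congˡ (qVandermonde n x z)) ⟩
    q ^ n * (x - z) * (e n * poch z n) + (1# - x * q ^ n) * (e n * poch z n)
      ≈⟨ solve 5 (λ Q x z e p → Q :* (x :- z) :* (e :* p) :+ (con (+ 1) :- x :* Q) :* (e :* p)
                              := e :* (p :* (con (+ 1) :- z :* Q))) refl _ x z _ _ ⟩
    e n * (poch z n * (1# - z * q ^ n))
      ≈⟨ *-congʳ (e-step n) ⟩
    (1# - q ^ suc n) * e (suc n) * (poch z n * (1# - z * q ^ n))
      ≈⟨ *-assoc _ _ _ ⟩
    (1# - q ^ suc n) * (e (suc n) * poch z (suc n)) ∎)
    where
    G : Carrier → ℕ → ℕ → Carrier
    G x a b = rise x z a * q ^ tri a * poch (x * q ^ a) b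
    termwise : ∀ a b → a ℕ.+ b ≡ n →
      e a * e b * (q ^ b * G x (suc a) b + G x a (suc b))
      ≈ q ^ n * (x - z) * (e a * e b * G (x * q) a b) + (1# - x * q ^ n) * (e a * e b * G x a b)
    termwise a b ≡.refl = begin
      e a * e b * (q ^ b * (rise x z (suc a) * q ^ (tri a ℕ.+ a) * poch (x * (q * q ^ a)) b)
                  + rise x z a * q ^ tri a * (poch (x * q ^ a) b * (1# - x * q ^ a * q ^ b)))
        ≈⟨ *-congˡ (+-cong (*-congˡ (*-cong (*-cong (rise-front x z a) (^-homo-* q (tri a) a))
                                            (poch-cong b (sym (*-assoc x q _))))) refl) ⟩
      e a * e b * (q ^ b * ((x - z) * rise (x * q) z a * (q ^ tri a * q ^ a) * poch (x * q * q ^ a) b)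
                  + rise x z a * q ^ tri a * (poch (x * q ^ a) b * (1# - x * q ^ a * q ^ b)))
        ≈⟨ solve 10 (λ ee A B x w R T P' R' P → ee :* (B :* (w :* R :* (T :* A) :* P') :+ R' :* T :* (P :* (con (+ 1) :- x :* A :* B)))
             := A :* B :* w :* (ee :* (R :* T :* P')) :+ (con (+ 1) :- x :* (A :* B)) :* (ee :* (R' :* T :* P)))
             refl (e a * e b) (q ^ a) (q ^ b) x (x - z) (rise (x * q) z a) (q ^ tri a) (poch (x * q * q ^ a) b) (rise x z a) (poch (x * q ^ a) b) ⟩
      q ^ a * q ^ b * (x - z) * (e a * e b * G (x * q) a b) + (1# - x * (q ^ a * q ^ b)) * (e a * e b * G x a b)
        ≈⟨ +-cong (*-congʳ (*-congʳ (^-homo-* q a b))) (*-congʳ (+-congˡ (-‿cong (*-congˡ (^-homo-* q a b))))) ⟨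
      q ^ (a ℕ.+ b) * (x - z) * (e a * e b * G (x * q) a b) + (1# - x * q ^ (a ℕ.+ b)) * (e a * e b * G x a b) ∎

-- The Bailey kernel

-- The kernel 1/((q)_(n-r) (q)_(n+r+2ℓ)) for q = h² and its transformation under convolution with 1/(q)_n.
module BaileyChain {c r : Level} (R : CommutativeRing c r)
  (h : CommutativeRing.Carrier R) (reciprocals : QFactorialReciprocals R (CommutativeRing._*_ R h h)) (ℓ : ℕ) where

  open CommutativeRing R
  open QFactorialReciprocals reciprocals
  open Algebra.Properties.Semiring.Exp semiring using (_^_)

  open Algebra.Properties.Semiring.Exp semiring using (^-homo-*; ^-congʳ)
  open Relation.Binary.Reasoning.Setoid setoid
  open IntegerCoefficients R using (module Solver)
  open Solver using (solve; _:=_; _:+_; _:*_; _:-_; :-_; con)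
  open FiniteSums R
  open QVandermonde R (h * h) reciprocals public
  open import Data.List.Base using ([]; _∷_)

  q : Carrier
  q = h * h

  h^-cong : ∀ {m n} → m ≡ n → h ^ m ≈ h ^ n
  h^-cong eq = ^-congʳ h eq

  h^-* : ∀ {k} m n → m ℕ.+ n ≡ k → h ^ m * h ^ n ≈ h ^ k
  h^-* m n eq = trans (sym (^-homo-* h m n)) (h^-cong eq)

  q^≈ : ∀ n → q ^ n ≈ h ^ (2 ℕ.* n)
  q^≈ zero    = refl
  q^≈ (suc n) = begin
    h * h * q ^ n              ≈⟨ *-congˡ (q^≈ n) ⟩
    h * h * h ^ (2 ℕ.* n)      ≈⟨ *-assoc _ _ _ ⟩
    h ^ suc (suc (2 ℕ.* n))    ≈⟨ h^-cong {suc (suc (2 ℕ.* n))} {2 ℕ.* suc n} (solveℕ (n ∷ [])) ⟩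
    h ^ (2 ℕ.* suc n)          ∎

  -- 1/(q)_(n-r), which is 0 when n < r.
  e⊖ : ℕ → ℕ → Carrier
  e⊖ = delay e

  -- (1 - q^m)/(q)_m = 1/(q)_(m-1), also when m = 0.
  e⊖-next : ∀ r m → e⊖ (r ℕ.+ m) (suc r) ≈ (1# - q ^ m) * e m
  e⊖-next zero    zero    = sym (trans (*-congʳ (-‿inverseʳ 1#)) (zeroˡ _))
  e⊖-next zero    (suc m) = e-step m
  e⊖-next (suc r) m       = e⊖-next r m

  -- The Bailey kernel 1/((q)_(n-r) (q)_(n+r+2ℓ)).
  U : ℕ → ℕ → Carrier
  U r n = e⊖ n r * e (n ℕ.+ (r ℕ.+ 2 ℕ.* ℓ))

  U-vanish : ∀ {n r} → n ℕ.< r → U r n ≈ 0#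
  U-vanish n<r = trans (*-congʳ (reflexive (delay-vanish e n<r))) (zeroˡ _)

  -- Passage between the parameters q^(2ℓ) and q^(2ℓ+1): multiplication by q^n
  -- turns U r - q^(2r+2ℓ+1) U (r + 1) into q^r (U r - U (r + 1)).
  U-shift : ∀ r n → h ^ (2 ℕ.* n) * (U r n - h ^ (2 ℕ.* (2 ℕ.* r ℕ.+ 2 ℕ.* ℓ ℕ.+ 1)) * U (suc r) n)
                  ≈ h ^ (2 ℕ.* r) * (U r n - U (suc r) n)
  U-shift r n with r ℕₚ.≤? n
  ... | no r≰n = trans (*-congˡ (trans (+-cong U₀ (-‿cong (trans (*-congˡ U₁) (zeroʳ _)))) (-‿inverseʳ 0#)))
                 (trans (zeroʳ _) (sym (trans (*-congˡ (trans (+-cong U₀ (-‿cong U₁)) (-‿inverseʳ 0#))) (zeroʳ _))))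
    where
    U₀ = U-vanish (ℕₚ.≰⇒> r≰n)
    U₁ = U-vanish (ℕₚ.m<n⇒m<1+n (ℕₚ.≰⇒> r≰n))
  ... | yes r≤n with ℕₚ.m≤n⇒∃[o]m+o≡n r≤n
  ... | m , ≡.refl = begin
    h ^ (2 ℕ.* (r ℕ.+ m)) * (U r (r ℕ.+ m) - s * U (suc r) (r ℕ.+ m))
      ≈⟨ *-cong (sym (h^-* {2 ℕ.* (r ℕ.+ m)} (2 ℕ.* r) (2 ℕ.* m) (solveℕ (r ∷ m ∷ [])))) (+-cong U₀ (-‿cong (*-congˡ U₁))) ⟩
    h ^ (2 ℕ.* r) * h ^ (2 ℕ.* m) * (A * ((1# - s * h ^ (2 ℕ.* m)) * B) - s * ((1# - h ^ (2 ℕ.* m)) * A * B))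
      ≈⟨ solve 5 (λ x t s A B → x :* t :* (A :* ((con (+ 1) :- s :* t) :* B) :- s :* ((con (+ 1) :- t) :* A :* B))
                             := x :* (A :* ((con (+ 1) :- s :* t) :* B) :- (con (+ 1) :- t) :* A :* B)) refl _ _ s A B ⟩
    h ^ (2 ℕ.* r) * (A * ((1# - s * h ^ (2 ℕ.* m)) * B) - (1# - h ^ (2 ℕ.* m)) * A * B)
      ≈⟨ *-congˡ (+-cong U₀ (-‿cong U₁)) ⟨
    h ^ (2 ℕ.* r) * (U r (r ℕ.+ m) - U (suc r) (r ℕ.+ m)) ∎
    where
    s = h ^ (2 ℕ.* (2 ℕ.* r ℕ.+ 2 ℕ.* ℓ ℕ.+ 1))
    A = e m
    B = e (suc (r ℕ.+ m ℕ.+ (r ℕ.+ 2 ℕ.* ℓ)))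
    U₀ : U r (r ℕ.+ m) ≈ A * ((1# - s * h ^ (2 ℕ.* m)) * B)
    U₀ = *-cong (reflexive (delay-diag e r m)) (begin
      e (r ℕ.+ m ℕ.+ (r ℕ.+ 2 ℕ.* ℓ))            ≈⟨ e-step _ ⟩
      (1# - q ^ suc (r ℕ.+ m ℕ.+ (r ℕ.+ 2 ℕ.* ℓ))) * B  ≈⟨ *-congʳ (+-congˡ (-‿cong (q^≈ (suc (r ℕ.+ m ℕ.+ (r ℕ.+ 2 ℕ.* ℓ)))))) ⟩
      (1# - h ^ (2 ℕ.* suc (r ℕ.+ m ℕ.+ (r ℕ.+ 2 ℕ.* ℓ)))) * B
        ≈⟨ *-congʳ (+-congˡ (-‿cong (h^-* {2 ℕ.* suc (r ℕ.+ m ℕ.+ (r ℕ.+ 2 ℕ.* ℓ))} (2 ℕ.* (2 ℕ.* r ℕ.+ 2 ℕ.* ℓ ℕ.+ 1)) (2 ℕ.* m) (solveℕ (r ∷ m ∷ ℓ ∷ []))))) ⟨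
      (1# - s * h ^ (2 ℕ.* m)) * B ∎)
    U₁ : U (suc r) (r ℕ.+ m) ≈ (1# - h ^ (2 ℕ.* m)) * A * B
    U₁ = *-cong (trans (e⊖-next r m) (*-congʳ (+-congˡ (-‿cong (q^≈ m)))))
                (reflexive (≡.cong e (ℕₚ.+-suc (r ℕ.+ m) (r ℕ.+ 2 ℕ.* ℓ))))

  ∑-e⊖-e⊖ : ∀ M r m (g : ℕ → Carrier) → r ℕ.+ m ℕ.< M →
    ∑ M (λ n → e⊖ (r ℕ.+ m) n * (e⊖ n r * g n)) ≈ conv m (λ a b → e b * (e a * g (r ℕ.+ a)))
  ∑-e⊖-e⊖ M       zero    m g m<M       = ∑-delay M m e (λ n → e n * g n) m<M
  ∑-e⊖-e⊖ (suc M) (suc r) m g (s≤s lt) = begin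
    ∑ (suc M) (λ n → e⊖ (suc r ℕ.+ m) n * (e⊖ n (suc r) * g n)) ≈⟨ ∑-front M _ ⟩
    e (suc r ℕ.+ m) * (0# * g 0) + ∑ M (λ n → e⊖ (r ℕ.+ m) n * (e⊖ n r * g (suc n)))
      ≈⟨ +-cong (trans (*-congˡ (zeroˡ _)) (zeroʳ _)) (∑-e⊖-e⊖ M r m (λ n → g (suc n)) lt) ⟩
    0# + conv m (λ a b → e b * (e a * g (suc r ℕ.+ a))) ≈⟨ +-identityˡ _ ⟩
    conv m (λ a b → e b * (e a * g (suc r ℕ.+ a))) ∎

  e⊖-e⊖-vanish : ∀ {L r} n → L ℕ.< r → e⊖ L n * e⊖ n r ≈ 0#
  e⊖-e⊖-vanish {L} {r} n L<r with n ℕₚ.<? r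
  ... | yes n<r = trans (*-congˡ (reflexive (delay-vanish e n<r))) (zeroʳ _)
  ... | no  n≮r = trans (*-congʳ (reflexive (delay-vanish e (ℕₚ.≤-trans L<r (ℕₚ.≮⇒≥ n≮r))))) (zeroˡ _)

  -- Convolution of w U s with e returns U s, multiplied by h^(γ s) and by a factor λ′ L independent of s.
  IsStep : (ℕ → Carrier) → (ℕ → Carrier) → (ℕ → ℕ) → Set r
  IsStep w λ′ γ = ∀ M L s → L ℕ.< M → ∑ M (λ n → e⊖ L n * (w n * U s n)) ≈ λ′ L * (h ^ γ s * U s L)

  private
    -- With n = s + a, the sum over n ≥ s becomes a convolution; for L < s both sides vanish.
    isStep : ∀ w λ′ γ →
      (∀ s m → conv m (λ a b → e b * (e a * (w (s ℕ.+ a) * e (s ℕ.+ a ℕ.+ (s ℕ.+ 2 ℕ.* ℓ)))))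
             ≈ λ′ (s ℕ.+ m) * (h ^ γ s * (e m * e (s ℕ.+ m ℕ.+ (s ℕ.+ 2 ℕ.* ℓ))))) → IsStep w λ′ γ
    isStep w λ′ γ eq M L s L<M with s ℕₚ.≤? L
    ... | no s≰L = trans (∑-zero M λ n _ → trans
          (solve 4 (λ x w y z → x :* (w :* (y :* z)) := x :* y :* (w :* z)) refl _ _ _ _)
          (trans (*-congʳ (e⊖-e⊖-vanish n (ℕₚ.≰⇒> s≰L))) (zeroˡ _)))
        (sym (trans (*-congˡ (trans (*-congˡ (U-vanish (ℕₚ.≰⇒> s≰L))) (zeroʳ _))) (zeroʳ _)))
    ... | yes s≤L with ℕₚ.m≤n⇒∃[o]m+o≡n s≤L
    ... | m , ≡.refl = begin
      ∑ M (λ n → e⊖ (s ℕ.+ m) n * (w n * U s n))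
        ≈⟨ ∑-cong M (λ n _ → *-congˡ (solve 3 (λ w x y → w :* (x :* y) := x :* (w :* y)) refl _ _ _)) ⟩
      ∑ M (λ n → e⊖ (s ℕ.+ m) n * (e⊖ n s * (w n * e (n ℕ.+ (s ℕ.+ 2 ℕ.* ℓ)))))
        ≈⟨ ∑-e⊖-e⊖ M s m _ L<M ⟩
      conv m (λ a b → e b * (e a * (w (s ℕ.+ a) * e (s ℕ.+ a ℕ.+ (s ℕ.+ 2 ℕ.* ℓ)))))
        ≈⟨ eq s m ⟩
      λ′ (s ℕ.+ m) * (h ^ γ s * (e m * e (s ℕ.+ m ℕ.+ (s ℕ.+ 2 ℕ.* ℓ))))
        ≈⟨ *-congˡ (*-congˡ (*-congʳ (reflexive (delay-diag e s m)))) ⟨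
      λ′ (s ℕ.+ m) * (h ^ γ s * U s (s ℕ.+ m)) ∎

    tri-double : ∀ a → 2 ℕ.* tri a ℕ.+ a ≡ a ℕ.* a
    tri-double zero    = ≡.refl
    tri-double (suc a) = ≡.trans (lemma (tri a)) (≡.trans (≡.cong (ℕ._+ suc (2 ℕ.* a)) (tri-double a)) square)
      where
      lemma : ∀ t → 2 ℕ.* (t ℕ.+ a) ℕ.+ suc a ≡ (2 ℕ.* t ℕ.+ a) ℕ.+ suc (2 ℕ.* a)
      lemma t = solveℕ (t ∷ a ∷ [])
      square : a ℕ.* a ℕ.+ suc (2 ℕ.* a) ≡ suc a ℕ.* suc a
      square = solveℕ (a ∷ [])

    -- Vandermonde with x = q^(c+1), after multiplication by e (c + m).
    vandermonde-e : ∀ c m z → conv m (λ a b → e b * (e a * (rise (q ^ suc c) z a * q ^ tri a * e (c ℕ.+ a))))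
                            ≈ poch z m * (e m * e (c ℕ.+ m))
    vandermonde-e c m z = begin
      conv m (λ a b → e b * (e a * (rise (q ^ suc c) z a * q ^ tri a * e (c ℕ.+ a))))
        ≈⟨ conv-cong m termwise ⟩
      conv m (λ a b → e (c ℕ.+ m) * (e a * e b * (rise (q ^ suc c) z a * q ^ tri a * poch (q ^ suc c * q ^ a) b)))
        ≈⟨ conv-*ˡ m _ _ ⟩
      e (c ℕ.+ m) * conv m (λ a b → e a * e b * (rise (q ^ suc c) z a * q ^ tri a * poch (q ^ suc c * q ^ a) b))
        ≈⟨ *-congˡ (qVandermonde m (q ^ suc c) z) ⟩
      e (c ℕ.+ m) * (e m * poch z m)
        ≈⟨ solve 3 (λ x y z → x :* (y :* z) := z :* (y :* x)) refl _ _ _ ⟩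
      poch z m * (e m * e (c ℕ.+ m)) ∎
      where
      termwise : ∀ a b → a ℕ.+ b ≡ m → e b * (e a * (rise (q ^ suc c) z a * q ^ tri a * e (c ℕ.+ a)))
        ≈ e (c ℕ.+ m) * (e a * e b * (rise (q ^ suc c) z a * q ^ tri a * poch (q ^ suc c * q ^ a) b))
      termwise a b ≡.refl = begin
        e b * (e a * (rise (q ^ suc c) z a * q ^ tri a * e (c ℕ.+ a)))
          ≈⟨ *-congˡ (*-congˡ (*-congˡ (poch-e (c ℕ.+ a) b))) ⟨
        e b * (e a * (rise (q ^ suc c) z a * q ^ tri a * (poch (q ^ suc (c ℕ.+ a)) b * e (c ℕ.+ a ℕ.+ b))))
          ≈⟨ *-congˡ (*-congˡ (*-congˡ (*-cong (poch-cong b (^-homo-* q (suc c) a)) (reflexive (≡.cong e (ℕₚ.+-assoc c a b)))))) ⟩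
        e b * (e a * (rise (q ^ suc c) z a * q ^ tri a * (poch (q ^ suc c * q ^ a) b * e (c ℕ.+ (a ℕ.+ b)))))
          ≈⟨ solve 5 (λ x y z u v → x :* (y :* (z :* (u :* v))) := v :* (y :* x :* (z :* u))) refl _ _ _ _ _ ⟩
        e (c ℕ.+ (a ℕ.+ b)) * (e a * e b * (rise (q ^ suc c) z a * q ^ tri a * poch (q ^ suc c * q ^ a) b)) ∎

    -- In the case z = 0 of the Vandermonde sum all factors are powers of q.
    rise-0 : ∀ k a → rise (q ^ k) 0# a * q ^ tri a ≈ h ^ (2 ℕ.* (k ℕ.* a ℕ.+ 2 ℕ.* tri a))
    rise-0 k a = begin
      rise (q ^ k) 0# a * q ^ tri a             ≈⟨ *-congʳ (power a) ⟩
      q ^ (k ℕ.* a ℕ.+ tri a) * q ^ tri a       ≈⟨ ^-homo-* q (k ℕ.* a ℕ.+ tri a) (tri a) ⟨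
      q ^ (k ℕ.* a ℕ.+ tri a ℕ.+ tri a)         ≈⟨ q^≈ (k ℕ.* a ℕ.+ tri a ℕ.+ tri a) ⟩
      h ^ (2 ℕ.* (k ℕ.* a ℕ.+ tri a ℕ.+ tri a)) ≈⟨ h^-cong (lemma (tri a)) ⟩
      h ^ (2 ℕ.* (k ℕ.* a ℕ.+ 2 ℕ.* tri a))     ∎
      where
      lemma : ∀ t → 2 ℕ.* (k ℕ.* a ℕ.+ t ℕ.+ t) ≡ 2 ℕ.* (k ℕ.* a ℕ.+ 2 ℕ.* t)
      lemma t = solveℕ (k ∷ a ∷ t ∷ [])
      exponent : ∀ a t → k ℕ.* a ℕ.+ t ℕ.+ (k ℕ.+ a) ≡ k ℕ.* suc a ℕ.+ (t ℕ.+ a)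
      exponent a t = solveℕ (k ∷ a ∷ t ∷ [])
      power : ∀ a → rise (q ^ k) 0# a ≈ q ^ (k ℕ.* a ℕ.+ tri a)
      power zero    = ^-congʳ q (≡.sym (≡.trans (ℕₚ.+-identityʳ _) (ℕₚ.*-zeroʳ k)))
      power (suc a) = begin
        rise (q ^ k) 0# a * (q ^ k * q ^ a - 0#)
          ≈⟨ *-cong (power a) (solve 2 (λ x y → x :* y :- con (+ 0) := x :* y) refl _ _) ⟩
        q ^ (k ℕ.* a ℕ.+ tri a) * (q ^ k * q ^ a)  ≈⟨ *-congˡ (^-homo-* q k a) ⟨
        q ^ (k ℕ.* a ℕ.+ tri a) * q ^ (k ℕ.+ a)    ≈⟨ ^-homo-* q (k ℕ.* a ℕ.+ tri a) (k ℕ.+ a) ⟨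
        q ^ (k ℕ.* a ℕ.+ tri a ℕ.+ (k ℕ.+ a))      ≈⟨ ^-congʳ q (exponent a (tri a)) ⟩
        q ^ (k ℕ.* suc a ℕ.+ (tri a ℕ.+ a))        ∎

    -- In the case x = y², z = - y the factors x q^j - z are y (1 + y q^j).
    rise-square : ∀ y a → rise (y * y) (- y) a ≈ y ^ a * poch (- y) a
    rise-square y zero    = sym (*-identityˡ 1#)
    rise-square y (suc a) = trans (*-congʳ (rise-square y a))
      (solve 4 (λ y Y P Q → Y :* P :* (y :* y :* Q :- (:- y)) := y :* Y :* (P :* (con (+ 1) :- (:- y) :* Q))) refl y _ _ _)

  -- The exponent s² + 2ℓs.
  γ : ℕ → ℕ
  γ s = s ℕ.* s ℕ.+ 2 ℕ.* (ℓ ℕ.* s)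

  -- The q-analogue of Durfee dissection: Vandermonde with x = q^(2s+2ℓ+1) and z = 0.
  q-step : IsStep (λ n → h ^ (2 ℕ.* γ n)) (λ _ → 1#) (λ s → 2 ℕ.* γ s)
  q-step = isStep (λ n → h ^ (2 ℕ.* γ n)) (λ _ → 1#) (λ s → 2 ℕ.* γ s) λ s m → begin
    conv m (λ a b → e b * (e a * (h ^ (2 ℕ.* γ (s ℕ.+ a)) * e (s ℕ.+ a ℕ.+ (s ℕ.+ 2 ℕ.* ℓ)))))
      ≈⟨ conv-cong m (λ a b _ → termwise s a b) ⟩
    conv m (λ a b → h ^ (2 ℕ.* γ s) * (e b * (e a * (rise (q ^ suc (2 ℕ.* (s ℕ.+ ℓ))) 0# a * q ^ tri a * e (2 ℕ.* (s ℕ.+ ℓ) ℕ.+ a)))))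
      ≈⟨ conv-*ˡ m _ _ ⟩
    h ^ (2 ℕ.* γ s) * conv m (λ a b → e b * (e a * (rise (q ^ suc (2 ℕ.* (s ℕ.+ ℓ))) 0# a * q ^ tri a * e (2 ℕ.* (s ℕ.+ ℓ) ℕ.+ a))))
      ≈⟨ *-congˡ (vandermonde-e (2 ℕ.* (s ℕ.+ ℓ)) m 0#) ⟩
    h ^ (2 ℕ.* γ s) * (poch 0# m * (e m * e (2 ℕ.* (s ℕ.+ ℓ) ℕ.+ m)))
      ≈⟨ *-congˡ (trans (*-congʳ (poch-0 m)) (*-identityˡ _)) ⟩
    h ^ (2 ℕ.* γ s) * (e m * e (2 ℕ.* (s ℕ.+ ℓ) ℕ.+ m))
      ≈⟨ *-congˡ (*-congˡ (reflexive (≡.cong e (index s m)))) ⟩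
    h ^ (2 ℕ.* γ s) * (e m * e (s ℕ.+ m ℕ.+ (s ℕ.+ 2 ℕ.* ℓ)))
      ≈⟨ *-identityˡ _ ⟨
    1# * (h ^ (2 ℕ.* γ s) * (e m * e (s ℕ.+ m ℕ.+ (s ℕ.+ 2 ℕ.* ℓ)))) ∎
    where
    poch-0 : ∀ m → poch 0# m ≈ 1#
    poch-0 zero    = refl
    poch-0 (suc m) = trans (*-congʳ (poch-0 m)) (solve 1 (λ x → con (+ 1) :* (con (+ 1) :- con (+ 0) :* x) := con (+ 1)) refl _)
    index : ∀ s a → 2 ℕ.* (s ℕ.+ ℓ) ℕ.+ a ≡ s ℕ.+ a ℕ.+ (s ℕ.+ 2 ℕ.* ℓ)
    index s a = solveℕ (s ∷ a ∷ ℓ ∷ [])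
    exponent : ∀ s a t → 2 ℕ.* (s ℕ.* s ℕ.+ 2 ℕ.* (ℓ ℕ.* s)) ℕ.+ 2 ℕ.* (suc (2 ℕ.* (s ℕ.+ ℓ)) ℕ.* a ℕ.+ 2 ℕ.* t)
      ≡ 2 ℕ.* (s ℕ.* s ℕ.+ 2 ℕ.* (ℓ ℕ.* s)) ℕ.+ 2 ℕ.* (2 ℕ.* (s ℕ.+ ℓ) ℕ.* a ℕ.+ (2 ℕ.* t ℕ.+ a))
    exponent s a t = solveℕ (s ∷ a ∷ t ∷ ℓ ∷ [])
    exponent′ : ∀ s a → 2 ℕ.* (s ℕ.* s ℕ.+ 2 ℕ.* (ℓ ℕ.* s)) ℕ.+ 2 ℕ.* (2 ℕ.* (s ℕ.+ ℓ) ℕ.* a ℕ.+ a ℕ.* a)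
      ≡ 2 ℕ.* ((s ℕ.+ a) ℕ.* (s ℕ.+ a) ℕ.+ 2 ℕ.* (ℓ ℕ.* (s ℕ.+ a)))
    exponent′ s a = solveℕ (s ∷ a ∷ ℓ ∷ [])
    termwise : ∀ s a b → e b * (e a * (h ^ (2 ℕ.* γ (s ℕ.+ a)) * e (s ℕ.+ a ℕ.+ (s ℕ.+ 2 ℕ.* ℓ))))
      ≈ h ^ (2 ℕ.* γ s) * (e b * (e a * (rise (q ^ suc (2 ℕ.* (s ℕ.+ ℓ))) 0# a * q ^ tri a * e (2 ℕ.* (s ℕ.+ ℓ) ℕ.+ a))))
    termwise s a b = begin
      e b * (e a * (h ^ (2 ℕ.* γ (s ℕ.+ a)) * e (s ℕ.+ a ℕ.+ (s ℕ.+ 2 ℕ.* ℓ))))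
        ≈⟨ *-congˡ (*-congˡ (*-cong
            (h^-* (2 ℕ.* γ s) (2 ℕ.* (suc (2 ℕ.* (s ℕ.+ ℓ)) ℕ.* a ℕ.+ 2 ℕ.* tri a))
              (≡.trans (exponent s a (tri a)) (≡.trans
                (≡.cong (λ x → 2 ℕ.* γ s ℕ.+ 2 ℕ.* (2 ℕ.* (s ℕ.+ ℓ) ℕ.* a ℕ.+ x)) (tri-double a)) (exponent′ s a))))
            (reflexive (≡.cong e (index s a))))) ⟨
      e b * (e a * (h ^ (2 ℕ.* γ s) * h ^ (2 ℕ.* (suc (2 ℕ.* (s ℕ.+ ℓ)) ℕ.* a ℕ.+ 2 ℕ.* tri a)) * e (2 ℕ.* (s ℕ.+ ℓ) ℕ.+ a)))
        ≈⟨ solve 5 (λ x y z u v → x :* (y :* (z :* u :* v)) := z :* (x :* (y :* (u :* v)))) refl _ _ _ _ _ ⟩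
      h ^ (2 ℕ.* γ s) * (e b * (e a * (h ^ (2 ℕ.* (suc (2 ℕ.* (s ℕ.+ ℓ)) ℕ.* a ℕ.+ 2 ℕ.* tri a)) * e (2 ℕ.* (s ℕ.+ ℓ) ℕ.+ a))))
        ≈⟨ *-congˡ (*-congˡ (*-congˡ (*-congʳ (rise-0 (suc (2 ℕ.* (s ℕ.+ ℓ))) a)))) ⟨
      h ^ (2 ℕ.* γ s) * (e b * (e a * (rise (q ^ suc (2 ℕ.* (s ℕ.+ ℓ))) 0# a * q ^ tri a * e (2 ℕ.* (s ℕ.+ ℓ) ℕ.+ a)))) ∎

  -- Vandermonde with x = q^(2s+2ℓ+1) = y² and z = - y, where y = h^(2s+2ℓ+1).
  h-step : IsStep (λ n → h ^ γ n * poch (- h) (n ℕ.+ ℓ)) (λ L → poch (- h) (L ℕ.+ ℓ)) γ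
  h-step = isStep (λ n → h ^ γ n * poch (- h) (n ℕ.+ ℓ)) (λ L → poch (- h) (L ℕ.+ ℓ)) γ λ s m → begin
    conv m (λ a b → e b * (e a * (h ^ γ (s ℕ.+ a) * poch (- h) (s ℕ.+ a ℕ.+ ℓ) * e (s ℕ.+ a ℕ.+ (s ℕ.+ 2 ℕ.* ℓ)))))
      ≈⟨ conv-cong m (λ a b _ → termwise s a b) ⟩
    conv m (λ a b → h ^ γ s * poch (- h) (s ℕ.+ ℓ) * (e b * (e a * (rise (q ^ suc (2 ℕ.* (s ℕ.+ ℓ))) (- y s) a * q ^ tri a * e (2 ℕ.* (s ℕ.+ ℓ) ℕ.+ a)))))
      ≈⟨ conv-*ˡ m _ _ ⟩
    h ^ γ s * poch (- h) (s ℕ.+ ℓ) * conv m (λ a b → e b * (e a * (rise (q ^ suc (2 ℕ.* (s ℕ.+ ℓ))) (- y s) a * q ^ tri a * e (2 ℕ.* (s ℕ.+ ℓ) ℕ.+ a))))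
      ≈⟨ *-congˡ (vandermonde-e (2 ℕ.* (s ℕ.+ ℓ)) m (- y s)) ⟩
    h ^ γ s * poch (- h) (s ℕ.+ ℓ) * (poch (- y s) m * (e m * e (2 ℕ.* (s ℕ.+ ℓ) ℕ.+ m)))
      ≈⟨ solve 4 (λ x p p' z → x :* p :* (p' :* z) := p :* p' :* (x :* z)) refl _ _ _ _ ⟩
    poch (- h) (s ℕ.+ ℓ) * poch (- y s) m * (h ^ γ s * (e m * e (2 ℕ.* (s ℕ.+ ℓ) ℕ.+ m)))
      ≈⟨ *-cong (join s m) (*-congˡ (*-congˡ (reflexive (≡.cong e (index s m))))) ⟩
    poch (- h) (s ℕ.+ m ℕ.+ ℓ) * (h ^ γ s * (e m * e (s ℕ.+ m ℕ.+ (s ℕ.+ 2 ℕ.* ℓ)))) ∎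
    where
    y : ℕ → Carrier
    y s = h ^ suc (2 ℕ.* (s ℕ.+ ℓ))
    -y : ∀ s → - h * q ^ (s ℕ.+ ℓ) ≈ - y s
    -y s = trans (*-congˡ (q^≈ (s ℕ.+ ℓ))) (solve 2 (λ h x → :- h :* x := :- (h :* x)) refl h (h ^ (2 ℕ.* (s ℕ.+ ℓ))))
    order : ∀ s m → s ℕ.+ ℓ ℕ.+ m ≡ s ℕ.+ m ℕ.+ ℓ
    order s m = solveℕ (s ∷ m ∷ ℓ ∷ [])
    join : ∀ s m → poch (- h) (s ℕ.+ ℓ) * poch (- y s) m ≈ poch (- h) (s ℕ.+ m ℕ.+ ℓ)
    join s m = begin
      poch (- h) (s ℕ.+ ℓ) * poch (- y s) m                    ≈⟨ *-congˡ (poch-cong m (-y s)) ⟨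
      poch (- h) (s ℕ.+ ℓ) * poch (- h * q ^ (s ℕ.+ ℓ)) m      ≈⟨ poch-+ (- h) (s ℕ.+ ℓ) m ⟨
      poch (- h) (s ℕ.+ ℓ ℕ.+ m)                               ≡⟨ ≡.cong (poch (- h)) (order s m) ⟩
      poch (- h) (s ℕ.+ m ℕ.+ ℓ)                               ∎
    index : ∀ s a → 2 ℕ.* (s ℕ.+ ℓ) ℕ.+ a ≡ s ℕ.+ a ℕ.+ (s ℕ.+ 2 ℕ.* ℓ)
    index s a = solveℕ (s ∷ a ∷ ℓ ∷ [])
    exponent : ∀ s a t → (suc (2 ℕ.* (s ℕ.+ ℓ))) ℕ.* a ℕ.+ 2 ℕ.* t ≡ 2 ℕ.* (s ℕ.+ ℓ) ℕ.* a ℕ.+ (2 ℕ.* t ℕ.+ a)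
    exponent s a t = solveℕ (s ∷ a ∷ t ∷ ℓ ∷ [])
    exponent′ : ∀ s a → (s ℕ.* s ℕ.+ 2 ℕ.* (ℓ ℕ.* s)) ℕ.+ (2 ℕ.* (s ℕ.+ ℓ) ℕ.* a ℕ.+ a ℕ.* a)
      ≡ (s ℕ.+ a) ℕ.* (s ℕ.+ a) ℕ.+ 2 ℕ.* (ℓ ℕ.* (s ℕ.+ a))
    exponent′ s a = solveℕ (s ∷ a ∷ ℓ ∷ [])
    rise-y : ∀ s a → rise (q ^ suc (2 ℕ.* (s ℕ.+ ℓ))) (- y s) a * q ^ tri a
                   ≈ h ^ (2 ℕ.* (s ℕ.+ ℓ) ℕ.* a ℕ.+ a ℕ.* a) * poch (- y s) a
    rise-y s a = begin
      rise (q ^ suc (2 ℕ.* (s ℕ.+ ℓ))) (- y s) a * q ^ tri a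
        ≈⟨ *-cong (rise-cong a) (q^≈ (tri a)) ⟩
      rise (y s * y s) (- y s) a * h ^ (2 ℕ.* tri a)
        ≈⟨ *-congʳ (rise-square (y s) a) ⟩
      y s ^ a * poch (- y s) a * h ^ (2 ℕ.* tri a)
        ≈⟨ solve 3 (λ x y z → x :* y :* z := x :* z :* y) refl _ _ _ ⟩
      y s ^ a * h ^ (2 ℕ.* tri a) * poch (- y s) a
        ≈⟨ *-congʳ (*-congʳ (Algebra.Properties.Semiring.Exp.^-assocʳ semiring h (suc (2 ℕ.* (s ℕ.+ ℓ))) a)) ⟩
      h ^ (suc (2 ℕ.* (s ℕ.+ ℓ)) ℕ.* a) * h ^ (2 ℕ.* tri a) * poch (- y s) a
        ≈⟨ *-congʳ (h^-* (suc (2 ℕ.* (s ℕ.+ ℓ)) ℕ.* a) (2 ℕ.* tri a)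
             (≡.trans (exponent s a (tri a)) (≡.cong (2 ℕ.* (s ℕ.+ ℓ) ℕ.* a ℕ.+_) (tri-double a)))) ⟩
      h ^ (2 ℕ.* (s ℕ.+ ℓ) ℕ.* a ℕ.+ a ℕ.* a) * poch (- y s) a ∎
      where
      square : q ^ suc (2 ℕ.* (s ℕ.+ ℓ)) ≈ y s * y s
      square = trans (q^≈ (suc (2 ℕ.* (s ℕ.+ ℓ)))) (sym (h^-* {2 ℕ.* suc (2 ℕ.* (s ℕ.+ ℓ))} (suc (2 ℕ.* (s ℕ.+ ℓ))) (suc (2 ℕ.* (s ℕ.+ ℓ))) (solveℕ (s ∷ ℓ ∷ []))))
      rise-cong : ∀ a → rise (q ^ suc (2 ℕ.* (s ℕ.+ ℓ))) (- y s) a ≈ rise (y s * y s) (- y s) a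
      rise-cong zero    = refl
      rise-cong (suc a) = *-cong (rise-cong a) (+-congʳ (*-congʳ square))
    termwise : ∀ s a b → e b * (e a * (h ^ γ (s ℕ.+ a) * poch (- h) (s ℕ.+ a ℕ.+ ℓ) * e (s ℕ.+ a ℕ.+ (s ℕ.+ 2 ℕ.* ℓ))))
      ≈ h ^ γ s * poch (- h) (s ℕ.+ ℓ) * (e b * (e a * (rise (q ^ suc (2 ℕ.* (s ℕ.+ ℓ))) (- y s) a * q ^ tri a * e (2 ℕ.* (s ℕ.+ ℓ) ℕ.+ a))))
    termwise s a b = begin
      e b * (e a * (h ^ γ (s ℕ.+ a) * poch (- h) (s ℕ.+ a ℕ.+ ℓ) * e (s ℕ.+ a ℕ.+ (s ℕ.+ 2 ℕ.* ℓ))))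
        ≈⟨ *-congˡ (*-congˡ (*-cong (*-cong
              (h^-* (γ s) (2 ℕ.* (s ℕ.+ ℓ) ℕ.* a ℕ.+ a ℕ.* a) (exponent′ s a)) (join s a))
              (reflexive (≡.cong e (index s a))))) ⟨
      e b * (e a * (h ^ γ s * h ^ (2 ℕ.* (s ℕ.+ ℓ) ℕ.* a ℕ.+ a ℕ.* a) * (poch (- h) (s ℕ.+ ℓ) * poch (- y s) a) * e (2 ℕ.* (s ℕ.+ ℓ) ℕ.+ a)))
        ≈⟨ solve 7 (λ x y g h p r v → x :* (y :* (g :* h :* (p :* r) :* v)) := g :* p :* (x :* (y :* (h :* r :* v)))) refl _ _ _ _ _ _ _ ⟩
      h ^ γ s * poch (- h) (s ℕ.+ ℓ) * (e b * (e a * (h ^ (2 ℕ.* (s ℕ.+ ℓ) ℕ.* a ℕ.+ a ℕ.* a) * poch (- y s) a * e (2 ℕ.* (s ℕ.+ ℓ) ℕ.+ a))))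
        ≈⟨ *-congˡ (*-congˡ (*-congˡ (*-congʳ (rise-y s a)))) ⟨
      h ^ γ s * poch (- h) (s ℕ.+ ℓ) * (e b * (e a * (rise (q ^ suc (2 ℕ.* (s ℕ.+ ℓ))) (- y s) a * q ^ tri a * e (2 ℕ.* (s ℕ.+ ℓ) ℕ.+ a)))) ∎

-- The finite identity

-- The doubled exponents of the theta series for ℓ ≥ 0, at n = ℓ + s (upper) and at n = - ℓ - 1 - s (lower).
module ThetaExponents (k i ℓ : ℕ) where

  upper : ℕ → ℕ
  upper s = (2 ℕ.* k ℕ.+ 1) ℕ.* (s ℕ.* s ℕ.+ 2 ℕ.* (ℓ ℕ.* s)) ℕ.+ 2 ℕ.* (i ℕ.* s)

  lower : ℕ → ℕ
  lower s = upper s ℕ.+ (2 ℕ.* (k ℕ.∸ i) ℕ.+ 1) ℕ.* (2 ℕ.* s ℕ.+ 2 ℕ.* ℓ ℕ.+ 1)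

-- The exponent of the extra factor q^n, present when the position m of the summation variable, counted
-- from the innermost one, is at most i.
bonus : ℕ → ℕ → ℕ → ℕ
bonus i m n = if m ℕ.≤ᵇ i then n else 0

bonus-yes : ∀ {i m} n → m ℕ.≤ i → bonus i m n ≡ n
bonus-yes {i} {m} n m≤i with m ℕ.≤ᵇ i | ℕₚ.≤⇒≤ᵇ m≤i
... | true | _ = ≡.refl

bonus-no : ∀ {i m} n → i ℕ.< m → bonus i m n ≡ 0
bonus-no {i} {m} n i<m with m ℕ.≤ᵇ i in eq
... | false = ≡.refl
... | true  = contradiction (ℕₚ.≤ᵇ⇒≤ m i (≡.subst Data.Bool.Base.T (≡.sym eq) _)) (ℕₚ.<⇒≱ i<m)

-- The multisum truncated by the factor 1/(q)_(L-N_1), evaluated by iterating the Bailey steps.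
module FiniteIdentity {c r : Level} (R : CommutativeRing c r)
  (h : CommutativeRing.Carrier R) (reciprocals : QFactorialReciprocals R (CommutativeRing._*_ R h h)) (ℓ i : ℕ) where

  open CommutativeRing R
  open QFactorialReciprocals reciprocals
  open Algebra.Properties.Semiring.Exp semiring using (_^_)

  open Relation.Binary.Reasoning.Setoid setoid
  open IntegerCoefficients R using (module Solver)
  open Solver using (solve; _:=_; _:+_; _:*_; _:-_; :-_; con)
  open FiniteSums R
  open BaileyChain R h reciprocals ℓ public

  -- A combination of the kernels, with coefficients given by exponents of h.
  combination : ℕ → (ℕ → ℕ) → (ℕ → ℕ) → ℕ → Carrier
  combination M A B n = ∑ M λ s → h ^ A s * U s n - h ^ B s * U (suc s) n

  combination-cong : ∀ M {A A′ B B′ : ℕ → ℕ} n → (∀ s → A s ≡ A′ s) → (∀ s → B s ≡ B′ s) →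
                     combination M A B n ≈ combination M A′ B′ n
  combination-cong M n A≡ B≡ = ∑-cong M λ s _ →
    +-cong (*-congʳ (h^-cong (A≡ s))) (-‿cong (*-congʳ (h^-cong (B≡ s))))

  -- A Bailey step acts on the exponents of a combination.
  step-combination : ∀ {w λ′ γ′} → IsStep w λ′ γ′ → ∀ M A B (D : ℕ → Carrier) →
    (∀ n → n ℕ.< M → D n ≈ combination M A B n) → ∀ L → L ℕ.< M →
    ∑ M (λ n → e⊖ L n * (w n * D n))
    ≈ λ′ L * combination M (λ s → A s ℕ.+ γ′ s) (λ s → B s ℕ.+ γ′ (suc s)) L
  step-combination {w} {λ′} {γ′} step M A B D D≈ L L<M = begin
    ∑ M (λ n → e⊖ L n * (w n * D n))
      ≈⟨ ∑-cong M (λ n n<M → trans (*-congˡ (*-congˡ (D≈ n n<M))) (expand n)) ⟩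
    ∑ M (λ n → ∑ M (λ s → h ^ A s * (e⊖ L n * (w n * U s n)) - h ^ B s * (e⊖ L n * (w n * U (suc s) n))))
      ≈⟨ ∑-swap M M _ ⟩
    ∑ M (λ s → ∑ M (λ n → h ^ A s * (e⊖ L n * (w n * U s n)) - h ^ B s * (e⊖ L n * (w n * U (suc s) n))))
      ≈⟨ ∑-cong M (λ s _ → trans (∑-minus M _ _) (+-cong (∑-*ˡ M _ _) (-‿cong (∑-*ˡ M _ _)))) ⟩
    ∑ M (λ s → h ^ A s * ∑ M (λ n → e⊖ L n * (w n * U s n)) - h ^ B s * ∑ M (λ n → e⊖ L n * (w n * U (suc s) n)))
      ≈⟨ ∑-cong M (λ s _ → trans (+-cong (*-congˡ (step M L s L<M)) (-‿cong (*-congˡ (step M L (suc s) L<M)))) (collect s)) ⟩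
    ∑ M (λ s → λ′ L * (h ^ (A s ℕ.+ γ′ s) * U s L - h ^ (B s ℕ.+ γ′ (suc s)) * U (suc s) L))
      ≈⟨ ∑-*ˡ M _ _ ⟩
    λ′ L * combination M (λ s → A s ℕ.+ γ′ s) (λ s → B s ℕ.+ γ′ (suc s)) L ∎
    where
    expand : ∀ n → e⊖ L n * (w n * combination M A B n)
      ≈ ∑ M (λ s → h ^ A s * (e⊖ L n * (w n * U s n)) - h ^ B s * (e⊖ L n * (w n * U (suc s) n)))
    expand n = begin
      e⊖ L n * (w n * combination M A B n) ≈⟨ *-assoc _ _ _ ⟨
      e⊖ L n * w n * combination M A B n   ≈⟨ ∑-*ˡ M _ _ ⟨
      ∑ M (λ s → e⊖ L n * w n * (h ^ A s * U s n - h ^ B s * U (suc s) n))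
        ≈⟨ ∑-cong M (λ s _ → solve 6 (λ x w a u b v → x :* w :* (a :* u :- b :* v) := a :* (x :* (w :* u)) :- b :* (x :* (w :* v))) refl _ _ _ _ _ _) ⟩
      ∑ M (λ s → h ^ A s * (e⊖ L n * (w n * U s n)) - h ^ B s * (e⊖ L n * (w n * U (suc s) n))) ∎
    collect : ∀ s → h ^ A s * (λ′ L * (h ^ γ′ s * U s L)) - h ^ B s * (λ′ L * (h ^ γ′ (suc s) * U (suc s) L))
      ≈ λ′ L * (h ^ (A s ℕ.+ γ′ s) * U s L - h ^ (B s ℕ.+ γ′ (suc s)) * U (suc s) L)
    collect s = trans
      (solve 7 (λ a l g u b g′ v → a :* (l :* (g :* u)) :- b :* (l :* (g′ :* v)) := l :* (a :* g :* u :- b :* g′ :* v)) refl _ _ _ _ _ _ _)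
      (*-congˡ (+-cong (*-congʳ (h^-* (A s) (γ′ s) ≡.refl)) (-‿cong (*-congʳ (h^-* (B s) (γ′ (suc s)) ≡.refl)))))

  -- Multiplication by q^n of a combination of differences U s - q^(2s+2ℓ+1) U (s + 1).
  shift-combination : ∀ M A n →
    h ^ (2 ℕ.* n) * combination M A (λ s → A s ℕ.+ 2 ℕ.* (2 ℕ.* s ℕ.+ 2 ℕ.* ℓ ℕ.+ 1)) n
    ≈ combination M (λ s → A s ℕ.+ 2 ℕ.* s) (λ s → A s ℕ.+ 2 ℕ.* s) n
  shift-combination M A n = trans (sym (∑-*ˡ M _ _)) (∑-cong M λ s _ → begin
    h ^ (2 ℕ.* n) * (h ^ A s * U s n - h ^ (A s ℕ.+ 2 ℕ.* (2 ℕ.* s ℕ.+ 2 ℕ.* ℓ ℕ.+ 1)) * U (suc s) n)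
      ≈⟨ *-congˡ (+-congˡ (-‿cong (*-congʳ (h^-* (A s) (2 ℕ.* (2 ℕ.* s ℕ.+ 2 ℕ.* ℓ ℕ.+ 1)) ≡.refl)))) ⟨
    h ^ (2 ℕ.* n) * (h ^ A s * U s n - h ^ A s * h ^ (2 ℕ.* (2 ℕ.* s ℕ.+ 2 ℕ.* ℓ ℕ.+ 1)) * U (suc s) n)
      ≈⟨ solve 5 (λ x a u b v → x :* (a :* u :- a :* b :* v) := a :* (x :* (u :- b :* v))) refl _ _ _ _ _ ⟩
    h ^ A s * (h ^ (2 ℕ.* n) * (U s n - h ^ (2 ℕ.* (2 ℕ.* s ℕ.+ 2 ℕ.* ℓ ℕ.+ 1)) * U (suc s) n))
      ≈⟨ *-congˡ (U-shift s n) ⟩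
    h ^ A s * (h ^ (2 ℕ.* s) * (U s n - U (suc s) n))
      ≈⟨ solve 4 (λ a x u v → a :* (x :* (u :- v)) := a :* x :* u :- a :* x :* v) refl _ _ _ _ ⟩
    h ^ A s * h ^ (2 ℕ.* s) * U s n - h ^ A s * h ^ (2 ℕ.* s) * U (suc s) n
      ≈⟨ +-cong (*-congʳ (h^-* (A s) (2 ℕ.* s) ≡.refl)) (-‿cong (*-congʳ (h^-* (A s) (2 ℕ.* s) ≡.refl))) ⟩
    h ^ (A s ℕ.+ 2 ℕ.* s) * U s n - h ^ (A s ℕ.+ 2 ℕ.* s) * U (suc s) n ∎)

  -- The weight of the m-th summation variable counted from the innermost one.
  w : ℕ → ℕ → Carrier
  w m n = h ^ (2 ℕ.* γ n ℕ.+ 2 ℕ.* bonus i m n)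

  -- The weight of the outermost variable.
  wₜ : ℕ → ℕ → Carrier
  wₜ m n = h ^ (γ n ℕ.+ 2 ℕ.* bonus i m n) * poch (- h) (n ℕ.+ ℓ)

  -- The sums over the m innermost variables, truncated at M.
  inner : ℕ → ℕ → ℕ → Carrier
  inner M zero    n = U 0 n
  inner M (suc m) n = ∑ M λ j → e⊖ n j * (w (suc m) j * inner M m j)

  private
    γ-suc : ∀ s → γ (suc s) ≡ γ s ℕ.+ (2 ℕ.* s ℕ.+ 2 ℕ.* ℓ ℕ.+ 1)
    γ-suc s = lemma s ℓ
      where
      open import Data.List.Base using ([]; _∷_)
      lemma : ∀ s ℓ → suc s ℕ.* suc s ℕ.+ 2 ℕ.* (ℓ ℕ.* suc s) ≡ s ℕ.* s ℕ.+ 2 ℕ.* (ℓ ℕ.* s) ℕ.+ (2 ℕ.* s ℕ.+ 2 ℕ.* ℓ ℕ.+ 1)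
      lemma s ℓ = solveℕ (s ∷ ℓ ∷ [])

    d : ℕ → ℕ
    d s = 2 ℕ.* s ℕ.+ 2 ℕ.* ℓ ℕ.+ 1

    -- The exponents after m ≤ i steps, and (below) after i + p steps.
    A₁ B₁ : ℕ → ℕ → ℕ
    A₁ m s = 2 ℕ.* (suc m ℕ.* γ s ℕ.+ m ℕ.* s)
    B₁ m s = A₁ m s ℕ.+ 2 ℕ.* d s

    A₂ B₂ : ℕ → ℕ → ℕ
    A₂ p s = 2 ℕ.* (suc (i ℕ.+ p) ℕ.* γ s ℕ.+ i ℕ.* s)
    B₂ p s = A₂ p s ℕ.+ 2 ℕ.* (suc p ℕ.* d s)

    module Arithmetic where
      open import Data.List.Base using ([]; _∷_)

      A₁-step : ∀ m g s → 2 ℕ.* (suc m ℕ.* g ℕ.+ m ℕ.* s) ℕ.+ 2 ℕ.* s ℕ.+ 2 ℕ.* g ≡ 2 ℕ.* (suc (suc m) ℕ.* g ℕ.+ suc m ℕ.* s)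
      A₁-step m g s = solveℕ (m ∷ g ∷ s ∷ [])
      B₁-step : ∀ m g s d → 2 ℕ.* (suc m ℕ.* g ℕ.+ m ℕ.* s) ℕ.+ 2 ℕ.* s ℕ.+ 2 ℕ.* (g ℕ.+ d)
              ≡ 2 ℕ.* (suc (suc m) ℕ.* g ℕ.+ suc m ℕ.* s) ℕ.+ 2 ℕ.* d
      B₁-step m g s d = solveℕ (m ∷ g ∷ s ∷ d ∷ [])
      A₂-step : ∀ j g x → 2 ℕ.* (j ℕ.* g ℕ.+ x) ℕ.+ 2 ℕ.* g ≡ 2 ℕ.* (suc j ℕ.* g ℕ.+ x)
      A₂-step j g x = solveℕ (j ∷ g ∷ x ∷ [])
      B₂-step : ∀ j p g x d → 2 ℕ.* (j ℕ.* g ℕ.+ x) ℕ.+ 2 ℕ.* (p ℕ.* d) ℕ.+ 2 ℕ.* (g ℕ.+ d)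
              ≡ 2 ℕ.* (suc j ℕ.* g ℕ.+ x) ℕ.+ 2 ℕ.* (suc p ℕ.* d)
      B₂-step j p g x d = solveℕ (j ∷ p ∷ g ∷ x ∷ d ∷ [])
      A₁-last : ∀ m g s → 2 ℕ.* (suc m ℕ.* g ℕ.+ m ℕ.* s) ℕ.+ 2 ℕ.* s ℕ.+ g ≡ (2 ℕ.* suc m ℕ.+ 1) ℕ.* g ℕ.+ 2 ℕ.* (suc m ℕ.* s)
      A₁-last m g s = solveℕ (m ∷ g ∷ s ∷ [])
      A₂-last : ∀ j g x → 2 ℕ.* (j ℕ.* g ℕ.+ x) ℕ.+ g ≡ (2 ℕ.* j ℕ.+ 1) ℕ.* g ℕ.+ 2 ℕ.* x
      A₂-last j g x = solveℕ (j ∷ g ∷ x ∷ [])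
      B₂-last : ∀ j p g x d → 2 ℕ.* (j ℕ.* g ℕ.+ x) ℕ.+ 2 ℕ.* (p ℕ.* d) ℕ.+ (g ℕ.+ d)
              ≡ (2 ℕ.* j ℕ.+ 1) ℕ.* g ℕ.+ 2 ℕ.* x ℕ.+ (2 ℕ.* p ℕ.+ 1) ℕ.* d
      B₂-last j p g x d = solveℕ (j ∷ p ∷ g ∷ x ∷ d ∷ [])
      unit-A₁ : ∀ g s → g ≡ g ℕ.+ 0 → 2 ℕ.* g ≡ 2 ℕ.* (1 ℕ.* g ℕ.+ 0 ℕ.* s)
      unit-A₁ g s _ = solveℕ (g ∷ s ∷ [])
      double-+ : ∀ g d → 2 ℕ.* (g ℕ.+ d) ≡ 2 ℕ.* (1 ℕ.* g ℕ.+ 0) ℕ.+ 2 ℕ.* d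
      double-+ g d = solveℕ (g ∷ d ∷ [])
    open Arithmetic

  -- U 0 telescopes, the coefficients of U s and U (s + 1) being q^(γ s) and q^(γ (s + 1)).
  inner-unit : ∀ M n → n ℕ.< M → inner M 0 n ≈ combination M (A₁ 0) (B₁ 0) n
  inner-unit M n n<M = begin
    U 0 n                                  ≈⟨ solve 1 (λ u → u := con (+ 1) :* u :- con (+ 0)) refl _ ⟩
    1# * U 0 n - 0#                        ≈⟨ +-cong (*-congʳ (h^-cong γ0)) (-‿cong (trans (*-congˡ (U-vanish n<M)) (zeroʳ _))) ⟨
    f 0 - f M                              ≈⟨ ∑-telescope M f ⟨
    ∑ M (λ s → f s - f (suc s))            ≈⟨ combination-cong M n (λ s → double (γ s) s)
                                                (λ s → ≡.trans (≡.cong (2 ℕ.*_) (γ-suc s)) (double-+ (γ s) (d s))) ⟩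
    combination M (A₁ 0) (B₁ 0) n          ∎
    where
    f : ℕ → Carrier
    f s = h ^ (2 ℕ.* γ s) * U s n
    γ0 : 2 ℕ.* γ 0 ≡ 0
    γ0 = ≡.cong (λ x → 2 ℕ.* (2 ℕ.* x)) (ℕₚ.*-zeroʳ ℓ)
    double : ∀ g s → 2 ℕ.* g ≡ 2 ℕ.* (1 ℕ.* g ℕ.+ 0 ℕ.* s)
    double g s = unit-A₁ g s (≡.sym (ℕₚ.+-identityʳ g))

  private
    shifted : ∀ M A (D : ℕ → Carrier) →
      (∀ n → n ℕ.< M → D n ≈ combination M A (λ s → A s ℕ.+ 2 ℕ.* d s) n) →
      ∀ n → n ℕ.< M → h ^ (2 ℕ.* n) * D n ≈ combination M (λ s → A s ℕ.+ 2 ℕ.* s) (λ s → A s ℕ.+ 2 ℕ.* s) n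
    shifted M A D D≈ n n<M = trans (*-congˡ (D≈ n n<M)) (shift-combination M A n)

    w-yes : ∀ {m} n (D : Carrier) → m ℕ.≤ i → w m n * D ≈ h ^ (2 ℕ.* γ n) * (h ^ (2 ℕ.* n) * D)
    w-yes n D m≤i = trans (*-congʳ (trans (h^-cong (≡.cong (λ x → 2 ℕ.* γ n ℕ.+ 2 ℕ.* x) (bonus-yes n m≤i)))
                                          (sym (h^-* (2 ℕ.* γ n) (2 ℕ.* n) ≡.refl)))) (*-assoc _ _ _)

    w-no : ∀ {m} n → i ℕ.< m → w m n ≈ h ^ (2 ℕ.* γ n)
    w-no n i<m = h^-cong (≡.trans (≡.cong (λ x → 2 ℕ.* γ n ℕ.+ 2 ℕ.* x) (bonus-no n i<m)) (ℕₚ.+-identityʳ _))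

    wₜ-yes : ∀ {m} n (D : Carrier) → m ℕ.≤ i → wₜ m n * D ≈ h ^ γ n * poch (- h) (n ℕ.+ ℓ) * (h ^ (2 ℕ.* n) * D)
    wₜ-yes n D m≤i = trans (*-congʳ (*-congʳ (trans (h^-cong (≡.cong (λ x → γ n ℕ.+ 2 ℕ.* x) (bonus-yes n m≤i)))
                                             (sym (h^-* (γ n) (2 ℕ.* n) ≡.refl)))))
                     (solve 4 (λ x y z u → x :* y :* z :* u := x :* z :* (y :* u)) refl _ _ _ _)

    wₜ-no : ∀ {m} n → i ℕ.< m → wₜ m n ≈ h ^ γ n * poch (- h) (n ℕ.+ ℓ)
    wₜ-no n i<m = *-congʳ (h^-cong (≡.trans (≡.cong (λ x → γ n ℕ.+ 2 ℕ.* x) (bonus-no n i<m)) (ℕₚ.+-identityʳ _)))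

  -- Steps whose weights carry the extra factor q^n.
  inner-≤ : ∀ M m → m ℕ.≤ i → ∀ n → n ℕ.< M → inner M m n ≈ combination M (A₁ m) (B₁ m) n
  inner-≤ M zero    _   n n<M = inner-unit M n n<M
  inner-≤ M (suc m) m<i n n<M = begin
    ∑ M (λ j → e⊖ n j * (w (suc m) j * inner M m j))
      ≈⟨ ∑-cong M (λ j _ → *-congˡ (w-yes j (inner M m j) m<i)) ⟩
    ∑ M (λ j → e⊖ n j * (h ^ (2 ℕ.* γ j) * (h ^ (2 ℕ.* j) * inner M m j)))
      ≈⟨ step-combination q-step M (λ s → A₁ m s ℕ.+ 2 ℕ.* s) (λ s → A₁ m s ℕ.+ 2 ℕ.* s) _
           (shifted M (A₁ m) (inner M m) (inner-≤ M m (ℕₚ.<⇒≤ m<i))) n n<M ⟩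
    1# * combination M (λ s → A₁ m s ℕ.+ 2 ℕ.* s ℕ.+ 2 ℕ.* γ s) (λ s → A₁ m s ℕ.+ 2 ℕ.* s ℕ.+ 2 ℕ.* γ (suc s)) n
      ≈⟨ trans (*-identityˡ _) (combination-cong M n (λ s → A₁-step m (γ s) s) (λ s → ≡.trans
           (≡.cong (λ x → A₁ m s ℕ.+ 2 ℕ.* s ℕ.+ 2 ℕ.* x) (γ-suc s)) (B₁-step m (γ s) s (d s)))) ⟩
    combination M (A₁ (suc m)) (B₁ (suc m)) n ∎

  -- Steps whose weights do not carry it.
  inner-≥ : ∀ M p n → n ℕ.< M → inner M (i ℕ.+ p) n ≈ combination M (A₂ p) (B₂ p) n
  inner-≥ M zero n n<M = begin
    inner M (i ℕ.+ 0) n            ≡⟨ ≡.cong (λ x → inner M x n) (ℕₚ.+-identityʳ i) ⟩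
    inner M i n                    ≈⟨ inner-≤ M i ℕₚ.≤-refl n n<M ⟩
    combination M (A₁ i) (B₁ i) n  ≈⟨ combination-cong M n A≡ (λ s → ≡.cong₂ ℕ._+_ (A≡ s) (≡.cong (2 ℕ.*_) (≡.sym (ℕₚ.*-identityˡ (d s))))) ⟩
    combination M (A₂ 0) (B₂ 0) n  ∎
    where
    A≡ : ∀ s → A₁ i s ≡ A₂ 0 s
    A≡ s = ≡.cong (λ x → 2 ℕ.* (suc x ℕ.* γ s ℕ.+ i ℕ.* s)) (≡.sym (ℕₚ.+-identityʳ i))
  inner-≥ M (suc p) n n<M = begin
    inner M (i ℕ.+ suc p) n
      ≡⟨ ≡.cong (λ x → inner M x n) (ℕₚ.+-suc i p) ⟩
    ∑ M (λ j → e⊖ n j * (w (suc (i ℕ.+ p)) j * inner M (i ℕ.+ p) j))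
      ≈⟨ ∑-cong M (λ j _ → *-congˡ (*-congʳ (w-no j (s≤s (ℕₚ.m≤m+n i p))))) ⟩
    ∑ M (λ j → e⊖ n j * (h ^ (2 ℕ.* γ j) * inner M (i ℕ.+ p) j))
      ≈⟨ step-combination q-step M (A₂ p) (B₂ p) _ (inner-≥ M p) n n<M ⟩
    1# * combination M (λ s → A₂ p s ℕ.+ 2 ℕ.* γ s) (λ s → B₂ p s ℕ.+ 2 ℕ.* γ (suc s)) n
      ≈⟨ trans (*-identityˡ _) (combination-cong M n
           (λ s → ≡.trans (A₂-step (suc (i ℕ.+ p)) (γ s) (i ℕ.* s)) (reindexA s))
           (λ s → ≡.trans (≡.cong (λ x → B₂ p s ℕ.+ 2 ℕ.* x) (γ-suc s))
             (≡.trans (B₂-step (suc (i ℕ.+ p)) (suc p) (γ s) (i ℕ.* s) (d s))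
               (≡.cong (ℕ._+ 2 ℕ.* (suc (suc p) ℕ.* d s)) (reindexA s))))) ⟩
    combination M (A₂ (suc p)) (B₂ (suc p)) n ∎
    where
    reindexA : ∀ s → 2 ℕ.* (suc (suc (i ℕ.+ p)) ℕ.* γ s ℕ.+ i ℕ.* s) ≡ A₂ (suc p) s
    reindexA s = ≡.cong (λ x → 2 ℕ.* (suc x ℕ.* γ s ℕ.+ i ℕ.* s)) (≡.sym (ℕₚ.+-suc i p))

  -- The outermost step; its weight carries the extra factor exactly when i = k = m + 1.
  outer : ∀ M m → i ℕ.≤ suc m → ∀ L → L ℕ.< M →
    let open ThetaExponents (suc m) i ℓ in
    ∑ M (λ n → e⊖ L n * (wₜ (suc m) n * inner M m n)) ≈ poch (- h) (L ℕ.+ ℓ) * combination M upper lower L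
  outer M m i≤k L L<M with suc m ℕₚ.≤? i
  ... | yes k≤i with ℕₚ.≤-antisym k≤i i≤k
  ... | ≡.refl = begin
    ∑ M (λ n → e⊖ L n * (wₜ (suc m) n * inner M m n))
      ≈⟨ ∑-cong M (λ n _ → *-congˡ (wₜ-yes n (inner M m n) ℕₚ.≤-refl)) ⟩
    ∑ M (λ n → e⊖ L n * (h ^ γ n * poch (- h) (n ℕ.+ ℓ) * (h ^ (2 ℕ.* n) * inner M m n)))
      ≈⟨ step-combination h-step M (λ s → A₁ m s ℕ.+ 2 ℕ.* s) (λ s → A₁ m s ℕ.+ 2 ℕ.* s) _
           (shifted M (A₁ m) (inner M m) (inner-≤ M m (ℕₚ.n≤1+n m))) L L<M ⟩
    poch (- h) (L ℕ.+ ℓ) * combination M (λ s → A₁ m s ℕ.+ 2 ℕ.* s ℕ.+ γ s) (λ s → A₁ m s ℕ.+ 2 ℕ.* s ℕ.+ γ (suc s)) L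
      ≈⟨ *-congˡ (combination-cong M L (λ s → A₁-last m (γ s) s) λ s → ≡.trans
           (≡.cong (A₁ m s ℕ.+ 2 ℕ.* s ℕ.+_) (γ-suc s))
           (≡.trans (≡.sym (ℕₚ.+-assoc (A₁ m s ℕ.+ 2 ℕ.* s) (γ s) (d s)))
             (≡.cong₂ ℕ._+_ (A₁-last m (γ s) s)
               (≡.trans (≡.sym (ℕₚ.*-identityˡ (d s))) (≡.cong (λ x → (2 ℕ.* x ℕ.+ 1) ℕ.* d s) (≡.sym (ℕₚ.n∸n≡0 m))))))) ⟩
    poch (- h) (L ℕ.+ ℓ) * combination M upper lower L ∎
    where open ThetaExponents (suc m) i ℓ
  outer M m i≤k L L<M | no k≰i with ℕₚ.m≤n⇒∃[o]m+o≡n (ℕ.s≤s⁻¹ (ℕₚ.≰⇒> k≰i))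
  ... | p , ≡.refl = begin
    ∑ M (λ n → e⊖ L n * (wₜ (suc m) n * inner M m n))
      ≈⟨ ∑-cong M (λ n _ → *-congˡ (*-congʳ (wₜ-no n (s≤s (ℕₚ.m≤m+n i p))))) ⟩
    ∑ M (λ n → e⊖ L n * (h ^ γ n * poch (- h) (n ℕ.+ ℓ) * inner M m n))
      ≈⟨ step-combination h-step M (A₂ p) (B₂ p) _ (inner-≥ M p) L L<M ⟩
    poch (- h) (L ℕ.+ ℓ) * combination M (λ s → A₂ p s ℕ.+ γ s) (λ s → B₂ p s ℕ.+ γ (suc s)) L
      ≈⟨ *-congˡ (combination-cong M L (λ s → A₂-last (suc m) (γ s) (i ℕ.* s)) λ s → ≡.trans
           (≡.cong (B₂ p s ℕ.+_) (γ-suc s))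
           (≡.trans (B₂-last (suc m) (suc p) (γ s) (i ℕ.* s) (d s))
             (≡.cong (λ x → upper s ℕ.+ (2 ℕ.* x ℕ.+ 1) ℕ.* d s) (≡.sym difference)))) ⟩
    poch (- h) (L ℕ.+ ℓ) * combination M upper lower L ∎
    where
    open ThetaExponents (suc m) i ℓ
    difference : suc (i ℕ.+ p) ℕ.∸ i ≡ suc p
    difference = ≡.trans (≡.cong (ℕ._∸ i) (≡.sym (ℕₚ.+-suc i p))) (ℕₚ.m+n∸m≡n i (suc p))

  open import Data.Vec.Base using ([]; _∷_; sum)

  -- The factors contributed by the variables after the first, whose value is the first argument.
  tail : ∀ {m} → ℕ → Vec ℕ m → Carrier
  tail n []               = e (n ℕ.+ 2 ℕ.* ℓ)
  tail {suc m} n (n′ ∷ v) = w (suc m) (n′ ℕ.+ sum v) * (e n′ * tail n′ v)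

  -- The summand of the multisum.
  term : ∀ {m} → Vec ℕ (suc m) → Carrier
  term {m} (n ∷ v) = wₜ (suc m) (n ℕ.+ sum v) * (e n * tail n v)

  private
    -- Substitution of n + s by n; the terms lost at the upper end vanish by assumption.
    ∑-reindex : ∀ s M (g : ℕ → Carrier) → (∀ n → M ℕ.≤ n → g n ≈ 0#) →
      ∑ M (λ n → e n * g (n ℕ.+ s)) ≈ ∑ M (λ n → e⊖ n s * g n)
    ∑-reindex zero    M       g g≈0 = ∑-cong M λ n _ → *-congˡ (reflexive (≡.cong g (ℕₚ.+-identityʳ n)))
    ∑-reindex (suc s) zero    g g≈0 = refl
    ∑-reindex (suc s) (suc M) g g≈0 = begin
      ∑ (suc M) (λ n → e n * g (n ℕ.+ suc s))
        ≈⟨ ∑-cong (suc M) (λ n _ → *-congˡ (reflexive (≡.cong g (ℕₚ.+-suc n s)))) ⟩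
      ∑ (suc M) (λ n → e n * g (suc (n ℕ.+ s)))
        ≈⟨ ∑-reindex s (suc M) (λ n → g (suc n)) (λ n M≤n → g≈0 (suc n) (ℕₚ.m≤n⇒m≤1+n M≤n)) ⟩
      ∑ M (λ n → e⊖ n s * g (suc n)) + e⊖ M s * g (suc M)
        ≈⟨ +-congˡ (trans (*-congˡ (g≈0 (suc M) ℕₚ.≤-refl)) (zeroʳ _)) ⟩
      ∑ M (λ n → e⊖ n s * g (suc n)) + 0#
        ≈⟨ +-comm _ _ ⟩
      0# + ∑ M (λ n → e⊖ n s * g (suc n))
        ≈⟨ +-congʳ (zeroˡ _) ⟨
      0# * g 0 + ∑ M (λ n → e⊖ n s * g (suc n))
        ≈⟨ ∑-front M _ ⟨
      ∑ (suc M) (λ n → e⊖ n (suc s) * g n) ∎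

  -- A summand whose outermost weight is g.
  head : ∀ {m} → (ℕ → Carrier) → Vec ℕ (suc m) → Carrier
  head g (n ∷ v) = g (n ℕ.+ sum v) * (e n * tail n v)

  -- Summation in the variables N_j = n_j + ⋯ + n_k turns the multisum into the iterated sum.
  ∑cube-head : ∀ m M (g : ℕ → Carrier) → (∀ n → M ℕ.≤ n → g n ≈ 0#) →
    ∑cube (suc m) M (head g) ≈ ∑ M (λ n → g n * inner M m n)
  ∑cube-head zero    M g g≈0 = ∑-cong M λ n _ → *-congʳ (reflexive (≡.cong g (ℕₚ.+-identityʳ n)))
  ∑cube-head (suc m) M g g≈0 = begin
    ∑ M (λ n → ∑cube (suc m) M (λ u → head g (n ∷ u)))
      ≈⟨ ∑-cong M (λ n _ → ∑cube-cong (suc m) M (separate n)) ⟩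
    ∑ M (λ n → ∑cube (suc m) M (λ u → head (w (suc m)) u * (e n * g (n ℕ.+ sum u))))
      ≈⟨ ∑cube-∑ (suc m) M M (λ n u → head (w (suc m)) u * (e n * g (n ℕ.+ sum u))) ⟨
    ∑cube (suc m) M (λ u → ∑ M (λ n → head (w (suc m)) u * (e n * g (n ℕ.+ sum u))))
      ≈⟨ ∑cube-cong (suc m) M (λ u → trans (∑-*ˡ M (head (w (suc m)) u) _) (trans (*-congˡ (∑-reindex (sum u) M g g≈0)) (sym (∑-*ˡ M (head (w (suc m)) u) _)))) ⟩
    ∑cube (suc m) M (λ u → ∑ M (λ n → head (w (suc m)) u * (e⊖ n (sum u) * g n)))
      ≈⟨ ∑cube-∑ (suc m) M M (λ n u → head (w (suc m)) u * (e⊖ n (sum u) * g n)) ⟩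
    ∑ M (λ n → ∑cube (suc m) M (λ u → head (w (suc m)) u * (e⊖ n (sum u) * g n)))
      ≈⟨ ∑-cong M (λ n _ → trans (∑cube-cong (suc m) M (regroup n)) (∑cube-*ˡ (suc m) M (g n) (head (λ j → e⊖ n j * w (suc m) j)))) ⟩
    ∑ M (λ n → g n * ∑cube (suc m) M (head (λ j → e⊖ n j * w (suc m) j)))
      ≈⟨ ∑-cong M (λ n n<M → *-congˡ (trans
           (∑cube-head m M (λ j → e⊖ n j * w (suc m) j)
             (λ j M≤j → trans (*-congʳ (reflexive (delay-vanish e (ℕₚ.<-≤-trans n<M M≤j)))) (zeroˡ _)))
           (∑-cong M λ j _ → *-assoc _ _ _))) ⟩
    ∑ M (λ n → g n * inner M (suc m) n) ∎
    where
    separate : ∀ n u → head g (n ∷ u) ≈ head (w (suc m)) u * (e n * g (n ℕ.+ sum u))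
    separate n (n′ ∷ v) = solve 3 (λ g e t → g :* (e :* t) := t :* (e :* g)) refl _ _ _
    regroup : ∀ n u → head (w (suc m)) u * (e⊖ n (sum u) * g n) ≈ g n * head (λ j → e⊖ n j * w (suc m) j) u
    regroup n (n′ ∷ v) = solve 4 (λ w t e g → w :* t :* (e :* g) := g :* (e :* w :* t)) refl _ _ _ _

  finiteIdentity : ∀ m M L → i ℕ.≤ suc m → L ℕ.< M →
    let open ThetaExponents (suc m) i ℓ in
    ∑cube (suc m) M (λ v → e⊖ L (sum v) * term v) ≈ poch (- h) (L ℕ.+ ℓ) * combination M upper lower L
  finiteIdentity m M L i≤k L<M = begin
    ∑cube (suc m) M (λ v → e⊖ L (sum v) * term v)
      ≈⟨ ∑cube-cong (suc m) M assoc ⟩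
    ∑cube (suc m) M (head (λ n → e⊖ L n * wₜ (suc m) n))
      ≈⟨ ∑cube-head m M _ (λ n M≤n → trans (*-congʳ (reflexive (delay-vanish e (ℕₚ.<-≤-trans L<M M≤n)))) (zeroˡ _)) ⟩
    ∑ M (λ n → e⊖ L n * wₜ (suc m) n * inner M m n)
      ≈⟨ ∑-cong M (λ n _ → *-assoc _ _ _) ⟩
    ∑ M (λ n → e⊖ L n * (wₜ (suc m) n * inner M m n))
      ≈⟨ outer M m i≤k L L<M ⟩
    poch (- h) (L ℕ.+ ℓ) * combination M (ThetaExponents.upper (suc m) i ℓ) (ThetaExponents.lower (suc m) i ℓ) L ∎
    where
    assoc : ∀ v → e⊖ L (sum v) * term v ≈ head (λ n → e⊖ L n * wₜ (suc m) n) v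
    assoc (n ∷ v) = sym (*-assoc _ _ _)

-- Order and powers of real numbers

module OrderedField {c ℓ₁ ℓ₂ ℓ₃ : Level} (ℛ : RealNumbers c ℓ₁ ℓ₂ ℓ₃) where

  open Analysis ℛ

  ℝ-ring : CommutativeRing c ℓ₁
  ℝ-ring = Apartness.HeytingCommutativeRing.commutativeRing (Apartness.HeytingField.heytingCommutativeRing heytingField)

  open CommutativeRing ℝ-ring using (semiring)
  open IntegerCoefficients ℝ-ring public using (module Solver)
  open Solver using (solve; _:=_; _:+_; _:*_; _:-_; :-_; con)

  infix 4 _≤_
  -- x ≤ y is the negation of y < x.
  _≤_ : ℝ → ℝ → Set ℓ₃
  x ≤ y = ¬ (y < x)

  private
    -- An order relation between two expressions that are ring-equal to given ones.
    via : ∀ {x y x′ y′} → x ≈ x′ → y ≈ y′ → x < y → x′ < y′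
    via p p′ lt = <-respˡ-≈ p (<-respʳ-≈ p′ lt)

  <-cong : ∀ {x y x′ y′} → x ≈ x′ → y ≈ y′ → x < y → x′ < y′
  <-cong = via

  ≤-cong : ∀ {x y x′ y′} → x ≈ x′ → y ≈ y′ → x ≤ y → x′ ≤ y′
  ≤-cong p p′ x≤y lt = x≤y (via (sym p′) (sym p) lt)

  <-cotrans : ∀ {x y} → x < y → ∀ z → (x < z) ⊎ (z < y)
  <-cotrans x<y z with #-cotrans (<⇒# x<y) z
  ... | inj₁ x#z with #⇒<⊎> x#z
  ...   | inj₁ x<z = inj₁ x<z
  ...   | inj₂ z<x = inj₂ (<-trans z<x x<y)
  <-cotrans x<y z | inj₂ z#y with #⇒<⊎> z#y
  ...   | inj₁ z<y = inj₂ z<y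
  ...   | inj₂ y<z = inj₁ (<-trans x<y y<z)

  <⇒≤ : ∀ {x y} → x < y → x ≤ y
  <⇒≤ x<y y<x = <-irrefl refl (<-trans x<y y<x)

  ≈⇒≤ : ∀ {x y} → x ≈ y → x ≤ y
  ≈⇒≤ x≈y y<x = <-irrefl (sym x≈y) y<x

  ≤-refl : ∀ {x} → x ≤ x
  ≤-refl = ≈⇒≤ refl

  ≤-trans : ∀ {x y z} → x ≤ y → y ≤ z → x ≤ z
  ≤-trans {y = y} x≤y y≤z z<x with <-cotrans z<x y
  ... | inj₁ z<y = y≤z z<y
  ... | inj₂ y<x = x≤y y<x

  <-≤-trans : ∀ {x y z} → x < y → y ≤ z → x < z
  <-≤-trans {z = z} x<y y≤z with <-cotrans x<y z
  ... | inj₁ x<z = x<z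
  ... | inj₂ z<y = contradiction z<y y≤z

  ≤-<-trans : ∀ {x y z} → x ≤ y → y < z → x < z
  ≤-<-trans {x} x≤y y<z with <-cotrans y<z x
  ... | inj₁ y<x = contradiction y<x x≤y
  ... | inj₂ x<z = x<z

  ≤-antisym : ∀ {x y} → x ≤ y → y ≤ x → x ≈ y
  ≤-antisym x≤y y≤x = proj₁ (tight _ _) λ x#y → [ y≤x , x≤y ]′ (#⇒<⊎> x#y)

  +-monoʳ-< : ∀ z {x y} → x < y → z + x < z + y
  +-monoʳ-< z x<y = via (+-comm _ _) (+-comm _ _) (+-monoˡ-< z x<y)

  <⇒0< : ∀ {x y} → x < y → 0# < y - x
  <⇒0< {x} x<y = via (-‿inverseʳ x) refl (+-monoˡ-< (- x) x<y)

  0<⇒< : ∀ {x y} → 0# < y - x → x < y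
  0<⇒< {x} {y} lt = via (+-identityˡ x) (solve 2 (λ x y → y :- x :+ x := y) refl x y) (+-monoˡ-< x lt)

  ≤⇒0≤ : ∀ {x y} → x ≤ y → 0# ≤ y - x
  ≤⇒0≤ {x} {y} x≤y lt = x≤y (via (solve 2 (λ x y → y :- x :+ x := y) refl x y) (+-identityˡ x) (+-monoˡ-< x lt))

  0≤⇒≤ : ∀ {x y} → 0# ≤ y - x → x ≤ y
  0≤⇒≤ {x} {y} 0≤ y<x = 0≤ (via refl (-‿inverseʳ x) (+-monoˡ-< (- x) y<x))

  +-monoˡ-≤ : ∀ z {x y} → x ≤ y → x + z ≤ y + z
  +-monoˡ-≤ z {x} {y} x≤y = 0≤⇒≤ (≤-cong refl (solve 3 (λ x y z → y :- x := (y :+ z) :- (x :+ z)) refl x y z) (≤⇒0≤ x≤y))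

  +-mono-≤ : ∀ {x y u v} → x ≤ y → u ≤ v → x + u ≤ y + v
  +-mono-≤ x≤y u≤v = ≤-trans (+-monoˡ-≤ _ x≤y) (≤-cong (+-comm _ _) (+-comm _ _) (+-monoˡ-≤ _ u≤v))

  0≤+ : ∀ {x y} → 0# ≤ x → 0# ≤ y → 0# ≤ x + y
  0≤+ 0≤x 0≤y = ≤-cong (+-identityˡ 0#) refl (+-mono-≤ 0≤x 0≤y)

  0<+ : ∀ {x y} → 0# < x → 0# ≤ y → 0# < x + y
  0<+ {x} 0<x 0≤y = <-≤-trans 0<x (≤-cong (+-identityʳ x) refl (+-mono-≤ (≤-refl {x}) 0≤y))

  0<1+ : ∀ {y} → 0# ≤ y → 0# < 1# + y
  0<1+ = 0<+ 0<1

  0≤1 : 0# ≤ 1#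
  0≤1 = <⇒≤ 0<1

  x≤x+ : ∀ {x y} → 0# ≤ y → x ≤ x + y
  x≤x+ {x} 0≤y = ≤-cong (+-identityʳ x) refl (+-mono-≤ (≤-refl {x}) 0≤y)

  private
    #0-factorʳ : ∀ {x y} → x * y # 0# → y # 0#
    #0-factorʳ {x} {y} xy#0 with #⇒invertible xy#0
    ... | z , z* , *z = invertible⇒# (z * x , trans
          (solve 3 (λ z x y → z :* x :* (y :- con (+ 0)) := z :* (x :* y :- con (+ 0))) refl z x y) z* , trans
          (solve 3 (λ z x y → (y :- con (+ 0)) :* (z :* x) := z :* (x :* y :- con (+ 0))) refl z x y) z*)

    neg-pos : ∀ {x} → x < 0# → 0# < - x
    neg-pos {x} x<0 = via refl (+-identityˡ _) (<⇒0< x<0)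

  *-0≤ : ∀ {x y} → 0# ≤ x → 0# ≤ y → 0# ≤ x * y
  *-0≤ {x} {y} 0≤x 0≤y xy<0 = [ 0≤y , (λ 0<y → [ 0≤x , (λ 0<x → <-irrefl refl (<-trans xy<0 (*-pos 0<x 0<y))) ]′ x≶0) ]′ y≶0
    where
    y≶0 : (y < 0#) ⊎ (0# < y)
    y≶0 = #⇒<⊎> (#0-factorʳ (<⇒# xy<0))
    x≶0 : (x < 0#) ⊎ (0# < x)
    x≶0 = #⇒<⊎> (#0-factorʳ {y} {x} (<⇒# (via (*-comm x y) refl xy<0)))

  *-monoˡ-≤ : ∀ {z x y} → 0# ≤ z → x ≤ y → x * z ≤ y * z
  *-monoˡ-≤ {z} {x} {y} 0≤z x≤y = 0≤⇒≤ (≤-cong refl (solve 3 (λ x y z → (y :- x) :* z := y :* z :- x :* z) refl x y z) (*-0≤ (≤⇒0≤ x≤y) 0≤z))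

  *-monoʳ-≤ : ∀ {z x y} → 0# ≤ z → x ≤ y → z * x ≤ z * y
  *-monoʳ-≤ 0≤z x≤y = ≤-cong (*-comm _ _) (*-comm _ _) (*-monoˡ-≤ 0≤z x≤y)

  *-mono-≤ : ∀ {x y u v} → 0# ≤ x → 0# ≤ v → x ≤ y → u ≤ v → x * u ≤ y * v
  *-mono-≤ 0≤x 0≤v x≤y u≤v = ≤-trans (*-monoʳ-≤ 0≤x u≤v) (*-monoˡ-≤ 0≤v x≤y)

  *-monoʳ-< : ∀ {z x y} → 0# < z → x < y → z * x < z * y
  *-monoʳ-< {z} {x} {y} 0<z x<y = 0<⇒< (via refl (solve 3 (λ x y z → z :* (y :- x) := z :* y :- z :* x) refl x y z) (*-pos 0<z (<⇒0< x<y)))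

  *-cancelˡ-≤ : ∀ {z x y} → 0# < z → z * x ≤ z * y → x ≤ y
  *-cancelˡ-≤ 0<z zx≤zy y<x = zx≤zy (*-monoʳ-< 0<z y<x)

  square-0≤ : ∀ x → 0# ≤ x * x
  square-0≤ x xx<0 = [ (λ x<0 → negative (*-pos (neg-pos x<0) (neg-pos x<0)))
                     , (λ 0<x → <-irrefl refl (<-trans xx<0 (*-pos 0<x 0<x))) ]′ (#⇒<⊎> (#0-factorʳ {x} {x} (<⇒# xx<0)))
    where
    negative : ¬ (0# < - x * - x)
    negative lt = <-irrefl refl (<-trans xx<0 (via refl (solve 1 (λ x → (:- x) :* (:- x) := x :* x) refl x) lt))

  square-mono-< : ∀ {a b} → 0# ≤ b → b < a → b * b < a * a
  square-mono-< {a} {b} 0≤b b<a = 0<⇒< (via refl (solve 2 (λ a b → (a :- b) :* (a :+ b) := a :* a :- b :* b) refl a b)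
    (*-pos (<⇒0< b<a) (0<+ (≤-<-trans 0≤b b<a) 0≤b)))

  square-cancel-≤ : ∀ {a b} → 0# ≤ b → a * a ≤ b * b → a ≤ b
  square-cancel-≤ 0≤b aa≤bb b<a = aa≤bb (square-mono-< 0≤b b<a)

  square-mono-≤ : ∀ {a b} → 0# ≤ a → a ≤ b → a * a ≤ b * b
  square-mono-≤ 0≤a a≤b = *-mono-≤ 0≤a (≤-trans 0≤a a≤b) a≤b a≤b

  -- Reciprocals of positive numbers.
  reciprocal : ∀ x → 0# < x → ∃[ y ] (0# < y) × (x * y ≈ 1#)
  reciprocal x 0<x = y , pos , xy
    where
    x#0 = #-sym (<⇒# 0<x)
    y = proj₁ (#⇒invertible x#0)
    xy : x * y ≈ 1#
    xy = trans (solve 2 (λ x y → x :* y := y :* (x :- con (+ 0))) refl x y) (proj₁ (proj₂ (#⇒invertible x#0)))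
    pos : 0# < y
    -1≮0 : ¬ (0# < - 1#)
    -1≮0 0<-1 = <-irrefl refl (<-trans 0<-1 (via (+-identityˡ _) (-‿inverseʳ 1#) (+-monoˡ-< (- 1#) 0<1)))
    pos = [ (λ y<0 → contradiction (via refl (trans (solve 2 (λ x y → x :* (:- y) := :- (x :* y)) refl x y) (-‿cong xy))
                                         (*-pos 0<x (neg-pos y<0))) -1≮0)
          , (λ 0<y → 0<y) ]′ (#⇒<⊎> (#0-factorʳ {x} {y} (#-sym (<⇒# (via refl (sym xy) 0<1)))))

  half : ∀ x → 0# < x → ∃[ y ] (0# < y) × (y + y ≈ x)
  half x 0<x = let y , 0<y , 2y≈1 = reciprocal (1# + 1#) (0<1+ 0≤1) in x * y , *-pos 0<x 0<y ,
    trans (solve 2 (λ x y → x :* y :+ x :* y := x :* ((con (+ 1) :+ con (+ 1)) :* y)) refl x y) (trans (*-congˡ 2y≈1) (*-identityʳ x))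

  -- An inequality holds once it holds up to every positive error.
  ≤-approx : ∀ {x y} → (∀ ε → 0# < ε → x ≤ y + ε) → x ≤ y
  ≤-approx {x} {y} approx y<x = let ε , 0<ε , ε+ε = half (x - y) (<⇒0< y<x) in approx ε 0<ε (0<⇒< (via refl
    (trans (solve 2 (λ e y → e := (e :+ e) :- e) refl ε y) (trans (+-congʳ ε+ε)
      (solve 3 (λ x y e → x :- y :- e := x :- (y :+ e)) refl x y ε))) 0<ε))

  open Algebra.Properties.Semiring.Exp semiring public using (_^_; ^-homo-*)

  ^-0≤ : ∀ {t} → 0# ≤ t → ∀ n → 0# ≤ t ^ n
  ^-0≤ 0≤t zero    = 0≤1
  ^-0≤ 0≤t (suc n) = *-0≤ 0≤t (^-0≤ 0≤t n)

  ^-≤1 : ∀ {t} → 0# ≤ t → t ≤ 1# → ∀ n → t ^ n ≤ 1#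
  ^-≤1 0≤t t≤1 zero    = ≤-refl
  ^-≤1 0≤t t≤1 (suc n) = ≤-cong refl (*-identityˡ 1#) (*-mono-≤ 0≤t 0≤1 t≤1 (^-≤1 0≤t t≤1 n))

  ^-antitone : ∀ {t} → 0# ≤ t → t ≤ 1# → ∀ {m n} → m ℕ.≤ n → t ^ n ≤ t ^ m
  ^-antitone {t} 0≤t t≤1 {m} m≤n with ℕₚ.m≤n⇒∃[o]m+o≡n m≤n
  ... | o , ≡.refl = ≤-cong (sym (^-homo-* t m o)) (*-identityʳ _) (*-monoʳ-≤ (^-0≤ 0≤t m) (^-≤1 0≤t t≤1 o))

  fromℕ-0≤ : ∀ n → 0# ≤ fromℕ n
  fromℕ-0≤ zero    = ≤-refl
  fromℕ-0≤ (suc n) = <⇒≤ (fromℕ-pos n)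

  -- t^n ≤ 1/(1 + n (1 - t)), a form of Bernoulli's inequality.
  bernoulli : ∀ {t} → 0# ≤ t → t ≤ 1# → ∀ n → t ^ n * (1# + fromℕ n * (1# - t)) ≤ 1#
  bernoulli {t} 0≤t t≤1 zero    = ≈⇒≤ (solve 1 (λ t → con (+ 1) :* (con (+ 1) :+ con (+ 0) :* (con (+ 1) :- t)) := con (+ 1)) refl t)
  bernoulli {t} 0≤t t≤1 (suc n) = ≤-trans
    (≤-cong (solve 3 (λ t T m → T :* (t :* (con (+ 1) :+ (con (+ 1) :+ m) :* (con (+ 1) :- t)))
                             := t :* T :* (con (+ 1) :+ (con (+ 1) :+ m) :* (con (+ 1) :- t))) refl t (t ^ n) (fromℕ n))
            refl (*-monoʳ-≤ (^-0≤ 0≤t n) key))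
    (bernoulli 0≤t t≤1 n)
    where
    key : t * (1# + (1# + fromℕ n) * (1# - t)) ≤ 1# + fromℕ n * (1# - t)
    key = 0≤⇒≤ (≤-cong refl
      (solve 2 (λ t m → (con (+ 1) :+ m) :* ((con (+ 1) :- t) :* (con (+ 1) :- t))
         := (con (+ 1) :+ m :* (con (+ 1) :- t)) :- t :* (con (+ 1) :+ (con (+ 1) :+ m) :* (con (+ 1) :- t))) refl t (fromℕ n))
      (*-0≤ (fromℕ-0≤ (suc n)) (square-0≤ _)))

  -- K t^n tends to 0.
  geometric-vanish : ∀ {t} → 0# ≤ t → t < 1# → ∀ K → 0# ≤ K → ∀ ε → 0# < ε →
    ∃[ M ] (∀ n → M ℕ.≤ n → K * t ^ n ≤ ε)
  geometric-vanish {t} 0≤t t<1 K 0≤K ε 0<ε =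
    M , λ n M≤n → ≤-trans (*-monoʳ-≤ 0≤K (^-antitone 0≤t (<⇒≤ t<1) M≤n)) bound
    where
    inverse = reciprocal (ε * (1# - t)) (*-pos 0<ε (<⇒0< t<1))
    y = proj₁ inverse
    y≈ = proj₂ (proj₂ inverse)
    M = proj₁ (archimedean (K * y))
    Ky<M = proj₂ (archimedean (K * y))
    δ = 1# - t
    0<δ : 0# < δ
    0<δ = <⇒0< t<1
    bound : K * t ^ M ≤ ε
    bound lt = contradiction contra (<-irrefl refl)
      where
      -- M δ ε ≤ K t^M M δ ≤ K, whereas M > K/(δ ε).
      mδ = fromℕ M * δ
      step₁ : ε * mδ ≤ K
      step₁ = ≤-trans (*-monoˡ-≤ (*-0≤ (fromℕ-0≤ M) (<⇒≤ 0<δ)) (<⇒≤ lt))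
        (≤-trans (≤-cong (sym (*-assoc _ _ _)) refl (*-monoʳ-≤ 0≤K
           (≤-trans (*-monoʳ-≤ (^-0≤ 0≤t M) (≤-cong refl (+-comm _ _) (x≤x+ 0≤1))) (bernoulli 0≤t (<⇒≤ t<1) M))))
           (≈⇒≤ (*-identityʳ K)))
      step₂ : K < ε * mδ
      step₂ = via (trans (solve 4 (λ e d K y → e :* d :* (K :* y) := K :* (e :* d :* y)) refl ε δ K y) (trans (*-congˡ y≈) (*-identityʳ K)))
                  (solve 3 (λ e d m → e :* d :* m := e :* (m :* d)) refl ε δ (fromℕ M)) (*-monoʳ-< (*-pos 0<ε 0<δ) Ky<M)
      contra : K < K
      contra = <-≤-trans step₂ step₁

-- Geometric convergence in complete normed rings

-- A complete normed ring over the reals, with the norm given by its upper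
-- bounds: ∣ x ∣≤ a stands for "the norm of x is at most a".
record NormedRing {c ℓ₁ ℓ₂ ℓ₃ : Level} (ℛ : RealNumbers c ℓ₁ ℓ₂ ℓ₃) : Set (lsuc (c ⊔ ℓ₁ ⊔ ℓ₂ ⊔ ℓ₃)) where
  private module ℝ = RealNumbers ℛ
  open OrderedField ℛ using (_≤_)
  field
    commutativeRing : CommutativeRing c ℓ₁
  open CommutativeRing commutativeRing using (Carrier; _≈_; _+_; _*_; _-_; -_; 0#; 1#)
  infix 4 ∣_∣≤_
  field
    ∣_∣≤_    : Carrier → ℝ.Carrier → Set ℓ₃
    ∣∣-cong  : ∀ {x y a} → x ≈ y → ∣ x ∣≤ a → ∣ y ∣≤ a
    ∣∣-0≤    : ∀ {x a} → ∣ x ∣≤ a → ℝ.0# ≤ a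
    ∣∣-mono  : ∀ {x a b} → a ≤ b → ∣ x ∣≤ a → ∣ x ∣≤ b
    ∣0∣      : ∣ 0# ∣≤ ℝ.0#
    ∣1∣      : ∣ 1# ∣≤ ℝ.1#
    ∣+∣      : ∀ {x y a b} → ∣ x ∣≤ a → ∣ y ∣≤ b → ∣ x + y ∣≤ a ℝ.+ b
    ∣*∣      : ∀ {x y a b} → ∣ x ∣≤ a → ∣ y ∣≤ b → ∣ x * y ∣≤ a ℝ.* b
    ∣-∣      : ∀ {x a} → ∣ x ∣≤ a → ∣ - x ∣≤ a
    bounded  : ∀ x → ∃[ a ] (∣ x ∣≤ a)
    closed   : ∀ {x a} → (∀ ε → ℝ.0# ℝ.< ε → ∣ x ∣≤ a ℝ.+ ε) → ∣ x ∣≤ a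
    separate : ∀ {x} → ∣ x ∣≤ ℝ.0# → x ≈ 0#

  -- Convergence.
  Lim : (ℕ → Carrier) → Carrier → Set (c ⊔ ℓ₃)
  Lim a L = ∀ ε → ℝ.0# ℝ.< ε → ∃[ M ] (∀ n → M ℕ.≤ n → ∣ a n - L ∣≤ ε)

  field
    cauchy   : ∀ a → (∀ ε → ℝ.0# ℝ.< ε → ∃[ M ] (∀ m n → M ℕ.≤ m → M ℕ.≤ n → ∣ a m - a n ∣≤ ε)) → ∃[ L ] Lim a L

-- Sequences converging at least as fast as t^n, for a fixed 0 ≤ t < 1.
module GeometricLimits {c ℓ₁ ℓ₂ ℓ₃ : Level} (ℛ : RealNumbers c ℓ₁ ℓ₂ ℓ₃) (𝒩 : NormedRing ℛ)
  (t : RealNumbers.Carrier ℛ) (0≤t : OrderedField._≤_ ℛ (RealNumbers.0# ℛ) t)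
  (t<1 : RealNumbers._<_ ℛ t (RealNumbers.1# ℛ)) where

  open OrderedField ℛ
  private module ℝ = CommutativeRing ℝ-ring
  open Analysis ℛ using (ℝ; _<_)
  open Solver using (_:=_; _:+_; _:*_; _:-_; :-_; con) renaming (solve to solveℝ)
  open NormedRing 𝒩
  open CommutativeRing commutativeRing
  open Algebra.Properties.Semiring.Exp semiring using () renaming (_^_ to _^′_)
  private
    module C = IntegerCoefficients.Solver commutativeRing
    module ∑ℝ = FiniteSums ℝ-ring
  open FiniteSums commutativeRing

  private
    t≤1 : t ≤ ℝ.1#
    t≤1 = <⇒≤ t<1

    0≤t^ : ∀ n → ℝ.0# ≤ t ^ n
    0≤t^ = ^-0≤ 0≤t

  ∣minus∣ : ∀ {x y a b} → ∣ x ∣≤ a → ∣ y ∣≤ b → ∣ x - y ∣≤ a ℝ.+ b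
  ∣minus∣ p r = ∣+∣ p (∣-∣ r)

  ∣swap∣ : ∀ {x y a} → ∣ x - y ∣≤ a → ∣ y - x ∣≤ a
  ∣swap∣ {x} {y} p = ∣∣-cong (C.solve 2 (λ x y → C.:- (x C.:- y) C.:= y C.:- x) refl x y) (∣-∣ p)

  ∣triangle∣ : ∀ {x y z a b} → ∣ x - y ∣≤ a → ∣ y - z ∣≤ b → ∣ x - z ∣≤ a ℝ.+ b
  ∣triangle∣ {x} {y} {z} p r = ∣∣-cong (C.solve 3 (λ x y z → (x C.:- y) C.:+ (y C.:- z) C.:= x C.:- z) refl x y z) (∣+∣ p r)

  ∣^∣ : ∀ {x : Carrier} {a} → ∣ x ∣≤ a → ∀ n → ∣ x ^′ n ∣≤ a ^ n
  ∣^∣ p zero    = ∣1∣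
  ∣^∣ p (suc n) = ∣*∣ p (∣^∣ p n)

  -- The value 1/(1 - t) of the geometric series.
  T : ℝ
  T = proj₁ (reciprocal (ℝ.1# ℝ.- t) (<⇒0< t<1))

  0<T : ℝ.0# < T
  0<T = proj₁ (proj₂ (reciprocal (ℝ.1# ℝ.- t) (<⇒0< t<1)))

  0≤T : ℝ.0# ≤ T
  0≤T = <⇒≤ 0<T

  T-inverse : (ℝ.1# ℝ.- t) ℝ.* T ℝ.≈ ℝ.1#
  T-inverse = proj₂ (proj₂ (reciprocal (ℝ.1# ℝ.- t) (<⇒0< t<1)))

  geometric-sum : ∀ n → ∑ℝ.∑ n (t ^_) ≤ T
  geometric-sum n = *-cancelˡ-≤ (<⇒0< t<1) (≤-cong (ℝ.sym (exact n)) (ℝ.sym T-inverse)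
    (≤-cong ℝ.refl (solveℝ 1 (λ x → (con (+ 1) :- x) :+ x := con (+ 1)) ℝ.refl (t ^ n)) (x≤x+ (0≤t^ n))))
    where
    exact : ∀ n → (ℝ.1# ℝ.- t) ℝ.* ∑ℝ.∑ n (t ^_) ℝ.≈ ℝ.1# ℝ.- t ^ n
    exact zero    = solveℝ 1 (λ t → (con (+ 1) :- t) :* con (+ 0) := con (+ 1) :- con (+ 1)) ℝ.refl t
    exact (suc n) = ℝ.trans (ℝ.distribˡ _ _ _) (ℝ.trans (ℝ.+-congʳ (exact n))
      (solveℝ 2 (λ t x → (con (+ 1) :- x) :+ (con (+ 1) :- t) :* x := con (+ 1) :- t :* x) ℝ.refl t (t ^ n)))

  ∣∑∣ : ∀ n {f : ℕ → Carrier} {g : ℕ → ℝ} → (∀ j → ∣ f j ∣≤ g j) → ∣ ∑ n f ∣≤ ∑ℝ.∑ n g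
  ∣∑∣ zero    p = ∣0∣
  ∣∑∣ (suc n) p = ∣+∣ (∣∑∣ n p) (p n)

  ∑-geometric : ∀ n {f : ℕ → Carrier} {K} → ℝ.0# ≤ K → (∀ j → ∣ f j ∣≤ K ℝ.* t ^ j) → ∣ ∑ n f ∣≤ K ℝ.* T
  ∑-geometric n {f} {K} 0≤K p = ∣∣-mono (≤-trans (≈⇒≤ (∑ℝ.∑-*ˡ n K (t ^_))) (*-monoʳ-≤ 0≤K (geometric-sum n))) (∣∑∣ n p)

  -- Convergence at the rate t^n.
  infix 4 _⇝_
  _⇝_ : (ℕ → Carrier) → Carrier → Set (c ⊔ ℓ₃)
  a ⇝ L = ∃[ K ] (∀ n → ∣ a n - L ∣≤ K ℝ.* t ^ n)

  private
    constant-0≤ : ∀ {K} {x : ℕ → Carrier} → (∀ n → ∣ x n ∣≤ K ℝ.* t ^ n) → ℝ.0# ≤ K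
    constant-0≤ {K} p = ≤-cong ℝ.refl (ℝ.*-identityʳ K) (∣∣-0≤ (p 0))

  ⇝⇒Lim : ∀ {a L} → a ⇝ L → Lim a L
  ⇝⇒Lim (K , p) ε 0<ε = let M , small = geometric-vanish 0≤t t<1 K (constant-0≤ p) ε 0<ε in
    M , λ n M≤n → ∣∣-mono (small n M≤n) (p n)

  Lim-unique : ∀ {a L L′} → Lim a L → Lim a L′ → L ≈ L′
  Lim-unique {a} {L} {L′} p r = trans (C.solve 2 (λ x y → x C.:= (x C.:- y) C.:+ y) refl L L′)
    (trans (+-congʳ (separate (closed λ ε 0<ε → close ε 0<ε))) (+-identityˡ L′))
    where
    close : ∀ ε → ℝ.0# < ε → ∣ L - L′ ∣≤ ℝ.0# ℝ.+ ε
    close ε 0<ε = ∣∣-mono (≈⇒≤ (ℝ.trans δ+δ (ℝ.sym (ℝ.+-identityˡ ε))))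
      (∣triangle∣ (∣swap∣ (proj₂ (p δ 0<δ) M (ℕₚ.m≤m⊔n _ _))) (proj₂ (r δ 0<δ) M (ℕₚ.m≤n⊔m (proj₁ (p δ 0<δ)) _)))
      where
      δ = proj₁ (half ε 0<ε)
      0<δ = proj₁ (proj₂ (half ε 0<ε))
      δ+δ = proj₂ (proj₂ (half ε 0<ε))
      M = proj₁ (p δ 0<δ) ℕ.⊔ proj₁ (r δ 0<δ)

  -- Bounds pass to limits.
  Lim-bound : ∀ {a : ℕ → Carrier} {L x b} → Lim a L → ∀ N → (∀ m → ∣ a (N ℕ.+ m) - x ∣≤ b) → ∣ L - x ∣≤ b
  Lim-bound {a} {L} {x} {b} p N bound = closed λ ε 0<ε →
    let M , near = p ε 0<ε in
    ∣∣-mono (≈⇒≤ (ℝ.+-comm ε b)) (∣triangle∣ (∣swap∣ (near (N ℕ.+ M) (ℕₚ.m≤n+m M N))) (bound M))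

  -- If neighbouring terms differ by O(t^n), then a n differs from all later terms by O(t^n).
  ⇝-steps : ∀ {a : ℕ → Carrier} {K} → (∀ n → ∣ a (suc n) - a n ∣≤ K ℝ.* t ^ n) →
            ∀ n m → ∣ a (n ℕ.+ m) - a n ∣≤ (K ℝ.* T) ℝ.* t ^ n
  ⇝-steps {a} {K} step n m = ∣∣-mono
    (≤-cong ℝ.refl (solveℝ 3 (λ k x y → k :* x :* y := k :* y :* x) ℝ.refl K (t ^ n) T)
      (*-monoʳ-≤ (*-0≤ (constant-0≤ step) (0≤t^ n)) (geometric-sum m))) (go m)
    where
    go : ∀ m → ∣ a (n ℕ.+ m) - a n ∣≤ K ℝ.* t ^ n ℝ.* ∑ℝ.∑ m (t ^_)
    go zero    rewrite ℕₚ.+-identityʳ n = ∣∣-cong (sym (-‿inverseʳ (a n))) (∣∣-mono (≈⇒≤ (ℝ.sym (ℝ.zeroʳ (K ℝ.* t ^ n)))) ∣0∣)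
    go (suc m) rewrite ℕₚ.+-suc n m = ∣∣-mono
      (≈⇒≤ (ℝ.trans (ℝ.+-congʳ (ℝ.*-congˡ (^-homo-* t n m)))
        (solveℝ 4 (λ k x y s → k :* (x :* y) :+ k :* x :* s := k :* x :* (s :+ y)) ℝ.refl K (t ^ n) (t ^ m) _)))
      (∣triangle∣ (step (n ℕ.+ m)) (go m))

  -- If successive differences are O(t^n), the sequence converges at that rate.
  ⇝-complete : ∀ {a : ℕ → Carrier} {K} → (∀ n → ∣ a (suc n) - a n ∣≤ K ℝ.* t ^ n) → ∃[ L ] (a ⇝ L)
  ⇝-complete {a} {K} step = L , K ℝ.* T , λ n → ∣swap∣ (Lim-bound (proj₂ limit) n (⇝-steps step n))
    where
    is-cauchy : ∀ ε → ℝ.0# < ε → ∃[ M ] (∀ m n → M ℕ.≤ m → M ℕ.≤ n → ∣ a m - a n ∣≤ ε)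
    is-cauchy ε 0<ε = M , λ m n M≤m M≤n → ∣∣-mono (≈⇒≤ δ+δ) (∣triangle∣ (near m M≤m) (∣swap∣ (near n M≤n)))
      where
      δ = proj₁ (half ε 0<ε)
      δ+δ = proj₂ (proj₂ (half ε 0<ε))
      vanish = geometric-vanish 0≤t t<1 (K ℝ.* T) (*-0≤ (constant-0≤ step) 0≤T) δ (proj₁ (proj₂ (half ε 0<ε)))
      M = proj₁ vanish
      near : ∀ m → M ℕ.≤ m → ∣ a m - a M ∣≤ δ
      near m M≤m = ∣∣-mono (proj₂ vanish M ℕₚ.≤-refl)
        (≡.subst (λ x → ∣ a x - a M ∣≤ (K ℝ.* T) ℝ.* t ^ M) (ℕₚ.m+[n∸m]≡n M≤m) (⇝-steps step M (m ℕ.∸ M)))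
    limit : ∃[ L ] Lim a L
    limit = cauchy a is-cauchy
    L = proj₁ limit

  ⇝-series : ∀ {f : ℕ → Carrier} {K} → (∀ n → ∣ f n ∣≤ K ℝ.* t ^ n) → ∃[ S ] ((λ n → ∑ n f) ⇝ S)
  ⇝-series {f} p = ⇝-complete λ n → ∣∣-cong (C.solve 2 (λ s x → x C.:= (s C.:+ x) C.:- s) refl (∑ n f) (f n)) (p n)

  ⇝-cong : ∀ {a b L} → (∀ n → a n ≈ b n) → a ⇝ L → b ⇝ L
  ⇝-cong eq (K , p) = K , λ n → ∣∣-cong (+-congʳ (eq n)) (p n)

  ⇝-const : ∀ x → (λ _ → x) ⇝ x
  ⇝-const x = ℝ.0# , λ n → ∣∣-cong (sym (-‿inverseʳ x)) (∣∣-mono (≈⇒≤ (ℝ.sym (ℝ.zeroˡ _))) ∣0∣)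

  ⇝-shift : ∀ {a L} d → a ⇝ L → (λ n → a (n ℕ.+ d)) ⇝ L
  ⇝-shift d (K , p) = K , λ n → ∣∣-mono (*-monoʳ-≤ (constant-0≤ p) (^-antitone 0≤t t≤1 (ℕₚ.m≤m+n n d))) (p (n ℕ.+ d))

  ⇝-perturb : ∀ {a b : ℕ → Carrier} {L K} → (∀ n → ∣ b n - a n ∣≤ K ℝ.* t ^ n) → a ⇝ L → b ⇝ L
  ⇝-perturb {K = K} near (K′ , p) = K ℝ.+ K′ , λ n →
    ∣∣-mono (≈⇒≤ (ℝ.sym (ℝ.distribʳ _ _ _))) (∣triangle∣ (near n) (p n))

  ⇝-minus : ∀ {a b L L′} → a ⇝ L → b ⇝ L′ → (λ n → a n - b n) ⇝ (L - L′)
  ⇝-minus {a} {b} {L} {L′} (K , p) (K′ , r) = K ℝ.+ K′ , λ n → ∣∣-cong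
    (C.solve 4 (λ a b x y → (a C.:- x) C.:- (b C.:- y) C.:= (a C.:- b) C.:- (x C.:- y)) refl (a n) (b n) L L′)
    (∣∣-mono (≈⇒≤ (ℝ.sym (ℝ.distribʳ _ _ _))) (∣minus∣ (p n) (r n)))

  ⇝-bounded : ∀ {a L} → a ⇝ L → ∃[ K ] (∀ n → ∣ a n ∣≤ K)
  ⇝-bounded {a} {L} (K , p) = K ℝ.+ proj₁ (bounded L) , λ n → ∣∣-cong
    (C.solve 2 (λ a x → (a C.:- x) C.:+ x C.:= a) refl (a n) L)
    (∣+∣ (∣∣-mono (≤-cong ℝ.refl (ℝ.*-identityʳ K) (*-monoʳ-≤ (constant-0≤ p) (^-≤1 0≤t t≤1 n))) (p n)) (proj₂ (bounded L)))

  ⇝-* : ∀ {a b L L′} → a ⇝ L → b ⇝ L′ → (λ n → a n * b n) ⇝ (L * L′)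
  ⇝-* {a} {b} {L} {L′} (K , p) lim@(K′ , r) = K ℝ.* B ℝ.+ A ℝ.* K′ , λ n → ∣∣-cong
    (C.solve 4 (λ a b x y → (a C.:- x) C.:* b C.:+ x C.:* (b C.:- y) C.:= a C.:* b C.:- x C.:* y) refl (a n) (b n) L L′)
    (∣∣-mono (≈⇒≤ (solveℝ 5 (λ k b a k′ x → k :* x :* b :+ a :* (k′ :* x) := (k :* b :+ a :* k′) :* x) ℝ.refl K B A K′ (t ^ n)))
      (∣+∣ (∣*∣ (p n) (proj₂ (⇝-bounded lim) n)) (∣*∣ (proj₂ (bounded L)) (r n))))
    where
    A = proj₁ (bounded L)
    B = proj₁ (⇝-bounded lim)

  -- If e tends to E, then e (L - s) - E is O(t^(L-s)) for s ≤ L, and bounded for s > L; either way its product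
  -- with an x of size O(t^s) is O(t^L).
  delay-bound : ∀ {e E} → e ⇝ E → ∃[ K ] (ℝ.0# ≤ K) ×
    (∀ L s {x c} → ℝ.0# ≤ c → ∣ x ∣≤ c ℝ.* t ^ s → ∣ (delay e L s - E) * x ∣≤ K ℝ.* c ℝ.* t ^ L)
  delay-bound {e} {E} (K , p) = K ℝ.+ A , 0≤+ 0≤K 0≤A , bound
    where
    A = proj₁ (bounded E)
    ∣E∣ = proj₂ (bounded E)
    0≤A = ∣∣-0≤ ∣E∣
    0≤K = constant-0≤ p
    bound : ∀ L s {x c} → ℝ.0# ≤ c → ∣ x ∣≤ c ℝ.* t ^ s → ∣ (delay e L s - E) * x ∣≤ (K ℝ.+ A) ℝ.* c ℝ.* t ^ L
    bound L s {x} {c} 0≤c ∣x∣ with s ℕₚ.≤? L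
    ... | no s≰L = ∣∣-cong
        (*-congʳ (trans (C.solve 1 (λ x → C.:- x C.:= C.con (+ 0) C.:- x) refl E) (+-congʳ (reflexive (≡.sym (delay-vanish e (ℕₚ.≰⇒> s≰L)))))))
        (∣∣-mono (≤-trans (*-monoʳ-≤ 0≤A (*-monoʳ-≤ 0≤c (^-antitone 0≤t t≤1 (ℕₚ.<⇒≤ (ℕₚ.≰⇒> s≰L)))))
                 (≤-cong (ℝ.*-assoc _ _ _) ℝ.refl (*-monoˡ-≤ (0≤t^ L) (*-monoˡ-≤ 0≤c (≤-cong ℝ.refl (ℝ.+-comm A K) (x≤x+ 0≤K))))))
          (∣*∣ (∣-∣ ∣E∣) ∣x∣))
    ... | yes s≤L = ∣∣-cong (*-congʳ (+-congʳ (reflexive (≡.trans (≡.sym (delay-diag e s o)) (≡.cong (λ n → delay e n s) (ℕₚ.m+[n∸m]≡n s≤L))))))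
        (∣∣-mono (≤-trans (≈⇒≤ (ℝ.trans (solveℝ 4 (λ k c x y → k :* x :* (c :* y) := k :* c :* (y :* x)) ℝ.refl K c (t ^ o) (t ^ s))
                                (ℝ.*-congˡ (ℝ.trans (ℝ.sym (^-homo-* t s o)) (ℝ.reflexive (≡.cong (t ^_) (ℕₚ.m+[n∸m]≡n s≤L)))))))
                   (*-monoˡ-≤ (0≤t^ L) (*-monoˡ-≤ 0≤c (x≤x+ 0≤A))))
          (∣*∣ (p o) ∣x∣))
      where o = L ℕ.∸ s

  -- Dominated convergence: replacing e (L - n) by its limit E changes the sum by O(t^L), whatever the range.
  dominated : ∀ {e E} → e ⇝ E → ∀ {f : ℕ → Carrier} {C} → ℝ.0# ≤ C → (∀ n → ∣ f n ∣≤ C ℝ.* t ^ n ℝ.* t ^ n) → ∃[ K ]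
    (∀ L M → ∣ ∑ M (λ n → delay e L n * f n) - E * ∑ M f ∣≤ K ℝ.* t ^ L)
  dominated {e} {E} lim {f} {C} 0≤C ∣f∣ = K ℝ.* C ℝ.* T , λ L M → ∣∣-cong (difference L M)
    (∣∣-mono (≈⇒≤ (solveℝ 4 (λ k c x y → k :* c :* x :* y := k :* c :* y :* x) ℝ.refl K C (t ^ L) T))
      (∑-geometric M (*-0≤ (*-0≤ 0≤K 0≤C) (0≤t^ L)) λ n → ∣∣-mono
        (≈⇒≤ (solveℝ 4 (λ k c x y → k :* (c :* y) :* x := k :* c :* x :* y) ℝ.refl K C (t ^ L) (t ^ n)))
        (proj₂ (proj₂ tail) L n (*-0≤ 0≤C (0≤t^ n)) (∣f∣ n))))
    where
    tail = delay-bound lim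
    K = proj₁ tail
    0≤K = proj₁ (proj₂ tail)
    difference : ∀ L M → ∑ M (λ n → (delay e L n - E) * f n) ≈ ∑ M (λ n → delay e L n * f n) - E * ∑ M f
    difference L M = trans (∑-cong M λ n _ → C.solve 3 (λ x y z → (x C.:- y) C.:* z C.:= x C.:* z C.:- y C.:* z) refl _ _ _)
      (trans (∑-minus M _ _) (+-congˡ (-‿cong (∑-*ˡ M E f))))

  open import Data.Vec.Base using ([]; _∷_; sum)

  ∣∑cube∣ : ∀ k M {f : Vec ℕ k → Carrier} {g : Vec ℕ k → ℝ} → (∀ v → ∣ f v ∣≤ g v) → ∣ ∑cube k M f ∣≤ ∑ℝ.∑cube k M g
  ∣∑cube∣ zero    M p = p []
  ∣∑cube∣ (suc k) M p = ∣∑∣ M λ n → ∣∑cube∣ k M λ v → p (n ∷ v)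

  geometric-cube : ∀ k M → ∑ℝ.∑cube k M (λ v → t ^ sum v) ≤ T ^ k
  geometric-cube zero    M = ≤-refl
  geometric-cube (suc k) M = ≤-cong (ℝ.sym factor) ℝ.refl
    (≤-trans (*-monoʳ-≤ (nonnegative k) (geometric-sum M)) (≤-cong (ℝ.*-comm T _) ℝ.refl (*-monoʳ-≤ 0≤T (geometric-cube k M))))
    where
    slice : ∀ k n → ∑ℝ.∑cube k M (λ v → t ^ (n ℕ.+ sum v)) ℝ.≈ ∑ℝ.∑cube k M (λ v → t ^ sum v) ℝ.* t ^ n
    slice k n = ℝ.trans (∑ℝ.∑cube-cong k M λ v → ^-homo-* t n (sum v)) (ℝ.trans (∑ℝ.∑cube-*ˡ k M (t ^ n) _) (ℝ.*-comm _ _))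
    ∑-0≤ : ∀ m {f : ℕ → ℝ} → (∀ n → ℝ.0# ≤ f n) → ℝ.0# ≤ ∑ℝ.∑ m f
    ∑-0≤ zero    p = ≤-refl
    ∑-0≤ (suc m) p = 0≤+ (∑-0≤ m p) (p m)
    nonnegative : ∀ k → ℝ.0# ≤ ∑ℝ.∑cube k M (λ v → t ^ sum v)
    nonnegative zero    = 0≤1
    nonnegative (suc k) = ∑-0≤ M λ n → ≤-cong ℝ.refl (ℝ.sym (slice k n)) (*-0≤ (nonnegative k) (0≤t^ n))
    factor : ∑ℝ.∑ M (λ n → ∑ℝ.∑cube k M (λ v → t ^ (n ℕ.+ sum v))) ℝ.≈ ∑ℝ.∑cube k M (λ v → t ^ sum v) ℝ.* ∑ℝ.∑ M (t ^_)
    factor = ℝ.trans (∑ℝ.∑-cong M λ n _ → slice k n) (∑ℝ.∑-*ˡ M _ _)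

  ∑cube-geometric : ∀ k M {f : Vec ℕ k → Carrier} {K} → ℝ.0# ≤ K → (∀ v → ∣ f v ∣≤ K ℝ.* t ^ sum v) →
                    ∣ ∑cube k M f ∣≤ K ℝ.* T ^ k
  ∑cube-geometric k M {f} {K} 0≤K p = ∣∣-mono
    (≤-cong (ℝ.sym (∑ℝ.∑cube-*ˡ k M K _)) ℝ.refl (*-monoʳ-≤ 0≤K (geometric-cube k M))) (∣∑cube∣ k M p)

  -- The same for multiple sums, with e (L - n_1 - ⋯ - n_k).
  dominated-cube : ∀ {e E} → e ⇝ E → ∀ k {f : Vec ℕ k → Carrier} {C} → ℝ.0# ≤ C →
    (∀ v → ∣ f v ∣≤ C ℝ.* t ^ sum v ℝ.* t ^ sum v) → ∃[ K ]
    (∀ L M → ∣ ∑cube k M (λ v → delay e L (sum v) * f v) - E * ∑cube k M f ∣≤ K ℝ.* t ^ L)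
  dominated-cube {e} {E} lim k {f} {C} 0≤C ∣f∣ = K ℝ.* C ℝ.* T ^ k , λ L M → ∣∣-cong (difference L M)
    (∣∣-mono (≈⇒≤ (solveℝ 4 (λ k c x y → k :* c :* x :* y := k :* c :* y :* x) ℝ.refl K C (t ^ L) (T ^ k)))
      (∑cube-geometric k M (*-0≤ (*-0≤ 0≤K 0≤C) (0≤t^ L)) λ v → ∣∣-mono
        (≈⇒≤ (solveℝ 4 (λ k c x y → k :* (c :* y) :* x := k :* c :* x :* y) ℝ.refl K C (t ^ L) (t ^ sum v)))
        (proj₂ (proj₂ tail) L (sum v) (*-0≤ 0≤C (0≤t^ (sum v))) (∣f∣ v))))
    where
    tail = delay-bound lim
    K = proj₁ tail
    0≤K = proj₁ (proj₂ tail)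
    difference : ∀ L M → ∑cube k M (λ v → (delay e L (sum v) - E) * f v) ≈ ∑cube k M (λ v → delay e L (sum v) * f v) - E * ∑cube k M f
    difference L M = trans (∑cube-cong k M λ v → C.solve 3 (λ x y z → (x C.:- y) C.:* z C.:= x C.:* z C.:+ (C.:- y) C.:* z) refl _ _ _)
      (trans (∑cube-+ k M _ _) (+-congˡ (trans (∑cube-*ˡ k M (- E) f)
        (C.solve 2 (λ x y → (C.:- x) C.:* y C.:= C.:- (x C.:* y)) refl E _))))

-- Unconditional sums

module FiniteSets where

  open import Data.List.Base using ([]; _∷_; _++_; cartesianProductWith; downFrom)

  -- A duplicate-free list decomposes along a duplicate-free sublist.
  complement : ∀ {A : Set} (F G : List A) → Unique F → Unique G → F ⊆ G →
    ∃[ H ] (G ↭ F ++ H) × Unique H × (∀ {x} → x ∈ H → x ∈ G × x ∉ F)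
  complement []      G _ uG _ = G , Perm.refl , uG , λ x∈G → x∈G , λ ()
  complement {A} (x ∷ F) G (x∉F AllPairs.∷ uF) uG F⊆G with ∈ₚ.∈-∃++ (F⊆G (here ≡.refl))
  ... | ys , zs , ≡.refl = H , ↭-trans G↭ (Perm.prep x G′↭) , uH , outside
    where
    G′ = ys ++ zs
    G↭ : G ↭ x ∷ G′
    G↭ = ↭ₚ.shift x ys zs
    uxG′ : Unique (x ∷ G′)
    uxG′ = ↭ₛₚ.Unique-resp-↭ (≡.setoid A) (↭⇒↭ₛ G↭) uG
    F⊆G′ : F ⊆ G′
    F⊆G′ y∈F with ↭ₚ.∈-resp-↭ G↭ (F⊆G (there y∈F))
    ... | here ≡.refl = contradiction ≡.refl (All.lookup x∉F y∈F)
    ... | there y∈G′  = y∈G′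
    rest = complement F G′ uF (AllPairs.tail uxG′) F⊆G′
    H = proj₁ rest
    G′↭ = proj₁ (proj₂ rest)
    uH = proj₁ (proj₂ (proj₂ rest))
    outside : ∀ {y} → y ∈ H → y ∈ G × y ∉ x ∷ F
    outside {y} y∈H = ↭ₚ.∈-resp-↭ (↭-sym G↭) (there y∈G′) , λ
      { (here ≡.refl) → All.lookup (AllPairs.head uxG′) y∈G′ ≡.refl
      ; (there y∈F)   → proj₂ (proj₂ (proj₂ (proj₂ rest)) y∈H) y∈F }
      where y∈G′ = proj₁ (proj₂ (proj₂ (proj₂ rest)) y∈H)

  -- The vectors with all components below M.
  cube : ∀ k → ℕ → List (Vec ℕ k)
  cube zero    M = Vec.[] ∷ []
  cube (suc k) M = cartesianProductWith Vec._∷_ (downFrom M) (cube k M)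

  cube-unique : ∀ k M → Unique (cube k M)
  cube-unique zero    M = All.[] AllPairs.∷ AllPairs.[]
  cube-unique (suc k) M = Uniqueₚ.cartesianProductWith⁺ Vec._∷_ Vecₚ.∷-injective (Uniqueₚ.downFrom⁺ M) (cube-unique k M)

  ∈-cube : ∀ {k M} (v : Vec ℕ k) → Vec.sum v ℕ.< M → v ∈ cube k M
  ∈-cube Vec.[]      _ = here ≡.refl
  ∈-cube (n Vec.∷ v) s = ∈ₚ.∈-cartesianProductWith⁺ Vec._∷_
    (∈ₚ.∈-downFrom⁺ (ℕₚ.≤-<-trans (ℕₚ.m≤m+n n _) s)) (∈-cube v (ℕₚ.≤-<-trans (ℕₚ.m≤n+m _ n) s))

  -- Every finite set of vectors lies in a cube.
  enclosing-cube : ∀ {k} (G : List (Vec ℕ k)) → ∃[ M ] (G ⊆ cube k M)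
  enclosing-cube {k} G = suc (size G) , λ v∈G → ∈-cube _ (s≤s (sum≤size G v∈G))
    where
    size : List (Vec ℕ k) → ℕ
    size []      = 0
    size (v ∷ G) = Vec.sum v ℕ.+ size G
    sum≤size : ∀ G {v} → v ∈ G → Vec.sum v ℕ.≤ size G
    sum≤size (v ∷ G) (here ≡.refl) = ℕₚ.m≤m+n _ _
    sum≤size (v ∷ G) (there v∈G)   = ℕₚ.≤-trans (sum≤size G v∈G) (ℕₚ.m≤n+m _ _)

module ListSums {c ℓ : Level} (R : CommutativeRing c ℓ) where

  open CommutativeRing R
  open FiniteSums R
  open FiniteSets
  open import Data.List.Base using ([]; _∷_; _++_; map; cartesianProductWith; downFrom)

  -- The sum of f over a list.
  listSum : {A : Set} → (A → Carrier) → List A → Carrier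
  listSum f = List.foldr (λ x s → f x + s) 0#

  listSum-++ : ∀ {A : Set} (f : A → Carrier) F G → listSum f (F ++ G) ≈ listSum f F + listSum f G
  listSum-++ f []      G = sym (+-identityˡ _)
  listSum-++ f (x ∷ F) G = trans (+-congˡ (listSum-++ f F G)) (sym (+-assoc _ _ _))

  listSum-↭ : ∀ {A : Set} (f : A → Carrier) {F G} → F ↭ G → listSum f F ≈ listSum f G
  listSum-↭ f Perm.refl         = refl
  listSum-↭ f (Perm.prep x p)   = +-congˡ (listSum-↭ f p)
  listSum-↭ f (Perm.swap x y p) = trans (sym (+-assoc _ _ _)) (trans (+-cong (+-comm _ _) (listSum-↭ f p)) (+-assoc _ _ _))
  listSum-↭ f (Perm.trans p r)  = trans (listSum-↭ f p) (listSum-↭ f r)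

  listSum-map : ∀ {A B : Set} (f : B → Carrier) (g : A → B) F → listSum f (map g F) ≈ listSum (λ x → f (g x)) F
  listSum-map f g []      = refl
  listSum-map f g (x ∷ F) = +-congˡ (listSum-map f g F)

  listSum-cube : ∀ k M (f : Vec ℕ k → Carrier) → listSum f (cube k M) ≈ ∑cube k M f
  listSum-cube zero    M f = +-identityʳ _
  listSum-cube (suc k) M f = rows M
    where
    rows : ∀ m → listSum f (cartesianProductWith Vec._∷_ (downFrom m) (cube k M)) ≈ ∑ m (λ n → ∑cube k M (λ v → f (n Vec.∷ v)))
    rows zero    = refl
    rows (suc m) = trans (listSum-++ f (map (m Vec.∷_) (cube k M)) _) (trans
      (+-cong (trans (listSum-map f (m Vec.∷_) (cube k M)) (listSum-cube k M (λ v → f (m Vec.∷ v)))) (rows m)) (+-comm _ _))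

module UnconditionalSums {c ℓ₁ ℓ₂ ℓ₃ : Level} (ℛ : RealNumbers c ℓ₁ ℓ₂ ℓ₃) (𝒩 : NormedRing ℛ)
  (t : RealNumbers.Carrier ℛ) (0≤t : OrderedField._≤_ ℛ (RealNumbers.0# ℛ) t)
  (t<1 : RealNumbers._<_ ℛ t (RealNumbers.1# ℛ)) where

  open OrderedField ℛ
  private module ℝ = CommutativeRing ℝ-ring
  open Analysis ℛ using (ℝ; _<_)
  open NormedRing 𝒩
  open CommutativeRing commutativeRing
  open GeometricLimits ℛ 𝒩 t 0≤t t<1
  private
    module C = IntegerCoefficients.Solver commutativeRing
    module ∑ℝ where
      open FiniteSums ℝ-ring public
      open ListSums ℝ-ring public
  open FiniteSums commutativeRing
  open ListSums commutativeRing
  open FiniteSets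
  open import Data.List.Base using ([]; _∷_)

  private
    listSum-0≤ : ∀ {k} (G : List (Vec ℕ k)) → ℝ.0# ≤ ∑ℝ.listSum (λ v → t ^ Vec.sum v) G
    listSum-0≤ []      = ≤-refl
    listSum-0≤ (v ∷ G) = 0≤+ (^-0≤ 0≤t (Vec.sum v)) (listSum-0≤ G)

    -- The list is completed to a cube, where the sum is a product of geometric sums.
    geometric-list : ∀ {k} (G : List (Vec ℕ k)) → Unique G → ∑ℝ.listSum (λ v → t ^ Vec.sum v) G ≤ T ^ k
    geometric-list {k} G uG = ≤-trans (x≤x+ (listSum-0≤ H)) (≤-cong
      (ℝ.trans (ℝ.sym (∑ℝ.listSum-cube k M _)) (ℝ.trans (∑ℝ.listSum-↭ _ cube↭) (∑ℝ.listSum-++ _ G H))) ℝ.refl (geometric-cube k M))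
      where
      M = proj₁ (enclosing-cube G)
      rest = complement G (cube k M) uG (cube-unique k M) (proj₂ (enclosing-cube G))
      H = proj₁ rest
      cube↭ = proj₁ (proj₂ rest)

    ∣listSum∣ : ∀ {k K} (f : Vec ℕ k → Carrier) G → (∀ {v} → v ∈ G → ∣ f v ∣≤ K ℝ.* t ^ Vec.sum v) →
               ∣ listSum f G ∣≤ K ℝ.* ∑ℝ.listSum (λ v → t ^ Vec.sum v) G
    ∣listSum∣ {K = K} f []      p = ∣∣-mono (≈⇒≤ (ℝ.sym (ℝ.zeroʳ K))) ∣0∣
    ∣listSum∣ {K = K} f (v ∷ G) p = ∣∣-mono (≈⇒≤ (ℝ.sym (ℝ.distribˡ K _ _))) (∣+∣ (p (here ≡.refl)) (∣listSum∣ f G (λ v∈G → p (there v∈G))))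

  -- A family bounded by C t^(2(n_1 + ⋯ + n_k)) is unconditionally summable as soon as its sums over cubes converge.
  unconditional : ∀ {k C S} (f : Vec ℕ k → Carrier) → ℝ.0# ≤ C →
    (∀ v → ∣ f v ∣≤ C ℝ.* t ^ Vec.sum v ℝ.* t ^ Vec.sum v) → Lim (λ n → ∑cube k n f) S →
    ∀ ε → ℝ.0# < ε → Σ (List (Vec ℕ k)) λ F → ∀ G → Unique G → F ⊆ G → ∣ listSum f G - S ∣≤ ε
  unconditional {k} {C} {S} f 0≤C ∣f∣ lim ε 0<ε = cube k M , near
    where
    δ = proj₁ (half ε 0<ε)
    0<δ = proj₁ (proj₂ (half ε 0<ε))
    δ+δ = proj₂ (proj₂ (half ε 0<ε))
    vanish = geometric-vanish 0≤t t<1 (C ℝ.* T ^ k) (*-0≤ 0≤C (^-0≤ 0≤T k)) δ 0<δ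
    M = proj₁ (lim δ 0<δ) ℕ.⊔ proj₁ vanish
    near : ∀ G → Unique G → cube k M ⊆ G → ∣ listSum f G - S ∣≤ ε
    near G uG F⊆G = ∣∣-cong split (∣∣-mono (≈⇒≤ δ+δ) (∣+∣ (proj₂ (lim δ 0<δ) M (ℕₚ.m≤m⊔n _ _)) small))
      where
      rest = complement (cube k M) G (cube-unique k M) uG F⊆G
      H = proj₁ rest
      split : (∑cube k M f - S) + listSum f H ≈ listSum f G - S
      split = trans (C.solve 3 (λ x y z → (x C.:- y) C.:+ z C.:= (x C.:+ z) C.:- y) refl (∑cube k M f) S (listSum f H))
        (+-congʳ (sym (trans (listSum-↭ f (proj₁ (proj₂ rest))) (trans (listSum-++ f (cube k M) H) (+-congʳ (listSum-cube k M f))))))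
      large : ∀ {v} → v ∈ H → M ℕ.≤ Vec.sum v
      large {v} v∈H = ℕₚ.≮⇒≥ λ lt → proj₂ (proj₂ (proj₂ (proj₂ rest)) v∈H) (∈-cube v lt)
      small : ∣ listSum f H ∣≤ δ
      small = ∣∣-mono
        (≤-trans (*-monoʳ-≤ (*-0≤ 0≤C (^-0≤ 0≤t M)) (geometric-list H (proj₁ (proj₂ (proj₂ rest)))))
          (≤-trans (≈⇒≤ (ℝ.trans (ℝ.*-assoc _ _ _) (ℝ.trans (ℝ.*-congˡ (ℝ.*-comm _ _)) (ℝ.sym (ℝ.*-assoc _ _ _)))))
            (proj₂ vanish M (ℕₚ.m≤n⊔m (proj₁ (lim δ 0<δ)) _))))
        (∣listSum∣ f H λ {v} v∈H → ∣∣-mono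
          (*-monoˡ-≤ (^-0≤ 0≤t (Vec.sum v)) (*-monoʳ-≤ 0≤C (^-antitone 0≤t (<⇒≤ t<1) (large v∈H)))) (∣f∣ v))

-- The complex numbers

module ComplexNumbers {c ℓ₁ ℓ₂ ℓ₃ : Level} (ℛ : RealNumbers c ℓ₁ ℓ₂ ℓ₃) where

  open OrderedField ℛ
  open Analysis ℛ
  open Solver using (solve; _:=_; _:+_; _:*_; _:-_; :-_; con)

  ℂ-commutativeRing : CommutativeRing c ℓ₁
  ℂ-commutativeRing = record
    { Carrier = ℂ ; _≈_ = _≈ᶜ_ ; _+_ = _+ᶜ_ ; _*_ = _*ᶜ_ ; -_ = -ᶜ_ ; 0# = 0ᶜ ; 1# = 1ᶜ
    ; isCommutativeRing = record
      { isRing = record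
        { +-isAbelianGroup = record
          { isGroup = record
            { isMonoid = record
              { isSemigroup = record
                { isMagma = record
                  { isEquivalence = record
                    { refl  = refl , refl
                    ; sym   = λ { (p , r) → sym p , sym r }
                    ; trans = λ { (p , r) (p′ , r′) → trans p p′ , trans r r′ }
                    }
                  ; ∙-cong = λ { (p , r) (p′ , r′) → +-cong p p′ , +-cong r r′ }
                  }
                ; assoc = λ x y z → +-assoc _ _ _ , +-assoc _ _ _
                }
              ; identity = (λ x → +-identityˡ _ , +-identityˡ _) , (λ x → +-identityʳ _ , +-identityʳ _)
              }
            ; inverse = (λ x → -‿inverseˡ _ , -‿inverseˡ _) , (λ x → -‿inverseʳ _ , -‿inverseʳ _)
            ; ⁻¹-cong = λ { (p , r) → -‿cong p , -‿cong r }
            }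
          ; comm = λ x y → +-comm _ _ , +-comm _ _
          }
        ; *-cong = λ { (p , r) (p′ , r′) → +-cong (*-cong p p′) (-‿cong (*-cong r r′)) , +-cong (*-cong p r′) (*-cong r p′) }
        ; *-assoc = λ { (a +i b) (a′ +i b′) (a″ +i b″) →
            solve 6 (λ a b x y u v → (a :* x :- b :* y) :* u :- (a :* y :+ b :* x) :* v
                                  := a :* (x :* u :- y :* v) :- b :* (x :* v :+ y :* u)) refl a b a′ b′ a″ b″ ,
            solve 6 (λ a b x y u v → (a :* x :- b :* y) :* v :+ (a :* y :+ b :* x) :* u
                                  := a :* (x :* v :+ y :* u) :+ b :* (x :* u :- y :* v)) refl a b a′ b′ a″ b″ }
        ; *-identity =
            (λ { (a +i b) → solve 2 (λ a b → con (+ 1) :* a :- con (+ 0) :* b := a) refl a b ,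
                            solve 2 (λ a b → con (+ 1) :* b :+ con (+ 0) :* a := b) refl a b }) ,
            (λ { (a +i b) → solve 2 (λ a b → a :* con (+ 1) :- b :* con (+ 0) := a) refl a b ,
                            solve 2 (λ a b → a :* con (+ 0) :+ b :* con (+ 1) := b) refl a b })
        ; distrib =
            (λ { (a +i b) (a′ +i b′) (a″ +i b″) →
              solve 6 (λ a b x y u v → a :* (x :+ u) :- b :* (y :+ v) := (a :* x :- b :* y) :+ (a :* u :- b :* v)) refl a b a′ b′ a″ b″ ,
              solve 6 (λ a b x y u v → a :* (y :+ v) :+ b :* (x :+ u) := (a :* y :+ b :* x) :+ (a :* v :+ b :* u)) refl a b a′ b′ a″ b″ }) ,
            (λ { (a +i b) (a′ +i b′) (a″ +i b″) →
              solve 6 (λ a b x y u v → (x :+ u) :* a :- (y :+ v) :* b := (x :* a :- y :* b) :+ (u :* a :- v :* b)) refl a b a′ b′ a″ b″ ,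
              solve 6 (λ a b x y u v → (x :+ u) :* b :+ (y :+ v) :* a := (x :* b :+ y :* a) :+ (u :* b :+ v :* a)) refl a b a′ b′ a″ b″ })
        }
      ; *-comm = λ { (a +i b) (a′ +i b′) →
          solve 4 (λ a b x y → a :* x :- b :* y := x :* a :- y :* b) refl a b a′ b′ ,
          solve 4 (λ a b x y → a :* y :+ b :* x := x :* b :+ y :* a) refl a b a′ b′ }
      }
    }

  module ℂ-ring = CommutativeRing ℂ-commutativeRing

  ∣∣²-cong : ∀ {z w} → z ≈ᶜ w → ∣ z ∣² ≈ ∣ w ∣²
  ∣∣²-cong (p , r) = +-cong (*-cong p p) (*-cong r r)

  -- The norm is multiplicative.
  ∣∣²-* : ∀ z w → ∣ z *ᶜ w ∣² ≈ ∣ z ∣² * ∣ w ∣²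
  ∣∣²-* (a +i b) (x +i y) = solve 4 (λ a b x y →
    (a :* x :- b :* y) :* (a :* x :- b :* y) :+ (a :* y :+ b :* x) :* (a :* y :+ b :* x)
      := (a :* a :+ b :* b) :* (x :* x :+ y :* y)) refl a b x y

  ∣∣²-0≤ : ∀ z → 0# ≤ ∣ z ∣²
  ∣∣²-0≤ z = 0≤+ (square-0≤ _) (square-0≤ _)

  private
    -- The norm of z is at most a.
    Bound : ℂ → ℝ → Set ℓ₃
    Bound z a = (0# ≤ a) × (∣ z ∣² ≤ a * a)

    -- The Cauchy-Schwarz inequality.
    inner-product : ∀ {z w a b} → Bound z a → Bound w b → re z * re w + im z * im w ≤ a * b
    inner-product {x +i y} {u +i v} {a} {b} (0≤a , p) (0≤b , r) = square-cancel-≤ (*-0≤ 0≤a 0≤b)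
      (≤-trans (≤-cong refl
          (solve 4 (λ x y u v → (x :* u :+ y :* v) :* (x :* u :+ y :* v) :+ (x :* v :- y :* u) :* (x :* v :- y :* u)
                             := (x :* x :+ y :* y) :* (u :* u :+ v :* v)) refl x y u v)
          (x≤x+ (square-0≤ _)))
        (≤-cong refl (solve 2 (λ a b → (a :* a) :* (b :* b) := (a :* b) :* (a :* b)) refl a b)
          (*-mono-≤ (∣∣²-0≤ (x +i y)) (square-0≤ b) p r)))

    Bound-+ : ∀ {z w a b} → Bound z a → Bound w b → Bound (z +ᶜ w) (a + b)
    Bound-+ {x +i y} {u +i v} {a} {b} Bz@(0≤a , p) Bw@(0≤b , r) = 0≤+ 0≤a 0≤b ,
      ≤-cong (solve 4 (λ x y u v → (x :* x :+ y :* y :+ (u :* u :+ v :* v)) :+ ((x :* u :+ y :* v) :+ (x :* u :+ y :* v))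
                               := (x :+ u) :* (x :+ u) :+ (y :+ v) :* (y :+ v)) refl x y u v)
             (solve 2 (λ a b → (a :* a :+ b :* b) :+ (a :* b :+ a :* b) := (a :+ b) :* (a :+ b)) refl a b)
        (+-mono-≤ (+-mono-≤ p r) (+-mono-≤ cs cs))
      where
      cs : x * u + y * v ≤ a * b
      cs = inner-product {x +i y} {u +i v} Bz Bw

    Bound-* : ∀ {z w a b} → Bound z a → Bound w b → Bound (z *ᶜ w) (a * b)
    Bound-* {z} {w} {a} {b} (0≤a , p) (0≤b , r) = *-0≤ 0≤a 0≤b ,
      ≤-cong (sym (∣∣²-* z w)) (solve 2 (λ a b → (a :* a) :* (b :* b) := (a :* b) :* (a :* b)) refl a b)
        (*-mono-≤ (∣∣²-0≤ z) (square-0≤ b) p r)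

    Bound-closed : ∀ {z a} → (∀ ε → 0# < ε → Bound z (a + ε)) → Bound z a
    Bound-closed {z} {a} p = 0≤a , ≤-approx approx
      where
      0≤a : 0# ≤ a
      0≤a = ≤-approx λ ε 0<ε → proj₁ (p ε 0<ε)
      -- With ε = η/(2a + 1 + η) one has ε ≤ 1 and (a + ε)² ≤ a² + ε (2a + 1) ≤ a² + η.
      approx : ∀ η → 0# < η → ∣ z ∣² ≤ a * a + η
      approx η 0<η = ≤-trans (proj₂ (p ε 0<ε))
        (≤-trans expand (+-mono-≤ (≤-refl {a * a}) εd≤η))
        where
        d = a + a + 1# + η
        0<d : 0# < d
        0<d = <-cong refl (solve 2 (λ a η → (η :+ (a :+ a)) :+ con (+ 1) := a :+ a :+ con (+ 1) :+ η) refl a η) (0<+ (0<+ 0<η (0≤+ 0≤a 0≤a)) 0≤1)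
        r = proj₁ (reciprocal d 0<d)
        0<r = proj₁ (proj₂ (reciprocal d 0<d))
        dr = proj₂ (proj₂ (reciprocal d 0<d))
        ε = η * r
        0<ε : 0# < ε
        0<ε = *-pos 0<η 0<r
        ε≤1 : ε ≤ 1#
        ε≤1 = ≤-cong refl (trans (solve 3 (λ x y r → y :* r :+ x :* r := (x :+ y) :* r) refl (a + a + 1#) η r) dr)
                (x≤x+ (*-0≤ (0≤+ (0≤+ 0≤a 0≤a) 0≤1) (<⇒≤ 0<r)))
        expand : (a + ε) * (a + ε) ≤ a * a + ε * (a + a + 1#)
        expand = 0≤⇒≤ (≤-cong refl (solve 2 (λ a e → e :* (con (+ 1) :- e) := (a :* a :+ e :* (a :+ a :+ con (+ 1))) :- (a :+ e) :* (a :+ e)) refl a ε)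
                   (*-0≤ (<⇒≤ 0<ε) (≤⇒0≤ ε≤1)))
        εd≤η : ε * (a + a + 1#) ≤ η
        εd≤η = ≤-trans (*-monoʳ-≤ (<⇒≤ 0<ε) (x≤x+ (<⇒≤ 0<η)))
          (≈⇒≤ (trans (solve 3 (λ n r d → n :* r :* d := n :* (d :* r)) refl η r d) (trans (*-congˡ dr) (*-identityʳ η))))

    square≤0 : ∀ {x} → x * x ≤ 0# → x ≈ 0#
    square≤0 {x} p = ≤-antisym (nonpositive p)
      (≤-cong refl (solve 1 (λ x → con (+ 0) :- (:- x) := x) refl x)
        (≤⇒0≤ (nonpositive (≤-cong (solve 1 (λ x → x :* x := (:- x) :* (:- x)) refl x) refl p))))
      where
      nonpositive : ∀ {y} → y * y ≤ 0# → y ≤ 0#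
      nonpositive yy≤0 = square-cancel-≤ ≤-refl (≤-cong refl (sym (zeroˡ 0#)) yy≤0)

    square-sum≤0 : ∀ {x y} → x * x + y * y ≤ 0# → x ≈ 0#
    square-sum≤0 p = square≤0 (≤-trans (x≤x+ (square-0≤ _)) p)

  re≤ : ∀ {z a} → Bound z a → re z ≤ a
  re≤ (0≤a , p) = square-cancel-≤ 0≤a (≤-trans (x≤x+ (square-0≤ _)) p)

  private
    Bound-neg : ∀ {z a} → Bound z a → Bound (-ᶜ z) a
    Bound-neg {z} (0≤a , p) = 0≤a , ≤-cong (solve 2 (λ x y → x :* x :+ y :* y := (:- x) :* (:- x) :+ (:- y) :* (:- y)) refl (re z) (im z)) refl p

    im≤ : ∀ {z a} → Bound z a → im z ≤ a
    im≤ (0≤a , p) = square-cancel-≤ 0≤a (≤-trans (≤-cong refl (+-comm _ _) (x≤x+ (square-0≤ _))) p)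

    difference< : ∀ {x y δ ε} → x - y ≤ δ → δ < ε → x < y + ε
    difference< {x} {y} p lt = <-cong (solve 2 (λ x y → x :- y :+ y := x) refl x y) (+-comm _ _) (+-monoˡ-< y (≤-<-trans p lt))

    <difference : ∀ {x y ε} → x < y + ε → x - y ≤ ε
    <difference {x} {y} {ε} lt = <⇒≤ (<-cong refl (solve 2 (λ y e → (y :+ e) :- y := e) refl y ε) (+-monoˡ-< (- y) lt))

    square-bound : ∀ {x δ} → x ≤ δ → - x ≤ δ → x * x ≤ δ * δ
    square-bound {x} {δ} p r = 0≤⇒≤ (≤-cong refl (solve 2 (λ x d → (d :- x) :* (d :- (:- x)) := d :* d :- x :* x) refl x δ)
      (*-0≤ (≤⇒0≤ p) (≤⇒0≤ r)))

    CauchySequence : (ℕ → ℂ) → Set (c ⊔ ℓ₃)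
    CauchySequence a = ∀ ε → 0# < ε → ∃[ M ] (∀ m n → M ℕ.≤ m → M ℕ.≤ n → Bound (a m -ᶜ a n) ε)

    complete-component : (π : ℂ → ℝ) → (∀ {z w ε} → Bound (z -ᶜ w) ε → π z - π w ≤ ε) → ∀ a → CauchySequence a →
      ∃[ L ] (∀ ε → 0# < ε → ∃[ M ] (∀ n → M ℕ.≤ n → Within ε (π (a n)) L))
    complete-component π π≤ a cauchy = complete (λ n → π (a n)) λ ε 0<ε →
      let δ , 0<δ , δ+δ = half ε 0<ε
          M , near = cauchy δ 0<δ
          δ<ε : δ < ε
          δ<ε = <-cong (+-identityˡ δ) δ+δ (+-monoˡ-< δ 0<δ)
      in M , λ m n M≤m M≤n → difference< (π≤ {a m} {a n} (near m n M≤m M≤n)) δ<ε , difference< (π≤ {a n} {a m} (near n m M≤n M≤m)) δ<ε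

    Bound-cauchy : ∀ a → CauchySequence a → ∃[ L ] (∀ ε → 0# < ε → ∃[ M ] (∀ n → M ℕ.≤ n → Bound (a n -ᶜ L) ε))
    Bound-cauchy a cauchy = L , converges
      where
      real = complete-component re (λ {z} {w} → re≤ {z -ᶜ w}) a cauchy
      imaginary = complete-component im (λ {z} {w} → im≤ {z -ᶜ w}) a cauchy
      L = proj₁ real +i proj₁ imaginary
      converges : ∀ ε → 0# < ε → ∃[ M ] (∀ n → M ℕ.≤ n → Bound (a n -ᶜ L) ε)
      converges ε 0<ε = Mᵣ ℕ.⊔ Mᵢ , λ n M≤n →
        <⇒≤ 0<ε , ≤-trans (+-mono-≤ (component (proj₂ (proj₂ real δ 0<δ) n (ℕₚ.≤-trans (ℕₚ.m≤m⊔n Mᵣ Mᵢ) M≤n)))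
                                   (component (proj₂ (proj₂ imaginary δ 0<δ) n (ℕₚ.≤-trans (ℕₚ.m≤n⊔m Mᵣ Mᵢ) M≤n)))) bound
        where
        δ = proj₁ (half ε 0<ε)
        0<δ = proj₁ (proj₂ (half ε 0<ε))
        δ+δ = proj₂ (proj₂ (half ε 0<ε))
        Mᵣ = proj₁ (proj₂ real δ 0<δ)
        Mᵢ = proj₁ (proj₂ imaginary δ 0<δ)
        component : ∀ {x y} → Within δ x y → (x - y) * (x - y) ≤ δ * δ
        component {x} {y} (p , r) = square-bound (<difference p)
          (≤-cong (solve 2 (λ x y → y :- x := :- (x :- y)) refl x y) refl (<difference r))
        bound : δ * δ + δ * δ ≤ ε * ε
        bound = ≤-cong refl (trans (solve 1 (λ d → d :* d :+ d :* d :+ (d :* d :+ d :* d) := (d :+ d) :* (d :+ d)) refl δ) (*-cong δ+δ δ+δ))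
          (x≤x+ (0≤+ (square-0≤ δ) (square-0≤ δ)))

  ℂ-normed : NormedRing ℛ
  ℂ-normed = record
    { commutativeRing = ℂ-commutativeRing
    ; ∣_∣≤_    = Bound
    ; ∣∣-cong  = λ eq → λ { (0≤a , p) → 0≤a , ≤-cong (∣∣²-cong eq) refl p }
    ; ∣∣-0≤    = proj₁
    ; ∣∣-mono  = λ a≤b → λ { (0≤a , p) → ≤-trans 0≤a a≤b , ≤-trans p (square-mono-≤ 0≤a a≤b) }
    ; ∣0∣      = ≤-refl , ≈⇒≤ (solve 0 (con (+ 0) :* con (+ 0) :+ con (+ 0) :* con (+ 0) := con (+ 0) :* con (+ 0)) refl)
    ; ∣1∣      = 0≤1 , ≈⇒≤ (solve 0 (con (+ 1) :* con (+ 1) :+ con (+ 0) :* con (+ 0) := con (+ 1) :* con (+ 1)) refl)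
    ; ∣+∣      = λ {z} {w} → Bound-+ {z} {w}
    ; ∣*∣      = λ {z} {w} → Bound-* {z} {w}
    ; ∣-∣      = λ {z} → Bound-neg {z}
    ; bounded  = λ z → 1# + ∣ z ∣² , 0≤+ 0≤1 (∣∣²-0≤ z) ,
        ≤-cong refl (solve 1 (λ s → s :+ (con (+ 1) :+ (s :+ s :* s)) := (con (+ 1) :+ s) :* (con (+ 1) :+ s)) refl ∣ z ∣²)
          (x≤x+ (0≤+ 0≤1 (0≤+ (∣∣²-0≤ z) (square-0≤ _))))
    ; closed   = λ {z} → Bound-closed {z}
    ; separate = λ { {x +i y} (_ , p) → square-sum≤0 (≤-cong refl (zeroˡ 0#) p) , square-sum≤0 (≤-cong (+-comm _ _) (zeroˡ 0#) p) }
    ; cauchy   = Bound-cauchy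
    }

  open NormedRing ℂ-normed public using (∣_∣≤_; Lim)

  Lim⇒⟶ : ∀ {a L} → Lim a L → a ⟶ L
  Lim⇒⟶ lim ε 0<ε =
    let δ , 0<δ , δ+δ = half ε 0<ε
        M , near = lim δ 0<δ
        δ<ε : δ < ε
        δ<ε = <-cong (+-identityˡ δ) δ+δ (+-monoˡ-< δ 0<δ)
    in M , λ n M≤n → ≤-<-trans (proj₂ (near n M≤n)) (square-mono-< (<⇒≤ 0<δ) δ<ε)

  ⟶⇒Lim : ∀ {a L} → a ⟶ L → Lim a L
  ⟶⇒Lim lim ε 0<ε = let M , near = lim ε 0<ε in M , λ n M≤n → <⇒≤ 0<ε , <⇒≤ (near n M≤n)

-- Rational numbers

-- The embeddings of ℕ, ℤ and ℚ in the reals preserve the arithmetic operations.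
module Embeddings {c ℓ₁ ℓ₂ ℓ₃ : Level} (ℛ : RealNumbers c ℓ₁ ℓ₂ ℓ₃) where

  open OrderedField ℛ
  open Analysis ℛ
  private module ℝ = CommutativeRing ℝ-ring
  open IntegerCoefficients ℝ-ring using (fromInteger; fromInteger-+; fromInteger-*; fromInteger-neg)
  open Solver using (solve; _:=_; _:+_; _:*_; _:-_; :-_; con)
  open Relation.Binary.Reasoning.Setoid ℝ.setoid

  fromℕ-* : ∀ m n → fromℕ (m ℕ.* n) ≈ fromℕ m * fromℕ n
  fromℕ-* m n = Algebra.Properties.Semiring.Mult.×1-homo-* ℝ.semiring m n

  fromℕ-+ : ∀ m n → fromℕ (m ℕ.+ n) ≈ fromℕ m + fromℕ n
  fromℕ-+ m n = Algebra.Properties.Semiring.Mult.×-homo-+ ℝ.semiring 1# m n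

  fromℤ≈fromInteger : ∀ x → fromℤ x ≈ fromInteger x
  fromℤ≈fromInteger (+ n)    = Algebra.Properties.Semiring.Mult.TCOptimised.×ᵤ≈× ℝ.semiring n 1#
  fromℤ≈fromInteger -[1+ n ] = -‿cong (Algebra.Properties.Semiring.Mult.TCOptimised.×ᵤ≈× ℝ.semiring (suc n) 1#)

  fromℤ-+ : ∀ x y → fromℤ (x ℤ.+ y) ≈ fromℤ x + fromℤ y
  fromℤ-+ x y = trans (fromℤ≈fromInteger (x ℤ.+ y)) (trans (fromInteger-+ x y)
    (sym (+-cong (fromℤ≈fromInteger x) (fromℤ≈fromInteger y))))

  fromℤ-* : ∀ x y → fromℤ (x ℤ.* y) ≈ fromℤ x * fromℤ y
  fromℤ-* x y = trans (fromℤ≈fromInteger (x ℤ.* y)) (trans (fromInteger-* x y)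
    (sym (*-cong (fromℤ≈fromInteger x) (fromℤ≈fromInteger y))))

  fromℤ-neg : ∀ x → fromℤ (ℤ.- x) ≈ - fromℤ x
  fromℤ-neg x = trans (fromℤ≈fromInteger (ℤ.- x)) (trans (fromInteger-neg x) (-‿cong (sym (fromℤ≈fromInteger x))))

  recip-inverse : ∀ n .{{_ : ℕ.NonZero n}} → fromℕ n * recipℕ n ≈ 1#
  recip-inverse n = trans (solve 2 (λ x y → x :* y := y :* (x :- con (+ 0))) refl _ _) (proj₁ (proj₂ (#⇒invertible (fromℕ#0 n))))
    where open import Data.Product.Base using (proj₁; proj₂)

  inverse-unique : ∀ {x y z} → x * y ≈ 1# → x * z ≈ 1# → y ≈ z
  inverse-unique {x} {y} {z} xy xz = begin
    y            ≈⟨ *-identityʳ y ⟨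
    y * 1#       ≈⟨ *-congˡ xz ⟨
    y * (x * z)  ≈⟨ solve 3 (λ x y z → y :* (x :* z) := x :* y :* z) refl x y z ⟩
    x * y * z    ≈⟨ *-congʳ xy ⟩
    1# * z       ≈⟨ *-identityˡ z ⟩
    z            ∎

  fromℚ-/ : ∀ p n .{{_ : ℕ.NonZero n}} → fromℚ (p ℚ./ n) ≈ fromℤ p * recipℕ n
  fromℚ-/ p n = begin
    fromℤ (↥ r) * recipℕ (↧ₙ r)        ≈⟨ *-congˡ (inverse-unique (recip-inverse (↧ₙ r)) denominator) ⟩
    fromℤ (↥ r) * (G * recipℕ n)       ≈⟨ *-assoc _ _ _ ⟨
    fromℤ (↥ r) * G * recipℕ n         ≈⟨ *-congʳ (fromℤ-* (↥ r) g) ⟨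
    fromℤ (↥ r ℤ.* g) * recipℕ n       ≡⟨ ≡.cong (λ x → fromℤ x * recipℕ n) (ℚₚ.↥-/ p n) ⟩
    fromℤ p * recipℕ n                 ∎
    where
    r = p ℚ./ n
    g = ℤ.gcd p (+ n)
    G = fromℤ g
    denominator : fromℕ (↧ₙ r) * (G * recipℕ n) ≈ 1#
    denominator = begin
      fromℕ (↧ₙ r) * (G * recipℕ n)  ≈⟨ *-assoc _ _ _ ⟨
      fromℤ (↧ r) * G * recipℕ n     ≈⟨ *-congʳ (fromℤ-* (↧ r) g) ⟨
      fromℤ (↧ r ℤ.* g) * recipℕ n   ≡⟨ ≡.cong (λ x → fromℤ x * recipℕ n) (ℚₚ.↧-/ p n) ⟩
      fromℕ n * recipℕ n             ≈⟨ recip-inverse n ⟩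
      1#                             ∎

  private
    recip-* : ∀ m n .{{_ : ℕ.NonZero m}} .{{_ : ℕ.NonZero n}} .{{_ : ℕ.NonZero (m ℕ.* n)}} →
              recipℕ (m ℕ.* n) ≈ recipℕ m * recipℕ n
    recip-* m n = inverse-unique (recip-inverse (m ℕ.* n)) (begin
      fromℕ (m ℕ.* n) * (recipℕ m * recipℕ n)          ≈⟨ *-congʳ (fromℕ-* m n) ⟩
      fromℕ m * fromℕ n * (recipℕ m * recipℕ n)        ≈⟨ solve 4 (λ a b x y → a :* b :* (x :* y) := a :* x :* (b :* y)) refl _ _ _ _ ⟩
      fromℕ m * recipℕ m * (fromℕ n * recipℕ n)        ≈⟨ *-cong (recip-inverse m) (recip-inverse n) ⟩
      1# * 1#                                          ≈⟨ *-identityˡ 1# ⟩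
      1#                                               ∎)

  fromℚ-+ : ∀ p r → fromℚ (p ℚ.+ r) ≈ fromℚ p + fromℚ r
  fromℚ-+ p@(mkℚ a b-1 _) r@(mkℚ x y-1 _) = begin
    fromℚ (p ℚ.+ r)                                            ≈⟨ fromℚ-/ (a ℤ.* Y ℤ.+ x ℤ.* B) (b ℕ.* y) ⟩
    fromℤ (a ℤ.* Y ℤ.+ x ℤ.* B) * recipℕ (b ℕ.* y)             ≈⟨ *-cong (trans (fromℤ-+ (a ℤ.* Y) (x ℤ.* B)) (+-cong (fromℤ-* a Y) (fromℤ-* x B))) (recip-* b y) ⟩
    (fromℤ a * fromℕ y + fromℤ x * fromℕ b) * (recipℕ b * recipℕ y)
      ≈⟨ solve 6 (λ a b x y β η → (a :* y :+ x :* b) :* (β :* η) := a :* β :* (y :* η) :+ x :* η :* (b :* β)) refl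
           (fromℤ a) (fromℕ b) (fromℤ x) (fromℕ y) (recipℕ b) (recipℕ y) ⟩
    fromℤ a * recipℕ b * (fromℕ y * recipℕ y) + fromℤ x * recipℕ y * (fromℕ b * recipℕ b)
      ≈⟨ +-cong (trans (*-congˡ (recip-inverse y)) (*-identityʳ _)) (trans (*-congˡ (recip-inverse b)) (*-identityʳ _)) ⟩
    fromℚ p + fromℚ r ∎
    where
    b = suc b-1
    y = suc y-1
    B Y : ℤ
    B = + b
    Y = + y

  fromℚ-* : ∀ p r → fromℚ (p ℚ.* r) ≈ fromℚ p * fromℚ r
  fromℚ-* p@(mkℚ a b-1 _) r@(mkℚ x y-1 _) = begin
    fromℚ (p ℚ.* r)                                     ≈⟨ fromℚ-/ (a ℤ.* x) (b ℕ.* y) ⟩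
    fromℤ (a ℤ.* x) * recipℕ (b ℕ.* y)                  ≈⟨ *-cong (fromℤ-* a x) (recip-* b y) ⟩
    fromℤ a * fromℤ x * (recipℕ b * recipℕ y)
      ≈⟨ solve 4 (λ a b x y → a :* b :* (x :* y) := a :* x :* (b :* y)) refl _ _ _ _ ⟩
    fromℚ p * fromℚ r                                   ∎
    where
    b = suc b-1
    y = suc y-1

  fromℚ-neg : ∀ p → fromℚ (ℚ.- p) ≈ - fromℚ p
  fromℚ-neg (mkℚ (+ zero) b _)    = solve 1 (λ β → con (+ 0) :* β := :- (con (+ 0) :* β)) refl (recipℕ (suc b))
  fromℚ-neg (mkℚ (+ suc a) b _)   = solve 2 (λ a β → (:- a) :* β := :- (a :* β)) refl _ (recipℕ (suc b))
  fromℚ-neg (mkℚ -[1+ a ] b _)    = solve 2 (λ a β → a :* β := :- ((:- a) :* β)) refl _ (recipℕ (suc b))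

  fromℚ-ℤ : ∀ x → fromℚ (ℤ⇒ℚ x) ≈ fromℤ x
  fromℚ-ℤ x = trans (fromℚ-/ x 1) (trans (*-congˡ (trans (sym (*-identityˡ _)) (trans (*-congʳ (sym (+-identityʳ 1#))) (recip-inverse 1)))) (*-identityʳ _))

-- The exponential function

-- The reciprocals κ n of n! in a commutative ring, together with those of the positive integers.
record FactorialReciprocals {c ℓ : Level} (R : CommutativeRing c ℓ) : Set (c ⊔ ℓ) where
  open CommutativeRing R
  open Algebra.Properties.Semiring.Mult semiring using () renaming (_×_ to _·_)
  field
    κ           : ℕ → Carrier
    κ-zero      : κ 0 ≈ 1#
    κ-suc       : ∀ n → (suc n · 1#) * κ (suc n) ≈ κ n
    inverse     : ℕ → Carrier
    inverse-suc : ∀ n → inverse n * (suc n · 1#) ≈ 1#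

-- The Cauchy product of two exponential series.
module ExponentialSeries {c ℓ : Level} (R : CommutativeRing c ℓ) (reciprocals : FactorialReciprocals R) where

  open CommutativeRing R
  open FactorialReciprocals reciprocals
  open Algebra.Properties.Semiring.Mult semiring using () renaming (_×_ to _·_)
  open Algebra.Properties.Semiring.Exp semiring using (_^_)
  open Algebra.Properties.Semiring.Mult semiring using (×-homo-+)
  open Relation.Binary.Reasoning.Setoid setoid
  open IntegerCoefficients R using (module Solver)
  open Solver using (solve; _:=_; _:*_)
  open FiniteSums R

  -- The terms of the exponential series.
  summand : Carrier → ℕ → Carrier
  summand z n = κ n * z ^ n

  summand-suc : ∀ z n → (suc n · 1#) * summand z (suc n) ≈ z * summand z n
  summand-suc z n = begin
    (suc n · 1#) * (κ (suc n) * (z * z ^ n)) ≈⟨ solve 4 (λ a b z y → a :* (b :* (z :* y)) := z :* (a :* b :* y)) refl _ _ _ _ ⟩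
    z * ((suc n · 1#) * κ (suc n) * z ^ n)   ≈⟨ *-congˡ (*-congʳ (κ-suc n)) ⟩
    z * (κ n * z ^ n)                        ∎

  -- Both sides satisfy (n + 1) c (n + 1) = (z + w) c n.
  conv-summand : ∀ z w n → conv n (λ i j → summand z i * summand w j) ≈ summand (z + w) n
  conv-summand z w zero    = trans (*-cong (*-identityʳ _) (trans (*-identityʳ _) κ-zero)) refl
  conv-summand z w (suc n) = begin
    conv (suc n) F                                       ≈⟨ cancel (conv (suc n) F) ⟨
    inverse n * ((suc n · 1#) * conv (suc n) F)          ≈⟨ *-congˡ recurrence ⟩
    inverse n * ((z + w) * summand (z + w) n)            ≈⟨ *-congˡ (summand-suc (z + w) n) ⟨
    inverse n * ((suc n · 1#) * summand (z + w) (suc n)) ≈⟨ cancel _ ⟩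
    summand (z + w) (suc n)                              ∎
    where
    F : ℕ → ℕ → Carrier
    F i j = summand z i * summand w j
    cancel : ∀ x → inverse n * ((suc n · 1#) * x) ≈ x
    cancel x = trans (sym (*-assoc _ _ _)) (trans (*-congʳ (inverse-suc n)) (*-identityˡ x))
    split : ∀ i j → i ℕ.+ j ≡ suc n → (suc n · 1#) * F i j ≈ (i · 1#) * F i j + (j · 1#) * F i j
    split i j eq = trans (*-congʳ (trans (reflexive (≡.cong (_· 1#) (≡.sym eq))) (×-homo-+ 1# i j))) (distribʳ _ _ _)
    left : conv (suc n) (λ i j → (i · 1#) * F i j) ≈ z * conv n F
    left = begin
      0# * F 0 (suc n) + conv n (λ i j → (suc i · 1#) * F (suc i) j)
        ≈⟨ +-cong (zeroˡ _) (conv-cong n λ i j _ → trans (sym (*-assoc _ _ _)) (trans (*-congʳ (summand-suc z i)) (*-assoc _ _ _))) ⟩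
      0# + conv n (λ i j → z * F i j) ≈⟨ +-identityˡ _ ⟩
      conv n (λ i j → z * F i j)      ≈⟨ conv-*ˡ n z F ⟩
      z * conv n F                    ∎
    right : conv (suc n) (λ i j → (j · 1#) * F i j) ≈ w * conv n F
    right = begin
      conv (suc n) (λ i j → (j · 1#) * F i j)
        ≈⟨ conv-back n (λ i j → (j · 1#) * F i j) ⟩
      conv n (λ i j → (suc j · 1#) * F i (suc j)) + 0# * F (suc n) 0
        ≈⟨ +-cong (conv-cong n λ i j _ → trans
             (solve 3 (λ a x y → a :* (x :* y) := x :* (a :* y)) refl _ _ _)
             (trans (*-congˡ (summand-suc w j)) (solve 3 (λ x w y → x :* (w :* y) := w :* (x :* y)) refl _ _ _))) (zeroˡ _) ⟩
      conv n (λ i j → w * F i j) + 0# ≈⟨ +-identityʳ _ ⟩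
      conv n (λ i j → w * F i j)      ≈⟨ conv-*ˡ n w F ⟩
      w * conv n F                    ∎
    recurrence : (suc n · 1#) * conv (suc n) F ≈ (z + w) * summand (z + w) n
    recurrence = begin
      (suc n · 1#) * conv (suc n) F                     ≈⟨ conv-*ˡ (suc n) _ F ⟨
      conv (suc n) (λ i j → (suc n · 1#) * F i j)       ≈⟨ conv-cong (suc n) split ⟩
      conv (suc n) (λ i j → (i · 1#) * F i j + (j · 1#) * F i j) ≈⟨ conv-+ (suc n) (λ i j → (i · 1#) * F i j) (λ i j → (j · 1#) * F i j) ⟩
      conv (suc n) (λ i j → (i · 1#) * F i j) + conv (suc n) (λ i j → (j · 1#) * F i j) ≈⟨ +-cong left right ⟩
      z * conv n F + w * conv n F                       ≈⟨ distribʳ _ z w ⟨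
      (z + w) * conv n F                                ≈⟨ *-congˡ (conv-summand z w n) ⟩
      (z + w) * summand (z + w) n                       ∎

  -- The sum of F i j over i + j ≤ n, arranged by rows.
  ∑-conv : ∀ n (F : ℕ → ℕ → Carrier) → ∑ (suc n) (λ s → conv s F) ≈ conv n (λ i j → ∑ (suc j) (F i))
  ∑-conv zero    F = refl
  ∑-conv (suc n) F = begin
    ∑ (suc (suc n)) (λ s → conv s F)
      ≈⟨ ∑-front (suc n) (λ s → conv s F) ⟩
    F 0 0 + ∑ (suc n) (λ s → F 0 (suc s) + conv s (λ i → F (suc i)))
      ≈⟨ +-congˡ (∑-+ (suc n) (λ s → F 0 (suc s)) _) ⟩
    F 0 0 + (∑ (suc n) (λ s → F 0 (suc s)) + ∑ (suc n) (λ s → conv s (λ i → F (suc i))))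
      ≈⟨ +-assoc _ _ _ ⟨
    F 0 0 + ∑ (suc n) (λ s → F 0 (suc s)) + ∑ (suc n) (λ s → conv s (λ i → F (suc i)))
      ≈⟨ +-cong (sym (∑-front (suc n) (F 0))) (∑-conv n (λ i → F (suc i))) ⟩
    ∑ (suc (suc n)) (F 0) + conv n (λ i j → ∑ (suc j) (F (suc i))) ∎

  -- The partial sums of the series of z + w, arranged by the partial sums of the series of w.
  ∑-summand-+ : ∀ z w n → ∑ (suc n) (summand (z + w))
    ≈ ∑ (suc n) (λ i → delay (λ j → ∑ (suc j) (summand w)) n i * summand z i)
  ∑-summand-+ z w n = begin
    ∑ (suc n) (summand (z + w))
      ≈⟨ ∑-cong (suc n) (λ s _ → conv-summand z w s) ⟨
    ∑ (suc n) (λ s → conv s (λ i j → summand z i * summand w j))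
      ≈⟨ ∑-conv n _ ⟩
    conv n (λ i j → ∑ (suc j) (λ m → summand z i * summand w m))
      ≈⟨ conv-cong n (λ i j _ → trans (∑-*ˡ (suc j) _ _) (*-comm _ _)) ⟩
    conv n (λ i j → ∑ (suc j) (summand w) * summand z i)
      ≈⟨ ∑-delay (suc n) n (λ j → ∑ (suc j) (summand w)) (summand z) (ℕₚ.n<1+n n) ⟨
    ∑ (suc n) (λ i → delay (λ j → ∑ (suc j) (summand w)) n i * summand z i) ∎

module Exponential {c ℓ₁ ℓ₂ ℓ₃ : Level} (ℛ : RealNumbers c ℓ₁ ℓ₂ ℓ₃)
  (exp : Analysis.ℂ ℛ → Analysis.ℂ ℛ) (isExp : Analysis.IsExp ℛ exp) where

  open OrderedField ℛ
  open Analysis ℛ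
  open ComplexNumbers ℛ
  open Embeddings ℛ
  open NormedRing ℂ-normed using (∣∣-cong; ∣∣-mono; ∣*∣; bounded)
  open FiniteSums ℂ-commutativeRing
  private
    module ℝᵣ = CommutativeRing ℝ-ring
    module ∑ℝ = FiniteSums ℝ-ring
  open Solver using (solve; _:=_; _:+_; _:*_; _:-_; :-_; con)
  open Algebra.Properties.Semiring.Mult ℂ-ring.semiring using () renaming (_×_ to _·ᶜ_)

  -- 1/n!.
  κ : ℕ → ℝ
  κ n = recipℕ (n !) {{n ℕₚ.!≢0}}

  private
    κ-inverse : ∀ n → fromℕ (n !) * κ n ≈ 1#
    κ-inverse n = recip-inverse (n !) {{n ℕₚ.!≢0}}

  κ-suc : ∀ n → fromℕ (suc n) * κ (suc n) ≈ κ n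
  κ-suc n = begin
    fromℕ (suc n) * κ (suc n)                             ≈⟨ *-identityʳ _ ⟨
    fromℕ (suc n) * κ (suc n) * 1#                        ≈⟨ *-congˡ (κ-inverse n) ⟨
    fromℕ (suc n) * κ (suc n) * (fromℕ (n !) * κ n)       ≈⟨ solve 4 (λ a b x y → a :* b :* (x :* y) := a :* x :* b :* y) refl _ _ _ _ ⟩
    fromℕ (suc n) * fromℕ (n !) * κ (suc n) * κ n         ≈⟨ *-congʳ (*-congʳ (fromℕ-* (suc n) (n !))) ⟨
    fromℕ (suc n !) * κ (suc n) * κ n                     ≈⟨ *-congʳ (κ-inverse (suc n)) ⟩
    1# * κ n                                              ≈⟨ *-identityˡ _ ⟩
    κ n                                                   ∎
    where open Relation.Binary.Reasoning.Setoid ℝᵣ.setoid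

  κ-zero : κ 0 ≈ 1#
  κ-zero = trans (sym (trans (*-congʳ (+-identityʳ 1#)) (*-identityˡ _))) (κ-inverse 0)

  κ-0≤ : ∀ n → 0# ≤ κ n
  κ-0≤ n = <⇒≤ (pos (fromℕ (n !)) (κ n) (positive (n !) {{n ℕₚ.!≢0}}) (κ-inverse n))
    where
    positive : ∀ m .{{_ : ℕ.NonZero m}} → 0# < fromℕ m
    positive (suc m) = fromℕ-pos m
    pos : ∀ x y → 0# < x → x * y ≈ 1# → 0# < y
    pos x y 0<x xy = let r , 0<r , xr = reciprocal x 0<x in <-cong refl (inverse-unique xr xy) 0<r

  ofℝ-* : ∀ x y → ofℝ (x * y) ≈ᶜ ofℝ x *ᶜ ofℝ y
  ofℝ-* x y = solve 2 (λ x y → x :* y := x :* y :- con (+ 0) :* con (+ 0)) refl x y ,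
              solve 2 (λ x y → con (+ 0) := x :* con (+ 0) :+ con (+ 0) :* y) refl x y

  ofℝ-+ : ∀ x y → ofℝ (x + y) ≈ᶜ ofℝ x +ᶜ ofℝ y
  ofℝ-+ x y = refl , sym (+-identityˡ 0#)

  ofℝ-cong : ∀ {x y} → x ≈ y → ofℝ x ≈ᶜ ofℝ y
  ofℝ-cong eq = eq , refl

  ofℝ-fromℕ : ∀ n → n ·ᶜ 1ᶜ ≈ᶜ ofℝ (fromℕ n)
  ofℝ-fromℕ zero    = refl , refl
  ofℝ-fromℕ (suc n) = ℂ-ring.trans (ℂ-ring.+-congˡ {1ᶜ} (ofℝ-fromℕ n)) (ℂ-ring.sym (ofℝ-+ 1# (fromℕ n)))

  ofℝ-^ : ∀ x n → ofℝ x ^ᶜ n ≈ᶜ ofℝ (x ^ n)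
  ofℝ-^ x zero    = refl , refl
  ofℝ-^ x (suc n) = ℂ-ring.trans (ℂ-ring.*-congˡ {ofℝ x} (ofℝ-^ x n)) (ℂ-ring.sym (ofℝ-* x (x ^ n)))

  private
    κᶜ-suc : ∀ n → (suc n ·ᶜ 1ᶜ) *ᶜ ofℝ (κ (suc n)) ≈ᶜ ofℝ (κ n)
    κᶜ-suc n = ℂ-ring.trans (ℂ-ring.*-congʳ {ofℝ (κ (suc n))} (ofℝ-fromℕ (suc n)))
      (ℂ-ring.trans (ℂ-ring.sym (ofℝ-* (fromℕ (suc n)) (κ (suc n)))) (ofℝ-cong (κ-suc n)))

    inverse-suc : ∀ n → ofℝ (recipℕ (suc n)) *ᶜ (suc n ·ᶜ 1ᶜ) ≈ᶜ 1ᶜ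
    inverse-suc n = ℂ-ring.trans (ℂ-ring.*-congˡ {ofℝ (recipℕ (suc n))} (ofℝ-fromℕ (suc n)))
      (ℂ-ring.trans (ℂ-ring.sym (ofℝ-* (recipℕ (suc n)) (fromℕ (suc n)))) (ofℝ-cong (trans (*-comm _ _) (recip-inverse (suc n)))))

    reciprocals : FactorialReciprocals ℂ-commutativeRing
    reciprocals = record
      { κ           = λ n → ofℝ (κ n)
      ; κ-zero      = ofℝ-cong κ-zero
      ; κ-suc       = κᶜ-suc
      ; inverse     = λ n → ofℝ (recipℕ (suc n))
      ; inverse-suc = inverse-suc
      }

  open ExponentialSeries ℂ-commutativeRing reciprocals public

  partialSum≈∑ : ∀ f n → partialSum f n ≡ ∑ n f
  partialSum≈∑ f zero    = ≡.refl
  partialSum≈∑ f (suc n) = ≡.cong (_+ᶜ f n) (partialSum≈∑ f n)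

  exp-Lim : ∀ z → Lim (λ n → ∑ n (summand z)) (exp z)
  exp-Lim z ε 0<ε = let M , near = ⟶⇒Lim (isExp z) ε 0<ε in
    M , λ n M≤n → ≡.subst (λ s → ∣ s -ᶜ exp z ∣≤ ε) (partialSum≈∑ (summand z) n) (near n M≤n)

  -- The rate of convergence used for the exponential series.
  private
    ½ : ℝ
    ½ = proj₁ (reciprocal (1# + 1#) (0<1+ 0≤1))

    0<½ : 0# < ½
    0<½ = proj₁ (proj₂ (reciprocal (1# + 1#) (0<1+ 0≤1)))

    ½+½ : ½ + ½ ≈ 1#
    ½+½ = trans (solve 1 (λ x → x :+ x := (con (+ 1) :+ con (+ 1)) :* x) refl ½) (proj₂ (proj₂ (reciprocal (1# + 1#) (0<1+ 0≤1))))

    ½<1 : ½ < 1#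
    ½<1 = <-cong (+-identityˡ ½) ½+½ (+-monoˡ-< ½ 0<½)

  open GeometricLimits ℛ ℂ-normed ½ (<⇒≤ 0<½) ½<1

  exp-cong : ∀ {z w} → z ≈ᶜ w → exp z ≈ᶜ exp w
  exp-cong {z} {w} z≈w = Lim-unique (exp-Lim z) λ ε 0<ε → let M , near = exp-Lim w ε 0<ε in
    M , λ n M≤n → ∣∣-cong {∑ n (summand w) -ᶜ exp w} (ℂ-ring.+-congʳ { -ᶜ exp w} (∑-cong n λ j _ → ℂ-ring.*-congˡ {ofℝ (κ j)} (^-congˡ j (ℂ-ring.sym z≈w)))) (near n M≤n)
    where open Algebra.Properties.Semiring.Exp ℂ-ring.semiring using (^-congˡ)

  re-∑ : ∀ n f → re (∑ n f) ≡ ∑ℝ.∑ n (λ j → re (f j))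
  re-∑ zero    f = ≡.refl
  re-∑ (suc n) f = ≡.cong (_+ re (f n)) (re-∑ n f)

  re-summand : ∀ x n → re (summand (ofℝ x) n) ≈ κ n * x ^ n
  re-summand x n = proj₁ (ℂ-ring.trans (ℂ-ring.*-congˡ {ofℝ (κ n)} (ofℝ-^ x n)) (ℂ-ring.sym (ofℝ-* (κ n) (x ^ n))))

  -- The partial sums for x ≥ 0 increase to the exponential.
  partial≤exp : ∀ {x} → 0# ≤ x → ∀ N → ∑ℝ.∑ N (λ n → κ n * x ^ n) ≤ re (exp (ofℝ x))
  partial≤exp {x} 0≤x N = ≤-approx λ ε 0<ε →
    let M , near = exp-Lim (ofℝ x) ε 0<ε in
    ≤-trans (grow M) (0≤⇒≤ (≤-cong refl
      (solve 3 (λ s e x → e :- (s :- x) := x :+ e :- s) refl _ ε _)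
      (≤⇒0≤ (re≤ {∑ (N ℕ.+ M) (summand (ofℝ x)) -ᶜ exp (ofℝ x)} (near (N ℕ.+ M) (ℕₚ.m≤n+m M N))))))
    where
    real : ∀ n → re (∑ n (summand (ofℝ x))) ≈ ∑ℝ.∑ n (λ j → κ j * x ^ j)
    real n = trans (ℝᵣ.reflexive (re-∑ n (summand (ofℝ x)))) (∑ℝ.∑-cong n λ j _ → re-summand x j)
    grow : ∀ M → ∑ℝ.∑ N (λ n → κ n * x ^ n) ≤ re (∑ (N ℕ.+ M) (summand (ofℝ x)))
    grow M = ≤-cong refl (sym (real (N ℕ.+ M))) (go M)
      where
      go : ∀ M → ∑ℝ.∑ N (λ n → κ n * x ^ n) ≤ ∑ℝ.∑ (N ℕ.+ M) (λ n → κ n * x ^ n)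
      go zero    = ≈⇒≤ (ℝᵣ.reflexive (≡.cong (λ m → ∑ℝ.∑ m (λ n → κ n * x ^ n)) (≡.sym (ℕₚ.+-identityʳ N))))
      go (suc M) = ≤-trans (go M) (≤-cong refl (ℝᵣ.reflexive (≡.cong (λ m → ∑ℝ.∑ m (λ n → κ n * x ^ n)) (≡.sym (ℕₚ.+-suc N M))))
        (x≤x+ (*-0≤ (κ-0≤ (N ℕ.+ M)) (^-0≤ 0≤x (N ℕ.+ M)))))

  1+x≤exp : ∀ {x} → 0# ≤ x → 1# + x ≤ re (exp (ofℝ x))
  1+x≤exp {x} 0≤x = ≤-cong (begin
    0# + κ 0 * 1# + κ 1 * (x * 1#)  ≈⟨ +-cong (+-congˡ (*-congʳ κ-zero)) (*-congʳ κ-one) ⟩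
    0# + 1# * 1# + 1# * (x * 1#)    ≈⟨ solve 1 (λ x → con (+ 0) :+ con (+ 1) :* con (+ 1) :+ con (+ 1) :* (x :* con (+ 1)) := con (+ 1) :+ x) refl x ⟩
    1# + x                          ∎) refl (partial≤exp 0≤x 2)
    where
    open Relation.Binary.Reasoning.Setoid ℝᵣ.setoid
    κ-one : κ 1 ≈ 1#
    κ-one = trans (sym (trans (*-congʳ (+-identityʳ 1#)) (*-identityˡ _))) (trans (κ-suc 0) κ-zero)

  exp-0≤ : ∀ {x} → 0# ≤ x → 0# ≤ re (exp (ofℝ x))
  exp-0≤ 0≤x = ≤-trans (0≤+ 0≤1 0≤x) (1+x≤exp 0≤x)

  term≤exp : ∀ {x} → 0# ≤ x → ∀ n → κ n * x ^ n ≤ re (exp (ofℝ x))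
  term≤exp {x} 0≤x n = ≤-trans (≤-cong refl (+-comm _ _) (x≤x+ (nonnegative n))) (partial≤exp 0≤x (suc n))
    where
    nonnegative : ∀ n → 0# ≤ ∑ℝ.∑ n (λ n → κ n * x ^ n)
    nonnegative zero    = ≤-refl
    nonnegative (suc n) = 0≤+ (nonnegative n) (*-0≤ (κ-0≤ n) (^-0≤ 0≤x n))

  private
    module _ (z : ℂ) where
      A : ℝ
      A = proj₁ (bounded z)
      0≤A : 0# ≤ A
      0≤A = NormedRing.∣∣-0≤ ℂ-normed {z} (proj₂ (bounded z))
      -- Since ½ ½ = 1/4, the terms are bounded by those of exp (4A) over 4^n.
      4A : ℝ
      4A = (A + A) + (A + A)
      C : ℝ
      C = re (exp (ofℝ 4A))
      0≤C : 0# ≤ C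
      0≤C = exp-0≤ (0≤+ (0≤+ 0≤A 0≤A) (0≤+ 0≤A 0≤A))
      quarter : 4A * (½ * ½) ≈ A
      quarter = trans (solve 2 (λ a h → ((a :+ a) :+ (a :+ a)) :* (h :* h) := a :* ((h :+ h) :* (h :+ h))) refl A ½)
        (trans (*-congˡ (trans (*-cong ½+½ ½+½) (*-identityˡ 1#))) (*-identityʳ A))
      power : ∀ n → A ^ n ≈ 4A ^ n * ½ ^ n * ½ ^ n
      power zero    = solve 0 (con (+ 1) := con (+ 1) :* con (+ 1) :* con (+ 1)) refl
      power (suc n) = trans (*-cong (sym quarter) (power n))
        (solve 5 (λ a h x y z → a :* (h :* h) :* (x :* y :* z) := a :* x :* (h :* y) :* (h :* z)) refl 4A ½ (4A ^ n) (½ ^ n) (½ ^ n))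
      summand-bound : ∀ n → ∣ summand z n ∣≤ C * ½ ^ n * ½ ^ n
      summand-bound n = ∣∣-mono {summand z n}
        (≤-trans (≈⇒≤ (trans (*-congˡ (power n)) (solve 4 (λ k a x y → k :* (a :* x :* y) := k :* a :* x :* y) refl (κ n) (4A ^ n) (½ ^ n) (½ ^ n))))
          (*-monoˡ-≤ (^-0≤ (<⇒≤ 0<½) n) (*-monoˡ-≤ (^-0≤ (<⇒≤ 0<½) n) (term≤exp (0≤+ (0≤+ 0≤A 0≤A) (0≤+ 0≤A 0≤A)) n))))
        (∣*∣ {ofℝ (κ n)} {z ^ᶜ n} (κ-0≤ n , ≈⇒≤ (solve 1 (λ k → k :* k :+ con (+ 0) :* con (+ 0) := k :* k) refl (κ n))) (∣^∣ {z} (proj₂ (bounded z)) n))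

  exp-⇝ : ∀ z → (λ n → ∑ n (summand z)) ⇝ exp z
  exp-⇝ z = K , λ n → ∣∣-cong {∑ n (summand z) -ᶜ S} (ℂ-ring.+-congˡ {∑ n (summand z)} (ℂ-ring.-‿cong {S} S≈exp)) (p n)
    where
    series : ∃[ S ] ((λ n → ∑ n (summand z)) ⇝ S)
    series = ⇝-series {K = C z} λ n → ∣∣-mono {summand z n}
      (*-monoˡ-≤ (^-0≤ (<⇒≤ 0<½) n) (≤-cong refl (*-identityʳ (C z)) (*-monoʳ-≤ (0≤C z) (^-≤1 (<⇒≤ 0<½) (<⇒≤ ½<1) n)))) (summand-bound z n)
    S = proj₁ series
    K = proj₁ (proj₂ series)
    p = proj₂ (proj₂ series)
    S≈exp : S ≈ᶜ exp z
    S≈exp = Lim-unique (⇝⇒Lim (proj₂ series)) (exp-Lim z)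

  -- Dominated convergence for the terms of the series of z, with the partial sums of the series of w as e.
  exp-+ : ∀ z w → exp (z +ᶜ w) ≈ᶜ exp z *ᶜ exp w
  exp-+ z w = Lim-unique {a = λ n → ∑ (suc n) (summand (z +ᶜ w))}
    (λ ε 0<ε → let M , near = exp-Lim (z +ᶜ w) ε 0<ε in M , λ n M≤n → near (suc n) (ℕₚ.m≤n⇒m≤1+n M≤n))
    (⇝⇒Lim (⇝-cong (λ n → ℂ-ring.sym (∑-summand-+ z w n))
      (⇝-perturb {a = λ n → exp w *ᶜ ∑ (suc n) (summand z)} (λ n → proj₂ close n (suc n)) limit)))
    where
    shifted : ∀ z → (λ n → ∑ (suc n) (summand z)) ⇝ exp z
    shifted z = ⇝-cong (λ n → ℂ-ring.reflexive (≡.cong (λ m → ∑ m (summand z)) (ℕₚ.+-comm n 1))) (⇝-shift 1 (exp-⇝ z))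
    close = dominated (shifted w) (0≤C z) (summand-bound z)
    limit : (λ n → exp w *ᶜ ∑ (suc n) (summand z)) ⇝ (exp z *ᶜ exp w)
    limit = let K , p = ⇝-* (⇝-const (exp w)) (shifted z) in
      K , λ n → ∣∣-cong {exp w *ᶜ ∑ (suc n) (summand z) -ᶜ exp w *ᶜ exp z} (ℂ-ring.+-congˡ {exp w *ᶜ ∑ (suc n) (summand z)} (ℂ-ring.-‿cong (ℂ-ring.*-comm (exp w) (exp z)))) (p n)

  exp-0 : exp 0ᶜ ≈ᶜ 1ᶜ
  exp-0 = Lim-unique {a = λ n → ∑ (suc n) (summand 0ᶜ)}
    (λ ε 0<ε → let M , near = exp-Lim 0ᶜ ε 0<ε in M , λ n M≤n → near (suc n) (ℕₚ.m≤n⇒m≤1+n M≤n))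
    (⇝⇒Lim (⇝-cong (λ n → ℂ-ring.sym (constant n)) (⇝-const 1ᶜ)))
    where
    constant : ∀ n → ∑ (suc n) (summand 0ᶜ) ≈ᶜ 1ᶜ
    constant n = ℂ-ring.trans (∑-front n (summand 0ᶜ)) (ℂ-ring.trans
      (ℂ-ring.+-cong {summand 0ᶜ 0} (ℂ-ring.trans (ℂ-ring.*-identityʳ (ofℝ (κ 0))) (ofℝ-cong κ-zero))
        (∑-zero n λ j _ → ℂ-ring.trans (ℂ-ring.*-congˡ {ofℝ (κ (suc j))} (ℂ-ring.zeroˡ (0ᶜ ^ᶜ j))) (ℂ-ring.zeroʳ (ofℝ (κ (suc j))))))
      (ℂ-ring.+-identityʳ 1ᶜ))

  exp-·ℕ : ∀ n z → exp (ofℝ (fromℕ n) *ᶜ z) ≈ᶜ exp z ^ᶜ n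
  exp-·ℕ zero    z = ℂ-ring.trans (exp-cong (ℂ-ring.zeroˡ z)) exp-0
  exp-·ℕ (suc n) z = ℂ-ring.trans (exp-cong step) (ℂ-ring.trans (exp-+ z (ofℝ (fromℕ n) *ᶜ z)) (ℂ-ring.*-congˡ {exp z} (exp-·ℕ n z)))
    where
    step : ofℝ (1# + fromℕ n) *ᶜ z ≈ᶜ z +ᶜ ofℝ (fromℕ n) *ᶜ z
    step = ℂ-ring.trans (ℂ-ring.*-congʳ {z} (ofℝ-+ 1# (fromℕ n))) (ℂ-ring.trans (ℂ-ring.distribʳ z 1ᶜ (ofℝ (fromℕ n))) (ℂ-ring.+-congʳ (ℂ-ring.*-identityˡ z)))

  -- Complex conjugation.
  conj : ℂ → ℂ
  conj z = re z +i (- im z)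

  conj-* : ∀ z w → conj (z *ᶜ w) ≈ᶜ conj z *ᶜ conj w
  conj-* (a +i b) (x +i y) =
    solve 4 (λ a b x y → a :* x :- b :* y := a :* x :- (:- b) :* (:- y)) refl a b x y ,
    solve 4 (λ a b x y → :- (a :* y :+ b :* x) := a :* (:- y) :+ (:- b) :* x) refl a b x y

  exp-conj : ∀ z → exp (conj z) ≈ᶜ conj (exp z)
  exp-conj z = Lim-unique (exp-Lim (conj z)) λ ε 0<ε →
    let M , near = exp-Lim z ε 0<ε in
    M , λ n M≤n → ∣∣-cong {conj (∑ n (summand z) -ᶜ exp z)} (ℂ-ring.trans (conj-minus (∑ n (summand z)) (exp z)) (ℂ-ring.+-congʳ { -ᶜ conj (exp z)} (conj-∑ n)))
      (proj₁ (near n M≤n) , ≤-cong (solve 2 (λ x y → x :* x :+ y :* y := x :* x :+ (:- y) :* (:- y)) refl _ _) refl (proj₂ (near n M≤n)))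
    where
    conj-minus : ∀ z w → conj (z -ᶜ w) ≈ᶜ conj z -ᶜ conj w
    conj-minus (a +i b) (x +i y) = refl , solve 2 (λ b y → :- (b :- y) := :- b :- (:- y)) refl b y
    conj-^ : ∀ n → conj (z ^ᶜ n) ≈ᶜ conj z ^ᶜ n
    conj-^ zero    = refl , solve 0 (:- con (+ 0) := con (+ 0)) refl
    conj-^ (suc n) = ℂ-ring.trans (conj-* z (z ^ᶜ n)) (ℂ-ring.*-congˡ {conj z} (conj-^ n))
    conj-summand : ∀ n → conj (summand z n) ≈ᶜ summand (conj z) n
    conj-summand n = ℂ-ring.trans (conj-* (ofℝ (κ n)) (z ^ᶜ n)) (ℂ-ring.*-cong {conj (ofℝ (κ n))} (refl , solve 0 (:- con (+ 0) := con (+ 0)) refl) (conj-^ n))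
    conj-∑ : ∀ n → conj (∑ n (summand z)) ≈ᶜ ∑ n (summand (conj z))
    conj-∑ zero    = refl , solve 0 (:- con (+ 0) := con (+ 0)) refl
    conj-∑ (suc n) = ℂ-ring.trans (refl , solve 2 (λ b y → :- (b :+ y) := :- b :+ (:- y)) refl _ _) (ℂ-ring.+-cong {conj (∑ n (summand z))} (conj-∑ n) (conj-summand n))

  -- exp z times its conjugate is exp (2 re z).
  ∣exp∣² : ∀ z → ∣ exp z ∣² ≈ re (exp (ofℝ (re z + re z)))
  ∣exp∣² z = trans (solve 2 (λ x y → x :* x :+ y :* y := x :* x :- y :* (:- y)) refl (re (exp z)) (im (exp z)))
    (proj₁ (ℂ-ring.trans (ℂ-ring.*-congˡ {exp z} (ℂ-ring.sym (exp-conj z)))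
      (ℂ-ring.trans (ℂ-ring.sym (exp-+ z (conj z))) (exp-cong {z +ᶜ conj z} (refl , -‿inverseʳ (im z))))))

  exp-real : ∀ x → im (exp (ofℝ x)) ≈ 0#
  exp-real x = begin
    y                    ≈⟨ *-identityʳ y ⟨
    y * 1#               ≈⟨ *-congˡ ½+½ ⟨
    y * (½ + ½)          ≈⟨ solve 2 (λ y h → y :* (h :+ h) := (y :+ y) :* h) refl y ½ ⟩
    (y + y) * ½          ≈⟨ *-congʳ (+-congˡ symmetric) ⟩
    (y + - y) * ½        ≈⟨ *-congʳ (-‿inverseʳ y) ⟩
    0# * ½               ≈⟨ zeroˡ ½ ⟩
    0#                   ∎
    where
    open Relation.Binary.Reasoning.Setoid ℝᵣ.setoid
    y = im (exp (ofℝ x))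
    symmetric : y ≈ - y
    symmetric = proj₂ (ℂ-ring.trans (exp-cong {ofℝ x} {conj (ofℝ x)} (refl , solve 0 (con (+ 0) := :- con (+ 0)) refl)) (exp-conj (ofℝ x)))

  exp-real-+ : ∀ x y → re (exp (ofℝ (x + y))) ≈ re (exp (ofℝ x)) * re (exp (ofℝ y))
  exp-real-+ x y = begin
    re (exp (ofℝ (x + y)))    ≈⟨ proj₁ (exp-cong (ofℝ-+ x y)) ⟩
    re (exp (ofℝ x +ᶜ ofℝ y)) ≈⟨ proj₁ (exp-+ (ofℝ x) (ofℝ y)) ⟩
    u * v - im (exp (ofℝ x)) * im (exp (ofℝ y)) ≈⟨ +-congˡ (-‿cong (*-congʳ (exp-real x))) ⟩
    u * v - 0# * im (exp (ofℝ y)) ≈⟨ solve 3 (λ u v w → u :* v :- con (+ 0) :* w := u :* v) refl u v _ ⟩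
    u * v                     ∎
    where
    open Relation.Binary.Reasoning.Setoid ℝᵣ.setoid
    u = re (exp (ofℝ x))
    v = re (exp (ofℝ y))

  -- The modulus of exp z is at most s², with s = 1/(1 + y) < 1, when re z = - 2y < 0.
  exp-bound : ∀ z → re z < 0# → ∃[ s ] (0# < s) × (s < 1#) × (∣ exp z ∣≤ s * s)
  exp-bound z re<0 = s , 0<s , s<1 , *-0≤ (<⇒≤ 0<s) (<⇒≤ 0<s) , bound
    where
    x = re z
    0<-x : 0# < - x
    0<-x = <-cong refl (+-identityˡ _) (<⇒0< re<0)
    y = - x * ½
    0<y : 0# < y
    0<y = *-pos 0<-x 0<½
    s = proj₁ (reciprocal (1# + y) (0<1+ (<⇒≤ 0<y)))
    0<s = proj₁ (proj₂ (reciprocal (1# + y) (0<1+ (<⇒≤ 0<y))))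
    s-inverse = proj₂ (proj₂ (reciprocal (1# + y) (0<1+ (<⇒≤ 0<y))))
    s<1 : s < 1#
    s<1 = 0<⇒< (<-cong refl (trans (solve 2 (λ s y → s :* y := (con (+ 1) :+ y) :* s :- s) refl s y) (+-congʳ s-inverse)) (*-pos 0<s 0<y))
    E : ℝ → ℝ
    E u = re (exp (ofℝ u))
    4y : (y + y) + (y + y) ≈ - (x + x)
    4y = trans (solve 2 (λ x h → ((:- x) :* h :+ (:- x) :* h) :+ ((:- x) :* h :+ (:- x) :* h) := :- ((x :+ x) :* (h :+ h))) refl x ½) (-‿cong (trans (*-congˡ ½+½) (*-identityʳ _)))
    inverse : ∣ exp z ∣² * ((E y * E y) * (E y * E y)) ≈ 1#
    inverse = begin
      ∣ exp z ∣² * ((E y * E y) * (E y * E y))  ≈⟨ *-congʳ (∣exp∣² z) ⟩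
      E (x + x) * ((E y * E y) * (E y * E y))   ≈⟨ *-congˡ (*-cong (exp-real-+ y y) (exp-real-+ y y)) ⟨
      E (x + x) * (E (y + y) * E (y + y))       ≈⟨ *-congˡ (exp-real-+ (y + y) (y + y)) ⟨
      E (x + x) * E ((y + y) + (y + y))         ≈⟨ exp-real-+ (x + x) _ ⟨
      E ((x + x) + ((y + y) + (y + y)))         ≈⟨ proj₁ (exp-cong (ofℝ-cong (trans (+-congˡ 4y) (-‿inverseʳ (x + x))))) ⟩
      E 0#                                      ≈⟨ proj₁ exp-0 ⟩
      1#                                        ∎
      where open Relation.Binary.Reasoning.Setoid ℝᵣ.setoid
    0≤1+y : 0# ≤ 1# + y
    0≤1+y = <⇒≤ (0<1+ (<⇒≤ 0<y))
    square : (1# + y) * (1# + y) ≤ E y * E y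
    square = square-mono-≤ 0≤1+y (1+x≤exp (<⇒≤ 0<y))
    bound : ∣ exp z ∣² ≤ (s * s) * (s * s)
    bound = ≤-cong
      (trans (solve 3 (λ e p s → e :* ((p :* p) :* (p :* p)) :* ((s :* s) :* (s :* s)) := e :* ((p :* s) :* (p :* s) :* ((p :* s) :* (p :* s)))) refl ∣ exp z ∣² (1# + y) s)
        (trans (*-congˡ (trans (*-cong (*-cong s-inverse s-inverse) (*-cong s-inverse s-inverse)) (solve 0 (con (+ 1) :* con (+ 1) :* (con (+ 1) :* con (+ 1)) := con (+ 1)) refl))) (*-identityʳ _)))
      (*-identityˡ _)
      (*-monoˡ-≤ (square-0≤ (s * s))
        (≤-trans (*-monoʳ-≤ (∣∣²-0≤ (exp z)) (square-mono-≤ (square-0≤ (1# + y)) square)) (≈⇒≤ inverse)))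

-- The exponents

-- The sums over the partial sums N_j of a vector.
module PartialSums where

  open import Data.Vec.Base using ([]; _∷_; sum)

  N₁≡sum : ∀ {k} (v : Vec ℕ k) → N v 1 ≡ sum v
  N₁≡sum []      = ≡.refl
  N₁≡sum (n ∷ v) = ≡.cong (n ℕ.+_) (N₁≡sum v)

  -- The sums of all N_j and of all their squares.
  ∑N ∑N² : ∀ {k} → Vec ℕ k → ℕ
  ∑N  {k} v = ∑[ 1 ⋯ k ] (N v)
  ∑N² {k} v = ∑[ 1 ⋯ k ] (λ j → N v j ℕ.* N v j)

  -- The sum of the last i of the N_j.
  ∑bonus : ∀ {k} → ℕ → Vec ℕ k → ℕ
  ∑bonus i []              = 0
  ∑bonus {suc k} i (n ∷ v) = bonus i (suc k) (n ℕ.+ sum v) ℕ.+ ∑bonus i v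

  ∑bonus-complement : ∀ {k} i (v : Vec ℕ k) → ∑[ 1 ⋯ k ℕ.∸ i ] (N v) ℕ.+ ∑bonus i v ≡ ∑N v
  ∑bonus-complement {zero}  zero    [] = ≡.refl
  ∑bonus-complement {zero}  (suc i) [] = ≡.refl
  ∑bonus-complement {suc k} i (n ∷ v) with suc k ℕₚ.≤? i
  ... | yes k<i rewrite ℕₚ.m≤n⇒m∸n≡0 k<i | bonus-yes {i} {suc k} (n ℕ.+ sum v) k<i | N₁≡sum v =
    ≡.cong (n ℕ.+ sum v ℕ.+_) (≡.trans (≡.cong (λ m → ∑[ 1 ⋯ m ] (N v) ℕ.+ ∑bonus i v) (≡.sym (ℕₚ.m≤n⇒m∸n≡0 (ℕₚ.<⇒≤ k<i))))
      (∑bonus-complement i v))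
  ... | no k≮i rewrite ℕₚ.+-∸-assoc 1 (ℕ.s≤s⁻¹ (ℕₚ.≰⇒> k≮i)) | bonus-no {i} {suc k} (n ℕ.+ sum v) (ℕₚ.≰⇒> k≮i) =
    ≡.trans (ℕₚ.+-assoc (N (n ∷ v) 1) _ _) (≡.cong (N (n ∷ v) 1 ℕ.+_) (∑bonus-complement i v))

  -- Addition of s to the last component.
  raise : ∀ {k} → ℕ → Vec ℕ (suc k) → Vec ℕ (suc k)
  raise {zero}  s (n ∷ []) = (n ℕ.+ s) ∷ []
  raise {suc k} s (n ∷ v)  = n ∷ raise s v

  raise-0 : ∀ {k} (v : Vec ℕ (suc k)) → raise 0 v ≡ v
  raise-0 {zero}  (n ∷ []) = ≡.cong (_∷ []) (ℕₚ.+-identityʳ n)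
  raise-0 {suc k} (n ∷ v)  = ≡.cong (n ∷_) (raise-0 v)

  -- The last component.
  last : ∀ {k} → Vec ℕ (suc k) → ℕ
  last {zero}  (n ∷ []) = n
  last {suc k} (n ∷ v)  = last v

  last≡⟨⟩ : ∀ {k} (v : Vec ℕ (suc k)) → v ⟨ suc k ⟩ ≡ last v
  last≡⟨⟩ {zero}  (n ∷ []) = ≡.refl
  last≡⟨⟩ {suc k} (n ∷ v)  = last≡⟨⟩ v

  last-raise : ∀ {k} s (v : Vec ℕ (suc k)) → last (raise s v) ≡ last v ℕ.+ s
  last-raise {zero}  s (n ∷ []) = ≡.refl
  last-raise {suc k} s (n ∷ v)  = last-raise s v

  sum-raise : ∀ {k} s (v : Vec ℕ (suc k)) → sum (raise s v) ≡ sum v ℕ.+ s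
  sum-raise {zero}  s (n ∷ []) = ≡.trans (ℕₚ.+-identityʳ (n ℕ.+ s)) (≡.cong (ℕ._+ s) (≡.sym (ℕₚ.+-identityʳ n)))
  sum-raise {suc k} s (n ∷ v)  = ≡.trans (≡.cong (n ℕ.+_) (sum-raise s v)) (≡.sym (ℕₚ.+-assoc n _ s))

  private
    module Arithmetic where
      open import Data.Nat.Solver using (module +-*-Solver)
      open +-*-Solver
      rearrange : ∀ x s a b → x ℕ.+ s ℕ.+ (a ℕ.+ b) ≡ x ℕ.+ a ℕ.+ (s ℕ.+ b)
      rearrange = solve 4 (λ x s a b → x :+ s :+ (a :+ b) := x :+ a :+ (s :+ b)) ≡.refl
      square : ∀ x s a b k → (x ℕ.+ s) ℕ.* (x ℕ.+ s) ℕ.+ (a ℕ.+ (2 ℕ.* s ℕ.* b ℕ.+ k ℕ.* (s ℕ.* s)))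
             ≡ x ℕ.* x ℕ.+ a ℕ.+ (2 ℕ.* s ℕ.* (x ℕ.+ b) ℕ.+ suc k ℕ.* (s ℕ.* s))
      square = solve 5 (λ x s a b k → (x :+ s) :* (x :+ s) :+ (a :+ (con 2 :* s :* b :+ k :* (s :* s)))
             := x :* x :+ a :+ (con 2 :* s :* (x :+ b) :+ (con 1 :+ k) :* (s :* s))) ≡.refl
      base : ∀ x s → (x ℕ.+ s) ℕ.* (x ℕ.+ s) ℕ.+ 0 ≡ x ℕ.* x ℕ.+ 0 ℕ.+ (2 ℕ.* s ℕ.* (x ℕ.+ 0) ℕ.+ 1 ℕ.* (s ℕ.* s))
      base = solve 2 (λ x s → (x :+ s) :* (x :+ s) :+ con 0 := x :* x :+ con 0 :+ (con 2 :* s :* (x :+ con 0) :+ con 1 :* (s :* s))) ≡.refl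
      only : ∀ n s → n ℕ.+ s ℕ.+ 0 ℕ.+ 0 ≡ n ℕ.+ 0 ℕ.+ 0 ℕ.+ (s ℕ.+ 0)
      only = solve 2 (λ n s → n :+ s :+ con 0 :+ con 0 := n :+ con 0 :+ con 0 :+ (s :+ con 0)) ≡.refl
    open Arithmetic

  N₁-raise : ∀ {k} s (v : Vec ℕ (suc k)) → N (raise s v) 1 ≡ N v 1 ℕ.+ s
  N₁-raise s v = ≡.trans (N₁≡sum (raise s v)) (≡.trans (sum-raise s v) (≡.cong (ℕ._+ s) (≡.sym (N₁≡sum v))))

  ∑N-raise : ∀ {k} s (v : Vec ℕ (suc k)) → ∑N (raise s v) ≡ ∑N v ℕ.+ suc k ℕ.* s
  ∑N-raise {zero} s (n ∷ []) = ≡.trans (≡.cong (ℕ._+ 0) (N₁-raise s (n ∷ []))) (rearrange (N (n ∷ []) 1) s 0 0)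
  ∑N-raise {suc k} s (n ∷ v) = ≡.trans (≡.cong₂ ℕ._+_ (N₁-raise s (n ∷ v)) (∑N-raise s v))
    (rearrange (N (n ∷ v) 1) s (∑N v) (suc k ℕ.* s))

  ∑N²-raise : ∀ {k} s (v : Vec ℕ (suc k)) → ∑N² (raise s v) ≡ ∑N² v ℕ.+ (2 ℕ.* s ℕ.* ∑N v ℕ.+ suc k ℕ.* (s ℕ.* s))
  ∑N²-raise {zero} s (n ∷ []) = ≡.trans (≡.cong (λ x → x ℕ.* x ℕ.+ 0) (N₁-raise s (n ∷ []))) (base (N (n ∷ []) 1) s)
  ∑N²-raise {suc k} s (n ∷ v) = ≡.trans (≡.cong₂ ℕ._+_ (≡.cong (λ x → x ℕ.* x) (N₁-raise s (n ∷ v))) (∑N²-raise s v))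
    (square (N (n ∷ v) 1) s (∑N² v) (∑N v) (suc k))

  -- Raising increases every N_j by s, and only the last i of them are counted.
  ∑bonus-raise : ∀ {k} i s (v : Vec ℕ (suc k)) → ∑bonus i (raise s v) ≡ ∑bonus i v ℕ.+ (suc k ℕ.⊓ i) ℕ.* s
  ∑bonus-raise {zero}  zero    s (n ∷ []) = ≡.refl
  ∑bonus-raise {zero}  (suc i) s (n ∷ []) = only n s
  ∑bonus-raise {suc k} i s (n ∷ v) with suc (suc k) ℕₚ.≤? i
  ... | no k≰i = ≡.trans (≡.cong₂ ℕ._+_
      (≡.trans (bonus-no (n ℕ.+ sum (raise s v)) (ℕₚ.≰⇒> k≰i)) (≡.sym (bonus-no (n ℕ.+ sum v) (ℕₚ.≰⇒> k≰i))))
      (∑bonus-raise i s v))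
    (≡.trans (≡.sym (ℕₚ.+-assoc (bonus i (suc (suc k)) (n ℕ.+ sum v)) (∑bonus i v) _))
      (≡.cong (λ x → bonus i (suc (suc k)) (n ℕ.+ sum v) ℕ.+ ∑bonus i v ℕ.+ x ℕ.* s)
        (≡.trans (ℕₚ.m≥n⇒m⊓n≡n (ℕ.s≤s⁻¹ (ℕₚ.≰⇒> k≰i))) (≡.sym (ℕₚ.m≥n⇒m⊓n≡n (ℕₚ.<⇒≤ (ℕₚ.≰⇒> k≰i)))))))
  ... | yes k≤i = ≡.trans (≡.cong₂ ℕ._+_
      (≡.trans (bonus-yes (n ℕ.+ sum (raise s v)) k≤i)
        (≡.trans (≡.trans (≡.cong (n ℕ.+_) (sum-raise s v)) (≡.sym (ℕₚ.+-assoc n (sum v) s)))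
          (≡.cong (ℕ._+ s) (≡.sym (bonus-yes (n ℕ.+ sum v) k≤i)))))
      (∑bonus-raise i s v))
    (≡.trans (rearrange (bonus i (suc (suc k)) (n ℕ.+ sum v)) s (∑bonus i v) ((suc k ℕ.⊓ i) ℕ.* s))
      (≡.cong (λ x → bonus i (suc (suc k)) (n ℕ.+ sum v) ℕ.+ ∑bonus i v ℕ.+ x ℕ.* s)
        (≡.trans (≡.cong suc (ℕₚ.m≤n⇒m⊓n≡m (ℕₚ.<⇒≤ k≤i))) (≡.sym (ℕₚ.m≤n⇒m⊓n≡m k≤i)))))

-- The exponent of h in a summand of the multisum, for the nonnegative shift λ′.
module MultisumExponent (i λ′ : ℕ) where

  open PartialSums
  open import Data.Vec.Base using ([]; _∷_; sum)

  γ : ℕ → ℕ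
  γ s = s ℕ.* s ℕ.+ 2 ℕ.* (λ′ ℕ.* s)

  -- The contribution of the variables other than the first.
  innerExponent : ∀ {k} → Vec ℕ k → ℕ
  innerExponent []              = 0
  innerExponent {suc k} (n ∷ v) = (2 ℕ.* γ (n ℕ.+ sum v) ℕ.+ 2 ℕ.* bonus i (suc k) (n ℕ.+ sum v)) ℕ.+ innerExponent v

  exponent : ∀ {k} → Vec ℕ (suc k) → ℕ
  exponent {k} (n ∷ v) = (γ (n ℕ.+ sum v) ℕ.+ 2 ℕ.* bonus i (suc k) (n ℕ.+ sum v)) ℕ.+ innerExponent v

  private
    module Arithmetic where
      open import Data.Nat.Solver using (module +-*-Solver)
      open +-*-Solver
      step : ∀ x l b B A β → 2 ℕ.* (x ℕ.* x ℕ.+ 2 ℕ.* (l ℕ.* x)) ℕ.+ 2 ℕ.* b ℕ.+ (2 ℕ.* B ℕ.+ 4 ℕ.* (l ℕ.* A) ℕ.+ 2 ℕ.* β)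
        ≡ 2 ℕ.* (x ℕ.* x ℕ.+ B) ℕ.+ 4 ℕ.* (l ℕ.* (x ℕ.+ A)) ℕ.+ 2 ℕ.* (b ℕ.+ β)
      step = solve 6 (λ x l b B A β → con 2 :* (x :* x :+ con 2 :* (l :* x)) :+ con 2 :* b :+ (con 2 :* B :+ con 4 :* (l :* A) :+ con 2 :* β)
        := con 2 :* (x :* x :+ B) :+ con 4 :* (l :* (x :+ A)) :+ con 2 :* (b :+ β)) ≡.refl
      double : ∀ g b I → g ℕ.+ (g ℕ.+ 2 ℕ.* b ℕ.+ I) ≡ 2 ℕ.* g ℕ.+ 2 ℕ.* b ℕ.+ I
      double = solve 3 (λ g b I → g :+ (g :+ con 2 :* b :+ I) := con 2 :* g :+ con 2 :* b :+ I) ≡.refl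
      zeros : ∀ l → 0 ≡ 2 ℕ.* 0 ℕ.+ 4 ℕ.* (l ℕ.* 0) ℕ.+ 2 ℕ.* 0
      zeros = solve 1 (λ l → con 0 := con 2 :* con 0 :+ con 4 :* (l :* con 0) :+ con 2 :* con 0) ≡.refl
    open Arithmetic

  innerExponent≡ : ∀ {k} (v : Vec ℕ k) → innerExponent v ≡ 2 ℕ.* ∑N² v ℕ.+ 4 ℕ.* (λ′ ℕ.* ∑N v) ℕ.+ 2 ℕ.* ∑bonus i v
  innerExponent≡ []              = zeros λ′
  innerExponent≡ {suc k} (n ∷ v) = ≡.trans
    (≡.cong ((2 ℕ.* γ (n ℕ.+ sum v) ℕ.+ 2 ℕ.* bonus i (suc k) (n ℕ.+ sum v)) ℕ.+_) (innerExponent≡ v))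
    (≡.trans (step (n ℕ.+ sum v) λ′ (bonus i (suc k) (n ℕ.+ sum v)) (∑N² v) (∑N v) (∑bonus i v))
      (≡.cong (λ x → 2 ℕ.* (x ℕ.* x ℕ.+ ∑N² v) ℕ.+ 4 ℕ.* (λ′ ℕ.* (x ℕ.+ ∑N v)) ℕ.+ 2 ℕ.* ∑bonus i (n ∷ v)) (≡.cong (n ℕ.+_) (≡.sym (N₁≡sum v)))))

  exponent≡ : ∀ {k} (v : Vec ℕ (suc k)) → γ (N v 1) ℕ.+ exponent v ≡ 2 ℕ.* ∑N² v ℕ.+ 4 ℕ.* (λ′ ℕ.* ∑N v) ℕ.+ 2 ℕ.* ∑bonus i v
  exponent≡ {k} (n ∷ v) = ≡.trans (≡.cong (λ x → γ x ℕ.+ exponent (n ∷ v)) (≡.cong (n ℕ.+_) (N₁≡sum v)))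
    (≡.trans (double (γ (n ℕ.+ sum v)) (bonus i (suc k) (n ℕ.+ sum v)) (innerExponent v)) (innerExponent≡ (n ∷ v)))

  -- Hence the summands decay geometrically.
  sum≤exponent : ∀ {k} (v : Vec ℕ (suc k)) → sum v ℕ.≤ exponent v
  sum≤exponent {k} (n ∷ v) = ℕₚ.≤-trans (square (n ℕ.+ sum v)) (ℕₚ.≤-trans (ℕₚ.m≤m+n _ (2 ℕ.* (λ′ ℕ.* (n ℕ.+ sum v))))
    (ℕₚ.≤-trans (ℕₚ.m≤m+n _ (2 ℕ.* bonus i (suc k) (n ℕ.+ sum v))) (ℕₚ.m≤m+n _ (innerExponent v))))
    where
    square : ∀ m → m ℕ.≤ m ℕ.* m
    square zero    = z≤n
    square (suc m) = ℕₚ.m≤m+n (suc m) _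

-- σ ℓ = ∣ℓ∣ - ℓ, the least value of n_k for which 1/(q)_(n_k + 2ℓ) does not vanish by convention.
σ : ℤ → ℕ
σ (+ n)    = 0
σ -[1+ n ] = 2 ℕ.* suc n

σ-+ : ∀ ℓ → + σ ℓ ℤ.+ ℓ ≡ + ∣ ℓ ∣
σ-+ (+ n)    = ≡.refl
σ-+ -[1+ n ] = ≡.trans (ℤₚ.⊖-≥ (ℕₚ.m≤m+n (suc n) _)) (≡.cong +_ (≡.trans (ℕₚ.m+n∸m≡n (suc n) _) (ℕₚ.*-identityˡ (suc n))))

module Exponents {c ℓ₁ ℓ₂ ℓ₃ : Level} (ℛ : RealNumbers c ℓ₁ ℓ₂ ℓ₃) where

  open OrderedField ℛ
  open Analysis ℛ
  open Embeddings ℛ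
  open PartialSums
  private module ℝ = CommutativeRing ℝ-ring
  open Solver using (solve; _:=_; _:+_; _:*_; _:-_; :-_; con)
  open Relation.Binary.Reasoning.Setoid ℝ.setoid

  private
    2# : ℝ
    2# = 1# + 1#

    fromℕ-2* : ∀ n → fromℕ (2 ℕ.* n) ≈ 2# * fromℕ n
    fromℕ-2* n = trans (fromℕ-* 2 n) (*-congʳ (+-congˡ (+-identityʳ 1#)))

    σ≈ : ∀ ℓ → fromℕ (σ ℓ) ≈ fromℕ ∣ ℓ ∣ - fromℤ ℓ
    σ≈ ℓ = begin
      fromℕ (σ ℓ)                                ≈⟨ solve 2 (λ s l → s := (s :+ l) :- l) refl _ (fromℤ ℓ) ⟩
      (fromℕ (σ ℓ) + fromℤ ℓ) - fromℤ ℓ          ≈⟨ +-congʳ (fromℤ-+ (+ σ ℓ) ℓ) ⟨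
      fromℤ (+ σ ℓ ℤ.+ ℓ) - fromℤ ℓ              ≡⟨ ≡.cong (λ x → fromℤ x - fromℤ ℓ) (σ-+ ℓ) ⟩
      fromℕ ∣ ℓ ∣ - fromℤ ℓ                      ∎

    square-∣∣ : ∀ ℓ → fromℕ ∣ ℓ ∣ * fromℕ ∣ ℓ ∣ ≈ fromℤ ℓ * fromℤ ℓ
    square-∣∣ (+ n)    = refl
    square-∣∣ -[1+ n ] = solve 1 (λ x → x :* x := (:- x) :* (:- x)) refl _

  fromℚ-½ : fromℚ ℚ.½ + fromℚ ℚ.½ ≈ 1#
  fromℚ-½ = trans (+-cong (fromℚ-/ (+ 1) 2) (fromℚ-/ (+ 1) 2))
    (trans (solve 1 (λ r → (con (+ 1) :+ con (+ 0)) :* r :+ (con (+ 1) :+ con (+ 0)) :* r := (con (+ 1) :+ (con (+ 1) :+ con (+ 0))) :* r) refl _)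
      (recip-inverse 2))

  -- Twice the theta exponent at n: (2k+1)(n² - ℓ²) + 2i(n - ℓ).
  thetaExponent-double : ∀ k i ℓ n → fromℚ (thetaExponent k i ℓ n) + fromℚ (thetaExponent k i ℓ n)
    ≈ (1# + 2# * fromℕ k) * (fromℤ n * fromℤ n - fromℤ ℓ * fromℤ ℓ) + 2# * fromℕ i * (fromℤ n - fromℤ ℓ)
  thetaExponent-double k i ℓ n = begin
    fromℚ θ + fromℚ θ
      ≈⟨ +-cong expand expand ⟩
    ((K + ½) * ((n′ + I * ρ) * (n′ + I * ρ)) - Y * Y * ρ′) + ((K + ½) * ((n′ + I * ρ) * (n′ + I * ρ)) - Y * Y * ρ′)
      ≈⟨ solve 6 (λ K h X Y r i → ((K :+ h) :* (X :* X) :- Y :* Y :* r) :+ ((K :+ h) :* (X :* X) :- Y :* Y :* r)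
                  := ((h :+ h) :+ (con (+ 1) :+ con (+ 1)) :* K) :* (X :* X) :- Y :* Y :* (r :+ r)) refl K ½ (n′ + I * ρ) Y ρ′ I ⟩
    ((½ + ½) + 2# * K) * ((n′ + I * ρ) * (n′ + I * ρ)) - Y * Y * (ρ′ + ρ′)
      ≈⟨ +-cong (*-congʳ (+-congʳ fromℚ-½)) (-‿cong (*-cong (*-cong Y≈ Y≈) ρ′+ρ′)) ⟩
    m * ((n′ + I * ρ) * (n′ + I * ρ)) - (m * L + I) * (m * L + I) * ρ
      ≈⟨ solve 5 (λ m n i r l → m :* ((n :+ i :* r) :* (n :+ i :* r)) :- (m :* l :+ i) :* (m :* l :+ i) :* r
                  := m :* (n :* n) :+ (con (+ 1) :+ con (+ 1)) :* i :* n :* (m :* r) :+ i :* i :* r :* (m :* r)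
                     :- m :* (l :* l) :* (m :* r) :- (con (+ 1) :+ con (+ 1)) :* i :* l :* (m :* r) :- i :* i :* r) refl m n′ I ρ L ⟩
    m * (n′ * n′) + 2# * I * n′ * (m * ρ) + I * I * ρ * (m * ρ) - m * (L * L) * (m * ρ) - 2# * I * L * (m * ρ) - I * I * ρ
      ≈⟨ +-congʳ (+-cong (+-cong (+-cong (+-congˡ (*-congˡ mρ)) (*-congˡ mρ)) (-‿cong (*-congˡ mρ))) (-‿cong (*-congˡ mρ))) ⟩
    m * (n′ * n′) + 2# * I * n′ * 1# + I * I * ρ * 1# - m * (L * L) * 1# - 2# * I * L * 1# - I * I * ρ
      ≈⟨ solve 5 (λ m n i r l → m :* (n :* n) :+ (con (+ 1) :+ con (+ 1)) :* i :* n :* con (+ 1) :+ i :* i :* r :* con (+ 1)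
                     :- m :* (l :* l) :* con (+ 1) :- (con (+ 1) :+ con (+ 1)) :* i :* l :* con (+ 1) :- i :* i :* r
                  := m :* (n :* n :- l :* l) :+ (con (+ 1) :+ con (+ 1)) :* i :* (n :- l)) refl m n′ I ρ L ⟩
    m * (n′ * n′ - L * L) + 2# * I * (n′ - L) ∎
    where
    θ = thetaExponent k i ℓ n
    K = fromℕ k
    I = fromℕ i
    L = fromℤ ℓ
    n′ = fromℤ n
    ½ = fromℚ ℚ.½
    m = 1# + 2# * K
    ρ = recipℕ (1 ℕ.+ 2 ℕ.* k)
    ρ′ = recipℕ (2 ℕ.+ 4 ℕ.* k)
    y = + 2 ℤ.* + k ℤ.* ℓ ℤ.+ + i ℤ.+ ℓ
    x = ℤ⇒ℚ n ℚ.+ (+ i) ℚ./ (1 ℕ.+ 2 ℕ.* k)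
    Y = fromℤ y
    fromℚ-x : fromℚ x ≈ n′ + I * ρ
    fromℚ-x = trans (fromℚ-+ (ℤ⇒ℚ n) ((+ i) ℚ./ (1 ℕ.+ 2 ℕ.* k))) (+-cong (fromℚ-ℤ n) (fromℚ-/ (+ i) (1 ℕ.+ 2 ℕ.* k)))
    expand : fromℚ θ ≈ (K + ½) * ((n′ + I * ρ) * (n′ + I * ρ)) - Y * Y * ρ′
    expand = begin
      fromℚ θ
        ≈⟨ fromℚ-+ ((ℕ⇒ℚ k ℚ.+ ℚ.½) ℚ.* (x ℚ.* x)) (ℚ.- ((y ℤ.* y) ℚ./ (2 ℕ.+ 4 ℕ.* k))) ⟩
      fromℚ ((ℕ⇒ℚ k ℚ.+ ℚ.½) ℚ.* (x ℚ.* x)) + fromℚ (ℚ.- ((y ℤ.* y) ℚ./ (2 ℕ.+ 4 ℕ.* k)))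
        ≈⟨ +-cong (trans (fromℚ-* (ℕ⇒ℚ k ℚ.+ ℚ.½) (x ℚ.* x)) (*-cong (trans (fromℚ-+ (ℕ⇒ℚ k) ℚ.½) (+-congʳ (fromℚ-ℤ (+ k))))
                     (trans (fromℚ-* x x) (*-cong fromℚ-x fromℚ-x))))
                  (trans (fromℚ-neg ((y ℤ.* y) ℚ./ (2 ℕ.+ 4 ℕ.* k))) (-‿cong (trans (fromℚ-/ (y ℤ.* y) (2 ℕ.+ 4 ℕ.* k)) (*-congʳ (fromℤ-* y y))))) ⟩
      (K + ½) * ((n′ + I * ρ) * (n′ + I * ρ)) - Y * Y * ρ′ ∎
    Y≈ : Y ≈ m * L + I
    Y≈ = begin
      Y                                         ≈⟨ trans (fromℤ-+ (+ 2 ℤ.* + k ℤ.* ℓ ℤ.+ + i) ℓ) (+-congʳ (fromℤ-+ (+ 2 ℤ.* + k ℤ.* ℓ) (+ i))) ⟩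
      fromℤ (+ 2 ℤ.* + k ℤ.* ℓ) + I + L         ≈⟨ +-congʳ (+-congʳ (trans (fromℤ-* (+ 2 ℤ.* + k) ℓ) (*-congʳ (fromℤ-* (+ 2) (+ k))))) ⟩
      fromℕ 2 * K * L + I + L                   ≈⟨ solve 3 (λ k i l → (con (+ 1) :+ (con (+ 1) :+ con (+ 0))) :* k :* l :+ i :+ l
                                                     := (con (+ 1) :+ (con (+ 1) :+ con (+ 1)) :* k) :* l :+ i) refl K I L ⟩
      m * L + I                                 ∎
    mρ : m * ρ ≈ 1#
    mρ = trans (*-congʳ (+-congˡ (sym (fromℕ-2* k)))) (recip-inverse (1 ℕ.+ 2 ℕ.* k))
    ρ′+ρ′ : ρ′ + ρ′ ≈ ρ
    ρ′+ρ′ = inverse-unique {m} (begin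
      m * (ρ′ + ρ′)                          ≈⟨ solve 2 (λ k r → (con (+ 1) :+ (con (+ 1) :+ con (+ 1)) :* k) :* (r :+ r)
                                                  := (con (+ 1) :+ (con (+ 1) :+ (con (+ 1) :+ (con (+ 1) :+ (con (+ 1) :+ (con (+ 1) :+ con (+ 0))))) :* k)) :* r) refl K ρ′ ⟩
      (1# + (1# + fromℕ 4 * K)) * ρ′         ≈⟨ *-congʳ (+-congˡ (+-congˡ (fromℕ-* 4 k))) ⟨
      fromℕ (2 ℕ.+ 4 ℕ.* k) * ρ′             ≈⟨ recip-inverse (2 ℕ.+ 4 ℕ.* k) ⟩
      1#                                     ∎) mρ

  -- The power of h by which both sides for ℓ differ from those for ∣ℓ∣.
  offset : ℕ → ℤ → ℕ
  offset i ℓ = 2 ℕ.* (i ℕ.* σ ℓ)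

  private
    offset≈ : ∀ i ℓ → fromℕ (offset i ℓ) ≈ 2# * (fromℕ i * (fromℕ ∣ ℓ ∣ - fromℤ ℓ))
    offset≈ i ℓ = trans (fromℕ-2* (i ℕ.* σ ℓ)) (*-congˡ (trans (fromℕ-* i (σ ℓ)) (*-congˡ (σ≈ ℓ))))

    γ≈ : ∀ s λ′ → fromℕ (s ℕ.* s ℕ.+ 2 ℕ.* (λ′ ℕ.* s)) ≈ fromℕ s * fromℕ s + 2# * (fromℕ λ′ * fromℕ s)
    γ≈ s λ′ = trans (fromℕ-+ (s ℕ.* s) (2 ℕ.* (λ′ ℕ.* s))) (+-cong (fromℕ-* s s) (trans (fromℕ-2* (λ′ ℕ.* s)) (*-congˡ (fromℕ-* λ′ s))))

    upper≈ : ∀ k i λ′ s → fromℕ (ThetaExponents.upper k i λ′ s)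
      ≈ (1# + 2# * fromℕ k) * (fromℕ s * fromℕ s + 2# * (fromℕ λ′ * fromℕ s)) + 2# * (fromℕ i * fromℕ s)
    upper≈ k i λ′ s = trans (fromℕ-+ ((2 ℕ.* k ℕ.+ 1) ℕ.* (s ℕ.* s ℕ.+ 2 ℕ.* (λ′ ℕ.* s))) (2 ℕ.* (i ℕ.* s)))
      (+-cong (trans (fromℕ-* (2 ℕ.* k ℕ.+ 1) (s ℕ.* s ℕ.+ 2 ℕ.* (λ′ ℕ.* s))) (*-cong
          (trans (fromℕ-+ (2 ℕ.* k) 1) (trans (+-cong (fromℕ-2* k) (+-identityʳ 1#)) (+-comm _ _))) (γ≈ s λ′)))
        (trans (fromℕ-2* (i ℕ.* s)) (*-congˡ (fromℕ-* i s))))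

    -- The square of ℓ only depends on its absolute value.
    flatten : ∀ k i ℓ x → (1# + 2# * fromℕ k) * (x - fromℕ ∣ ℓ ∣ * fromℕ ∣ ℓ ∣) + i
                        ≈ (1# + 2# * fromℕ k) * (x - fromℤ ℓ * fromℤ ℓ) + i
    flatten k i ℓ x = +-congʳ (*-congˡ (+-congˡ (-‿cong (square-∣∣ ℓ))))

  thetaExponent-upper : ∀ k i ℓ s → fromℚ (thetaExponent k i ℓ (+ ∣ ℓ ∣ ℤ.+ + s)) + fromℚ (thetaExponent k i ℓ (+ ∣ ℓ ∣ ℤ.+ + s))
    ≈ fromℕ (offset i ℓ ℕ.+ ThetaExponents.upper k i ∣ ℓ ∣ s)
  thetaExponent-upper k i ℓ s = begin
    fromℚ (thetaExponent k i ℓ (+ ∣ ℓ ∣ ℤ.+ + s)) + fromℚ (thetaExponent k i ℓ (+ ∣ ℓ ∣ ℤ.+ + s))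
      ≈⟨ thetaExponent-double k i ℓ (+ ∣ ℓ ∣ ℤ.+ + s) ⟩
    m * (n * n - L * L) + 2# * I * (n - L)
      ≈⟨ +-cong (*-congˡ (+-congʳ (*-cong n≈ n≈))) (*-congˡ (+-congʳ n≈)) ⟩
    m * ((Λ + S) * (Λ + S) - L * L) + 2# * I * (Λ + S - L)
      ≈⟨ flatten k _ ℓ _ ⟨
    m * ((Λ + S) * (Λ + S) - Λ * Λ) + 2# * I * (Λ + S - L)
      ≈⟨ solve 5 (λ m Λ S i L → m :* ((Λ :+ S) :* (Λ :+ S) :- Λ :* Λ) :+ (con (+ 1) :+ con (+ 1)) :* i :* (Λ :+ S :- L)
           := (con (+ 1) :+ con (+ 1)) :* (i :* (Λ :- L)) :+ (m :* (S :* S :+ (con (+ 1) :+ con (+ 1)) :* (Λ :* S)) :+ (con (+ 1) :+ con (+ 1)) :* (i :* S)))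
           refl m Λ S I L ⟩
    2# * (I * (Λ - L)) + (m * (S * S + 2# * (Λ * S)) + 2# * (I * S))
      ≈⟨ +-cong (offset≈ i ℓ) (upper≈ k i ∣ ℓ ∣ s) ⟨
    fromℕ (offset i ℓ) + fromℕ (ThetaExponents.upper k i ∣ ℓ ∣ s)
      ≈⟨ fromℕ-+ (offset i ℓ) _ ⟨
    fromℕ (offset i ℓ ℕ.+ ThetaExponents.upper k i ∣ ℓ ∣ s) ∎
    where
    m = 1# + 2# * fromℕ k
    Λ = fromℕ ∣ ℓ ∣
    L = fromℤ ℓ
    I = fromℕ i
    S = fromℕ s
    n = fromℤ (+ ∣ ℓ ∣ ℤ.+ + s)
    n≈ : n ≈ Λ + S
    n≈ = fromℤ-+ (+ ∣ ℓ ∣) (+ s)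

  thetaExponent-lower : ∀ k i ℓ s → i ℕ.≤ k →
    fromℚ (thetaExponent k i ℓ (ℤ.- (+ ∣ ℓ ∣) ℤ.- + 1 ℤ.- + s)) + fromℚ (thetaExponent k i ℓ (ℤ.- (+ ∣ ℓ ∣) ℤ.- + 1 ℤ.- + s))
    ≈ fromℕ (offset i ℓ ℕ.+ ThetaExponents.lower k i ∣ ℓ ∣ s)
  thetaExponent-lower k i ℓ s i≤k = begin
    fromℚ (thetaExponent k i ℓ n) + fromℚ (thetaExponent k i ℓ n)
      ≈⟨ thetaExponent-double k i ℓ n ⟩
    m * (fromℤ n * fromℤ n - L * L) + 2# * I * (fromℤ n - L)
      ≈⟨ +-cong (*-congˡ (+-congʳ (*-cong n≈ n≈))) (*-congˡ (+-congʳ n≈)) ⟩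
    m * ((- Λ - 1# - S) * (- Λ - 1# - S) - L * L) + 2# * I * (- Λ - 1# - S - L)
      ≈⟨ flatten k _ ℓ _ ⟨
    m * ((- Λ - 1# - S) * (- Λ - 1# - S) - Λ * Λ) + 2# * I * (- Λ - 1# - S - L)
      ≈⟨ solve 5 (λ K Λ S i L → (con (+ 1) :+ (con (+ 1) :+ con (+ 1)) :* K) :* ((:- Λ :- con (+ 1) :- S) :* (:- Λ :- con (+ 1) :- S) :- Λ :* Λ) :+ (con (+ 1) :+ con (+ 1)) :* i :* (:- Λ :- con (+ 1) :- S :- L)
           := (con (+ 1) :+ con (+ 1)) :* (i :* (Λ :- L)) :+ (((con (+ 1) :+ (con (+ 1) :+ con (+ 1)) :* K) :* (S :* S :+ (con (+ 1) :+ con (+ 1)) :* (Λ :* S)) :+ (con (+ 1) :+ con (+ 1)) :* (i :* S))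
              :+ ((con (+ 1) :+ con (+ 1)) :* (K :- i) :+ con (+ 1)) :* ((con (+ 1) :+ con (+ 1)) :* S :+ (con (+ 1) :+ con (+ 1)) :* Λ :+ con (+ 1))))
           refl (fromℕ k) Λ S I L ⟩
    2# * (I * (Λ - L)) + ((m * (S * S + 2# * (Λ * S)) + 2# * (I * S)) + (2# * (fromℕ k - I) + 1#) * (2# * S + 2# * Λ + 1#))
      ≈⟨ +-cong (offset≈ i ℓ) (+-cong (upper≈ k i ∣ ℓ ∣ s) (*-cong gap width)) ⟨
    fromℕ (offset i ℓ) + (fromℕ (ThetaExponents.upper k i ∣ ℓ ∣ s) + fromℕ (2 ℕ.* (k ℕ.∸ i) ℕ.+ 1) * fromℕ (2 ℕ.* s ℕ.+ 2 ℕ.* ∣ ℓ ∣ ℕ.+ 1))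
      ≈⟨ +-congˡ (+-congˡ (fromℕ-* (2 ℕ.* (k ℕ.∸ i) ℕ.+ 1) (2 ℕ.* s ℕ.+ 2 ℕ.* ∣ ℓ ∣ ℕ.+ 1))) ⟨
    fromℕ (offset i ℓ) + (fromℕ (ThetaExponents.upper k i ∣ ℓ ∣ s) + fromℕ ((2 ℕ.* (k ℕ.∸ i) ℕ.+ 1) ℕ.* (2 ℕ.* s ℕ.+ 2 ℕ.* ∣ ℓ ∣ ℕ.+ 1)))
      ≈⟨ +-congˡ (fromℕ-+ (ThetaExponents.upper k i ∣ ℓ ∣ s) _) ⟨
    fromℕ (offset i ℓ) + fromℕ (ThetaExponents.lower k i ∣ ℓ ∣ s)
      ≈⟨ fromℕ-+ (offset i ℓ) _ ⟨
    fromℕ (offset i ℓ ℕ.+ ThetaExponents.lower k i ∣ ℓ ∣ s) ∎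
    where
    m = 1# + 2# * fromℕ k
    Λ = fromℕ ∣ ℓ ∣
    L = fromℤ ℓ
    I = fromℕ i
    S = fromℕ s
    n = ℤ.- (+ ∣ ℓ ∣) ℤ.- + 1 ℤ.- + s
    n≈ : fromℤ n ≈ - Λ - 1# - S
    n≈ = trans (fromℤ-+ (ℤ.- (+ ∣ ℓ ∣) ℤ.- + 1) (ℤ.- + s)) (+-cong
      (trans (fromℤ-+ (ℤ.- (+ ∣ ℓ ∣)) (ℤ.- + 1)) (+-cong (fromℤ-neg (+ ∣ ℓ ∣)) (-‿cong (+-identityʳ 1#)))) (fromℤ-neg (+ s)))
    gap : fromℕ (2 ℕ.* (k ℕ.∸ i) ℕ.+ 1) ≈ 2# * (fromℕ k - I) + 1#
    gap = trans (fromℕ-+ (2 ℕ.* (k ℕ.∸ i)) 1) (+-cong (trans (fromℕ-2* (k ℕ.∸ i)) (*-congˡ (begin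
      fromℕ (k ℕ.∸ i)                   ≈⟨ solve 2 (λ d i → d := (i :+ d) :- i) refl (fromℕ (k ℕ.∸ i)) I ⟩
      I + fromℕ (k ℕ.∸ i) - I           ≈⟨ +-congʳ (fromℕ-+ i (k ℕ.∸ i)) ⟨
      fromℕ (i ℕ.+ (k ℕ.∸ i)) - I       ≡⟨ ≡.cong (λ x → fromℕ x - I) (ℕₚ.m+[n∸m]≡n i≤k) ⟩
      fromℕ k - I                       ∎))) (+-identityʳ 1#))
    width : fromℕ (2 ℕ.* s ℕ.+ 2 ℕ.* ∣ ℓ ∣ ℕ.+ 1) ≈ 2# * S + 2# * Λ + 1#
    width = trans (fromℕ-+ (2 ℕ.* s ℕ.+ 2 ℕ.* ∣ ℓ ∣) 1) (+-cong (trans (fromℕ-+ (2 ℕ.* s) (2 ℕ.* ∣ ℓ ∣)) (+-cong (fromℕ-2* s) (fromℕ-2* ∣ ℓ ∣))) (+-identityʳ 1#))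

  -- Twice the exponent of the multisum, in terms of the sums over all partial sums.
  multisumExponent-double : ∀ k i ℓ (n : Vec ℕ (suc k)) →
    fromℚ (multisumExponent (suc k) i ℓ n) + fromℚ (multisumExponent (suc k) i ℓ n)
    ≈ 2# * fromℕ (∑N² n) + 2# * (2# * (fromℤ ℓ * fromℕ (∑N n))) + 2# * fromℕ (∑bonus i n)
      - (fromℕ (N n 1) * fromℕ (N n 1) + 2# * (fromℤ ℓ * fromℕ (N n 1)))
  multisumExponent-double k i ℓ n = begin
    fromℚ E + fromℚ E
      ≈⟨ +-cong expand expand ⟩
    (x * (x + 1#) * ½′ + Y + (L + ½) * x + (2# * L + 1#) * Z - V) + (x * (x + 1#) * ½′ + Y + (L + ½) * x + (2# * L + 1#) * Z - V)
      ≈⟨ solve 7 (λ x r Y L h Z V → let two = con (+ 1) :+ con (+ 1) ; t = x :* (x :+ con (+ 1)) :* r :+ Y :+ (L :+ h) :* x :+ (two :* L :+ con (+ 1)) :* Z :- V in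
           t :+ t := x :* (x :+ con (+ 1)) :* (r :+ r) :+ two :* Y :+ (two :* L :+ (h :+ h)) :* x :+ two :* ((two :* L :+ con (+ 1)) :* Z) :- two :* V)
           refl x ½′ Y L ½ Z V ⟩
    x * (x + 1#) * (½′ + ½′) + 2# * Y + (2# * L + (½ + ½)) * x + 2# * ((2# * L + 1#) * Z) - 2# * V
      ≈⟨ +-cong (+-congʳ (+-cong (+-congʳ (*-congˡ ½′+½′)) (*-congʳ (+-congˡ fromℚ-½)))) (-‿cong (*-congˡ V≈)) ⟩
    x * (x + 1#) * 1# + 2# * Y + (2# * L + 1#) * x + 2# * ((2# * L + 1#) * Z) - 2# * (x + Z - β)
      ≈⟨ solve 5 (λ x Y L Z β → let two = con (+ 1) :+ con (+ 1) in
           x :* (x :+ con (+ 1)) :* con (+ 1) :+ two :* Y :+ (two :* L :+ con (+ 1)) :* x :+ two :* ((two :* L :+ con (+ 1)) :* Z) :- two :* (x :+ Z :- β)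
           := two :* (x :* x :+ Y) :+ two :* (two :* (L :* (x :+ Z))) :+ two :* β :- (x :* x :+ two :* (L :* x))) refl x Y L Z β ⟩
    2# * (x * x + Y) + 2# * (2# * (L * (x + Z))) + 2# * β - (x * x + 2# * (L * x))
      ≈⟨ +-congʳ (+-congʳ (+-cong (*-congˡ (trans (fromℕ-+ (N n 1 ℕ.* N n 1) Y′) (+-congʳ (fromℕ-* (N n 1) (N n 1)))))
                               (*-congˡ (*-congˡ (*-congˡ (fromℕ-+ (N n 1) Z′)))))) ⟨
    2# * fromℕ (∑N² n) + 2# * (2# * (L * fromℕ (∑N n))) + 2# * β - (x * x + 2# * (L * x)) ∎
    where
    E = multisumExponent (suc k) i ℓ n
    x = fromℕ (N n 1)
    L = fromℤ ℓ
    Y′ = ∑[ 2 ⋯ suc k ] (λ j → N n j ℕ.* N n j)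
    Z′ = ∑[ 2 ⋯ suc k ] (N n)
    V′ = ∑[ 1 ⋯ suc k ℕ.∸ i ] (N n)
    Y = fromℕ Y′
    Z = fromℕ Z′
    V = fromℕ V′
    β = fromℕ (∑bonus i n)
    ½ = fromℚ ℚ.½
    ½′ = recipℕ 2
    ½′+½′ : ½′ + ½′ ≈ 1#
    ½′+½′ = trans (solve 1 (λ r → r :+ r := (con (+ 1) :+ (con (+ 1) :+ con (+ 0))) :* r) refl ½′) (recip-inverse 2)
    V≈ : V ≈ x + Z - β
    V≈ = begin
      V                        ≈⟨ solve 2 (λ V b → V := (V :+ b) :- b) refl V β ⟩
      (V + β) - β              ≈⟨ +-congʳ (fromℕ-+ V′ (∑bonus i n)) ⟨
      fromℕ (V′ ℕ.+ ∑bonus i n) - β ≡⟨ ≡.cong (λ s → fromℕ s - β) (∑bonus-complement i n) ⟩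
      fromℕ (∑N n) - β         ≈⟨ +-congʳ (fromℕ-+ (N n 1) Z′) ⟩
      x + Z - β                ∎
    r₁ r₂ r₃ r₄ r₅ : ℚ
    r₁ = (+ (N n 1 ℕ.* (N n 1 ℕ.+ 1))) ℚ./ 2
    r₂ = ℕ⇒ℚ Y′
    r₃ = (ℤ⇒ℚ ℓ ℚ.+ ℚ.½) ℚ.* ℕ⇒ℚ (N n 1)
    r₄ = ℤ⇒ℚ (+ 2 ℤ.* ℓ ℤ.+ + 1) ℚ.* ℕ⇒ℚ Z′
    r₅ = ℕ⇒ℚ V′
    expand : fromℚ E ≈ x * (x + 1#) * ½′ + Y + (L + ½) * x + (2# * L + 1#) * Z - V
    expand = begin
      fromℚ (r₁ ℚ.+ r₂ ℚ.+ r₃ ℚ.+ r₄ ℚ.- r₅)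
        ≈⟨ trans (fromℚ-+ (r₁ ℚ.+ r₂ ℚ.+ r₃ ℚ.+ r₄) (ℚ.- r₅)) (+-cong (trans (fromℚ-+ (r₁ ℚ.+ r₂ ℚ.+ r₃) r₄)
             (+-congʳ (trans (fromℚ-+ (r₁ ℚ.+ r₂) r₃) (+-congʳ (fromℚ-+ r₁ r₂))))) (fromℚ-neg r₅)) ⟩
      fromℚ r₁ + fromℚ r₂ + fromℚ r₃ + fromℚ r₄ - fromℚ r₅
        ≈⟨ +-cong (+-cong (+-cong (+-cong
             (trans (fromℚ-/ (+ (N n 1 ℕ.* (N n 1 ℕ.+ 1))) 2) (*-congʳ (trans (fromℕ-* (N n 1) (N n 1 ℕ.+ 1)) (*-congˡ (trans (fromℕ-+ (N n 1) 1) (+-congˡ (+-identityʳ 1#)))))))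
             (fromℚ-ℤ (+ Y′)))
             (trans (fromℚ-* (ℤ⇒ℚ ℓ ℚ.+ ℚ.½) (ℕ⇒ℚ (N n 1))) (*-cong (trans (fromℚ-+ (ℤ⇒ℚ ℓ) ℚ.½) (+-congʳ (fromℚ-ℤ ℓ))) (fromℚ-ℤ (+ N n 1)))))
             (trans (fromℚ-* (ℤ⇒ℚ (+ 2 ℤ.* ℓ ℤ.+ + 1)) (ℕ⇒ℚ Z′)) (*-cong (trans (fromℚ-ℤ (+ 2 ℤ.* ℓ ℤ.+ + 1))
               (trans (fromℤ-+ (+ 2 ℤ.* ℓ) (+ 1)) (+-cong (trans (fromℤ-* (+ 2) ℓ) (*-congʳ (+-congˡ (+-identityʳ 1#)))) (+-identityʳ 1#)))) (fromℚ-ℤ (+ Z′)))))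
             (-‿cong (fromℚ-ℤ (+ V′))) ⟩
      x * (x + 1#) * ½′ + Y + (L + ½) * x + (2# * L + 1#) * Z - V ∎

  -- Raising the last variable by σ ℓ reduces the multisum to the case of a nonnegative ℓ.
  multisumExponent-raise : ∀ k i ℓ (v : Vec ℕ (suc k)) → i ℕ.≤ suc k →
    fromℚ (multisumExponent (suc k) i ℓ (raise (σ ℓ) v)) + fromℚ (multisumExponent (suc k) i ℓ (raise (σ ℓ) v))
    ≈ fromℕ (offset i ℓ ℕ.+ MultisumExponent.exponent i ∣ ℓ ∣ v)
  multisumExponent-raise k i ℓ v i≤k = begin
    fromℚ (multisumExponent (suc k) i ℓ n) + fromℚ (multisumExponent (suc k) i ℓ n)
      ≈⟨ multisumExponent-double k i ℓ n ⟩
    2# * fromℕ (∑N² n) + 2# * (2# * (L * fromℕ (∑N n))) + 2# * fromℕ (∑bonus i n) - (fromℕ (N n 1) * fromℕ (N n 1) + 2# * (L * fromℕ (N n 1)))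
      ≈⟨ +-cong (+-cong (+-cong (*-congˡ B≈) (*-congˡ (*-congˡ (*-congˡ A≈)))) (*-congˡ β≈)) (-‿cong (+-cong (*-cong x≈ x≈) (*-congˡ (*-congˡ x≈)))) ⟩
    2# * (B + (2# * S * A + K * (S * S))) + 2# * (2# * (L * (A + K * S))) + 2# * (β + I * S) - ((x + S) * (x + S) + 2# * (L * (x + S)))
      ≈⟨ solve 8 (λ B A K S L β I x → let two = con (+ 1) :+ con (+ 1) in
           two :* (B :+ (two :* S :* A :+ K :* (S :* S))) :+ two :* (two :* (L :* (A :+ K :* S))) :+ two :* (β :+ I :* S) :- ((x :+ S) :* (x :+ S) :+ two :* (L :* (x :+ S)))
           := (two :* (I :* S) :+ (two :* B :+ two :* (two :* ((S :+ L) :* A)) :+ two :* β :- (x :* x :+ two :* ((S :+ L) :* x))))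
              :+ (two :* K :- con (+ 1)) :* ((S :+ L) :* (S :+ L) :- L :* L)) refl B A K S L β I x ⟩
    (2# * (I * S) + (2# * B + 2# * (2# * ((S + L) * A)) + 2# * β - (x * x + 2# * ((S + L) * x)))) + (2# * K - 1#) * ((S + L) * (S + L) - L * L)
      ≈⟨ +-cong (+-congˡ (+-cong (+-congʳ (+-congˡ (*-congˡ (*-congˡ (*-congʳ S+L))))) (-‿cong (+-congˡ (*-congˡ (*-congʳ S+L))))))
                (*-congˡ (+-congʳ (trans (*-cong S+L S+L) (square-∣∣ ℓ)))) ⟩
    (2# * (I * S) + (2# * B + 2# * (2# * (Λ * A)) + 2# * β - (x * x + 2# * (Λ * x)))) + (2# * K - 1#) * (L * L - L * L)
      ≈⟨ solve 5 (λ o e x K l → (o :+ (e :- x)) :+ K :* (l :- l) := o :+ (e :- x)) refl (2# * (I * S)) (2# * B + 2# * (2# * (Λ * A)) + 2# * β) (x * x + 2# * (Λ * x)) (2# * K - 1#) (L * L) ⟩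
    2# * (I * S) + (2# * B + 2# * (2# * (Λ * A)) + 2# * β - (x * x + 2# * (Λ * x)))
      ≈⟨ +-cong (trans (fromℕ-2* (i ℕ.* σ ℓ)) (*-congˡ (fromℕ-* i (σ ℓ)))) exponent≈ ⟨
    fromℕ (offset i ℓ) + fromℕ (exponent v)
      ≈⟨ fromℕ-+ (offset i ℓ) (exponent v) ⟨
    fromℕ (offset i ℓ ℕ.+ exponent v) ∎
    where
    open MultisumExponent i ∣ ℓ ∣
    n = raise (σ ℓ) v
    L = fromℤ ℓ
    Λ = fromℕ ∣ ℓ ∣
    S = fromℕ (σ ℓ)
    K = fromℕ (suc k)
    I = fromℕ i
    A = fromℕ (∑N v)
    B = fromℕ (∑N² v)
    β = fromℕ (∑bonus i v)
    x = fromℕ (N v 1)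
    S+L : S + L ≈ Λ
    S+L = trans (sym (fromℤ-+ (+ σ ℓ) ℓ)) (ℝ.reflexive (≡.cong fromℤ (σ-+ ℓ)))
    x≈ : fromℕ (N n 1) ≈ x + S
    x≈ = trans (ℝ.reflexive (≡.cong fromℕ (N₁-raise (σ ℓ) v))) (fromℕ-+ (N v 1) (σ ℓ))
    A≈ : fromℕ (∑N n) ≈ A + K * S
    A≈ = trans (ℝ.reflexive (≡.cong fromℕ (∑N-raise (σ ℓ) v))) (trans (fromℕ-+ (∑N v) _) (+-congˡ (fromℕ-* (suc k) (σ ℓ))))
    B≈ : fromℕ (∑N² n) ≈ B + (2# * S * A + K * (S * S))
    B≈ = trans (ℝ.reflexive (≡.cong fromℕ (∑N²-raise (σ ℓ) v))) (trans (fromℕ-+ (∑N² v) _) (+-congˡ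
      (trans (fromℕ-+ (2 ℕ.* σ ℓ ℕ.* ∑N v) _) (+-cong (trans (fromℕ-* (2 ℕ.* σ ℓ) (∑N v)) (*-congʳ (fromℕ-2* (σ ℓ))))
        (trans (fromℕ-* (suc k) (σ ℓ ℕ.* σ ℓ)) (*-congˡ (fromℕ-* (σ ℓ) (σ ℓ))))))))
    β≈ : fromℕ (∑bonus i n) ≈ β + I * S
    β≈ = trans (ℝ.reflexive (≡.cong fromℕ (≡.trans (∑bonus-raise i (σ ℓ) v) (≡.cong (λ m → ∑bonus i v ℕ.+ m ℕ.* σ ℓ) (ℕₚ.m≥n⇒m⊓n≡n i≤k)))))
      (trans (fromℕ-+ (∑bonus i v) _) (+-congˡ (fromℕ-* i (σ ℓ))))
    exponent≈ : fromℕ (exponent v) ≈ 2# * B + 2# * (2# * (Λ * A)) + 2# * β - (x * x + 2# * (Λ * x))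
    exponent≈ = begin
      fromℕ (exponent v)
        ≈⟨ solve 2 (λ g e → e := (g :+ e) :- g) refl (fromℕ (γ (N v 1))) _ ⟩
      (fromℕ (γ (N v 1)) + fromℕ (exponent v)) - fromℕ (γ (N v 1))
        ≈⟨ +-cong (sym (fromℕ-+ (γ (N v 1)) (exponent v))) (-‿cong (γ≈ (N v 1) ∣ ℓ ∣)) ⟩
      fromℕ (γ (N v 1) ℕ.+ exponent v) - (x * x + 2# * (Λ * x))
        ≈⟨ +-congʳ (trans (ℝ.reflexive (≡.cong fromℕ (exponent≡ v))) (trans (fromℕ-+ (2 ℕ.* ∑N² v ℕ.+ 4 ℕ.* (∣ ℓ ∣ ℕ.* ∑N v)) (2 ℕ.* ∑bonus i v))
             (+-cong (trans (fromℕ-+ (2 ℕ.* ∑N² v) (4 ℕ.* (∣ ℓ ∣ ℕ.* ∑N v))) (+-cong (fromℕ-2* (∑N² v))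
               (trans (fromℕ-* 4 (∣ ℓ ∣ ℕ.* ∑N v)) (trans (*-cong four (fromℕ-* ∣ ℓ ∣ (∑N v))) (*-assoc _ _ _)))))
               (fromℕ-2* (∑bonus i v))))) ⟩
      2# * B + 2# * (2# * (Λ * A)) + 2# * β - (x * x + 2# * (Λ * x)) ∎
      where
      four : fromℕ 4 ≈ 2# * 2#
      four = solve 0 (con (+ 1) :+ (con (+ 1) :+ (con (+ 1) :+ (con (+ 1) :+ con (+ 0)))) := (con (+ 1) :+ con (+ 1)) :* (con (+ 1) :+ con (+ 1))) refl

-- The summands and their reindexing

-- The summand of the finite identity, with the powers of h and the reciprocals of q-factorials collected.
module TermFactorisation {c r : Level} (R : CommutativeRing c r)
  (h : CommutativeRing.Carrier R) (reciprocals : QFactorialReciprocals R (CommutativeRing._*_ R h h)) (ℓ i : ℕ) where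

  open CommutativeRing R
  open QFactorialReciprocals reciprocals
  open Algebra.Properties.Semiring.Exp semiring using (_^_)

  open Relation.Binary.Reasoning.Setoid setoid
  open IntegerCoefficients R using (module Solver)
  open Solver using (solve; _:=_; _:*_)
  open FiniteIdentity R h reciprocals ℓ i
  open MultisumExponent i ℓ using (innerExponent; exponent)
  open PartialSums using (last)
  open import Data.Vec.Base using ([]; _∷_; sum; toList)

  -- The product of the 1/(q)_(n_j).
  e-product : ∀ {k} → Vec ℕ k → Carrier
  e-product v = List.foldr (λ m p → e m * p) 1# (toList v)

  tail-factors : ∀ {k} n (v : Vec ℕ k) → tail n v ≈ h ^ innerExponent v * (e-product v * e (last (n ∷ v) ℕ.+ 2 ℕ.* ℓ))
  tail-factors n []              = sym (trans (*-identityˡ _) (*-identityˡ _))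
  tail-factors {suc k} n (m ∷ v) = begin
    h ^ E * (e m * tail m v)
      ≈⟨ *-congˡ (*-congˡ (tail-factors m v)) ⟩
    h ^ E * (e m * (h ^ innerExponent v * (e-product v * e (last (m ∷ v) ℕ.+ 2 ℕ.* ℓ))))
      ≈⟨ solve 5 (λ x y z u v → x :* (y :* (z :* (u :* v))) := x :* z :* (y :* u :* v)) refl _ _ _ _ _ ⟩
    h ^ E * h ^ innerExponent v * (e m * e-product v * e (last (m ∷ v) ℕ.+ 2 ℕ.* ℓ))
      ≈⟨ *-congʳ (h^-* E (innerExponent v) ≡.refl) ⟩
    h ^ (E ℕ.+ innerExponent v) * (e m * e-product v * e (last (m ∷ v) ℕ.+ 2 ℕ.* ℓ)) ∎
    where E = 2 ℕ.* γ (m ℕ.+ sum v) ℕ.+ 2 ℕ.* bonus i (suc k) (m ℕ.+ sum v)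

  term-factors : ∀ {k} (v : Vec ℕ (suc k)) →
    term v ≈ h ^ exponent v * (poch (- h) (sum v ℕ.+ ℓ) * (e-product v * e (last v ℕ.+ 2 ℕ.* ℓ)))
  term-factors {k} (n ∷ v) = begin
    h ^ E * P * (e n * tail n v)
      ≈⟨ *-congˡ (*-congˡ (tail-factors n v)) ⟩
    h ^ E * P * (e n * (h ^ innerExponent v * (e-product v * e (last (n ∷ v) ℕ.+ 2 ℕ.* ℓ))))
      ≈⟨ solve 6 (λ x p y z u v → x :* p :* (y :* (z :* (u :* v))) := x :* z :* (p :* (y :* u :* v))) refl _ _ _ _ _ _ ⟩
    h ^ E * h ^ innerExponent v * (P * (e n * e-product v * e (last (n ∷ v) ℕ.+ 2 ℕ.* ℓ)))
      ≈⟨ *-congʳ (h^-* E (innerExponent v) ≡.refl) ⟩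
    h ^ (E ℕ.+ innerExponent v) * (P * (e n * e-product v * e (last (n ∷ v) ℕ.+ 2 ℕ.* ℓ))) ∎
    where
    E = γ (n ℕ.+ sum v) ℕ.+ 2 ℕ.* bonus i (suc k) (n ℕ.+ sum v)
    P = poch (- h) (n ℕ.+ sum v ℕ.+ ℓ)

-- Unconditional sums may be reindexed along an injection outside the image of
-- which the family vanishes.
module Reindexing {c ℓ₁ ℓ₂ ℓ₃ : Level} (ℛ : RealNumbers c ℓ₁ ℓ₂ ℓ₃) (𝒩 : NormedRing ℛ)
  {A B : Set} (encode : A → B) (decode : B → Maybe A)
  (decode-encode : ∀ a → decode (encode a) ≡ just a)
  (encode-decode : ∀ {a} b → decode b ≡ just a → b ≡ encode a) where

  open NormedRing 𝒩
  open CommutativeRing commutativeRing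
  open ListSums commutativeRing
  open import Data.List.Base using ([]; _∷_; map)

  private module ℝ = RealNumbers ℛ

  -- The net of finite subsums tends to S.
  Summable : {I : Set} → (I → Carrier) → Carrier → Set (c ⊔ ℓ₃)
  Summable {I} f S = ∀ ε → ℝ.0# ℝ.< ε → Σ (List I) λ F → ∀ G → Unique G → F ⊆ G → ∣ listSum f G - S ∣≤ ε

  private
    -- The elements of A whose codes occur in the list.
    preimage : List B → List A
    preimage []      = []
    preimage (b ∷ G) with decode b
    ... | just a  = a ∷ preimage G
    ... | nothing = preimage G

    ∈-preimage⁺ : ∀ {a} G → encode a ∈ G → a ∈ preimage G
    ∈-preimage⁺ {a} (b ∷ G) (here ≡.refl) with decode (encode a) | decode-encode a
    ... | .(just a) | ≡.refl = here ≡.refl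
    ∈-preimage⁺ (b ∷ G) (there p) with decode b
    ... | just _  = there (∈-preimage⁺ G p)
    ... | nothing = ∈-preimage⁺ G p

    ∈-preimage⁻ : ∀ {a} G → a ∈ preimage G → encode a ∈ G
    ∈-preimage⁻ (b ∷ G) p with decode b in eq
    ∈-preimage⁻ (b ∷ G) (here ≡.refl) | just a = here (≡.sym (encode-decode b eq))
    ∈-preimage⁻ (b ∷ G) (there p)     | just _ = there (∈-preimage⁻ G p)
    ... | nothing = there (∈-preimage⁻ G p)

    preimage-unique : ∀ G → Unique G → Unique (preimage G)
    preimage-unique []      _ = AllPairs.[]
    preimage-unique (b ∷ G) (b∉G AllPairs.∷ uG) with decode b in eq
    ... | nothing = preimage-unique G uG
    ... | just a  = All.tabulate (λ {a′} a′∈ a≡a′ → All.lookup b∉G (∈-preimage⁻ G a′∈)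
                      (≡.trans (encode-decode b eq) (≡.cong encode a≡a′))) AllPairs.∷ preimage-unique G uG

  reindex : ∀ {f : B → Carrier} {g : A → Carrier} {S} →
    (∀ a → f (encode a) ≈ g a) → (∀ b → decode b ≡ nothing → f b ≈ 0#) → Summable g S → Summable f S
  reindex {f} {g} {S} inside outside summable ε 0<ε =
    let F , near = summable ε 0<ε in
    map encode F , λ G uG F⊆G → ∣∣-cong (+-congʳ (sym (sums G)))
      (near (preimage G) (preimage-unique G uG) λ a∈F → ∈-preimage⁺ G (F⊆G (∈ₚ.∈-map⁺ encode a∈F)))
    where
    sums : ∀ G → listSum f G ≈ listSum g (preimage G)
    sums []      = refl
    sums (b ∷ G) with decode b in eq
    ... | just a  = +-cong (trans (reflexive (≡.cong f (encode-decode b eq))) (inside a)) (sums G)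
    ... | nothing = trans (+-cong (outside b eq) (sums G)) (+-identityˡ _)

-- Subtraction of s from the last component, when possible.
module Lowering (s : ℕ) where

  open PartialSums
  open import Data.Vec.Base using ([]; _∷_)

  lower : ∀ {k} → Vec ℕ (suc k) → Maybe (Vec ℕ (suc k))
  lower {zero}  (n ∷ []) with s ℕₚ.≤? n
  ... | yes _ = just ((n ℕ.∸ s) ∷ [])
  ... | no  _ = nothing
  lower {suc k} (n ∷ v) = Maybe.map (n ∷_) (lower v)

  lower-raise : ∀ {k} (v : Vec ℕ (suc k)) → lower (raise s v) ≡ just v
  lower-raise {zero} (n ∷ []) with s ℕₚ.≤? n ℕ.+ s
  ... | yes _  = ≡.cong (λ m → just (m ∷ [])) (ℕₚ.m+n∸n≡m n s)
  ... | no s≰  = contradiction (ℕₚ.m≤n+m s n) s≰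
  lower-raise {suc k} (n ∷ v) rewrite lower-raise v = ≡.refl

  raise-lower : ∀ {k} {v : Vec ℕ (suc k)} (w : Vec ℕ (suc k)) → lower w ≡ just v → w ≡ raise s v
  raise-lower {zero} (n ∷ []) eq with s ℕₚ.≤? n
  raise-lower {zero} (n ∷ []) ≡.refl | yes s≤n = ≡.cong (_∷ []) (≡.sym (ℕₚ.m∸n+n≡m s≤n))
  raise-lower {suc k} (n ∷ w) eq with lower w in eq′
  raise-lower {suc k} (n ∷ w) ≡.refl | just v = ≡.cong (n ∷_) (raise-lower w eq′)

  lower-nothing : ∀ {k} (w : Vec ℕ (suc k)) → lower w ≡ nothing → last w ℕ.< s
  lower-nothing {zero} (n ∷ []) eq with s ℕₚ.≤? n
  ... | no s≰n = ℕₚ.≰⇒> s≰n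
  lower-nothing {suc k} (n ∷ w) eq with lower w in eq′
  ... | nothing = lower-nothing w eq′

-- Reciprocals and infinite products

module ComplexInverses {c ℓ₁ ℓ₂ ℓ₃ : Level} (ℛ : RealNumbers c ℓ₁ ℓ₂ ℓ₃) where

  open OrderedField ℛ
  open Analysis ℛ
  open ComplexNumbers ℛ
  open Solver using (solve; _:=_; _:+_; _:*_; _:-_; :-_; con)

  invᶜ-inverse : ∀ z z≠0 → z *ᶜ invᶜ z z≠0 ≈ᶜ 1ᶜ
  invᶜ-inverse (a +i b) z≠0 =
    trans (solve 3 (λ a b r → a :* (a :* r :- (:- b) :* con (+ 0)) :- b :* (a :* con (+ 0) :+ (:- b) :* r) := r :* ((a :* a :+ b :* b) :- con (+ 0))) refl a b r)
      (proj₁ (proj₂ (#⇒invertible z≠0))) ,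
    solve 3 (λ a b r → a :* (a :* con (+ 0) :+ (:- b) :* r) :+ b :* (a :* r :- (:- b) :* con (+ 0)) := con (+ 0)) refl a b r
    where r = invℝ (∣ a +i b ∣²) z≠0

  positive⇒NonZero : ∀ z → 0# < ∣ z ∣² → NonZeroᶜ z
  positive⇒NonZero z 0<z = #-sym (<⇒# 0<z)

  NonZero⇒positive : ∀ z → NonZeroᶜ z → 0# < ∣ z ∣²
  NonZero⇒positive z z≠0 = [ (λ lt → contradiction lt (∣∣²-0≤ z)) , (λ lt → lt) ]′ (#⇒<⊎> z≠0)

  NonZero-* : ∀ z w → NonZeroᶜ z → NonZeroᶜ w → NonZeroᶜ (z *ᶜ w)
  NonZero-* z w z≠0 w≠0 = positive⇒NonZero (z *ᶜ w)
    (<-cong refl (sym (∣∣²-* z w)) (*-pos (NonZero⇒positive z z≠0) (NonZero⇒positive w w≠0)))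

  invertible⇒NonZero : ∀ z w → z *ᶜ w ≈ᶜ 1ᶜ → NonZeroᶜ z
  invertible⇒NonZero z w zw = positive⇒NonZero z ([ (λ lt → contradiction lt (∣∣²-0≤ z)) , (λ lt → lt) ]′ (#⇒<⊎> apart))
    where
    product : ∣ z ∣² * ∣ w ∣² ≈ 1#
    product = trans (sym (∣∣²-* z w)) (trans (∣∣²-cong zw) (solve 0 (con (+ 1) :* con (+ 1) :+ con (+ 0) :* con (+ 0) := con (+ 1)) refl))
    apart : ∣ z ∣² # 0#
    apart = invertible⇒# (∣ w ∣² , trans (solve 2 (λ x y → y :* (x :- con (+ 0)) := x :* y) refl _ _) product
                                 , trans (solve 2 (λ x y → (x :- con (+ 0)) :* y := x :* y) refl _ _) product)

  private
    -- The distance of 1 from a point of norm at most t < 1.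
    1-bound : ∀ {x t} → t < 1# → ∣ x ∣≤ t → (1# - t) * (1# - t) ≤ ∣ 1ᶜ -ᶜ x ∣²
    1-bound {x} {t} t<1 ∣x∣ = ≤-trans (square-mono-≤ (<⇒≤ (<⇒0< t<1)) (+-mono-≤ (≤-refl {1#})
      (0≤⇒≤ (≤-cong refl (solve 2 (λ a t → t :- a := :- a :- (:- t)) refl (re x) t) (≤⇒0≤ (re≤ {x} ∣x∣)))))) (x≤x+ (square-0≤ _))

  1-NonZero : ∀ {x t} → t < 1# → ∣ x ∣≤ t → NonZeroᶜ (1ᶜ -ᶜ x)
  1-NonZero {x} t<1 ∣x∣ = positive⇒NonZero (1ᶜ -ᶜ x) (<-≤-trans (*-pos (<⇒0< t<1) (<⇒0< t<1)) (1-bound {x} t<1 ∣x∣))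

  1-inverse-bound : ∀ {x t T} (t<1 : t < 1#) (∣x∣ : ∣ x ∣≤ t) → 0# < T → (1# - t) * T ≈ 1# →
                    ∣ invᶜ (1ᶜ -ᶜ x) (1-NonZero {x} t<1 ∣x∣) ∣≤ T
  1-inverse-bound {x} {t} {T} t<1 ∣x∣ 0<T inverse = <⇒≤ 0<T ,
    *-cancelˡ-≤ (*-pos (<⇒0< t<1) (<⇒0< t<1)) (≤-trans (*-monoˡ-≤ (∣∣²-0≤ w) (1-bound {x} t<1 ∣x∣)) (≈⇒≤ (trans product (sym squares))))
    where
    w = invᶜ (1ᶜ -ᶜ x) (1-NonZero {x} t<1 ∣x∣)
    product : ∣ 1ᶜ -ᶜ x ∣² * ∣ w ∣² ≈ 1#
    product = trans (sym (∣∣²-* (1ᶜ -ᶜ x) w)) (trans (∣∣²-cong (invᶜ-inverse (1ᶜ -ᶜ x) (1-NonZero {x} t<1 ∣x∣)))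
      (solve 0 (con (+ 1) :* con (+ 1) :+ con (+ 0) :* con (+ 0) := con (+ 1)) refl))
    squares : (1# - t) * (1# - t) * (T * T) ≈ 1#
    squares = trans (solve 2 (λ d T → d :* d :* (T :* T) := d :* T :* (d :* T)) refl (1# - t) T) (trans (*-cong inverse inverse) (*-identityˡ 1#))

-- Infinite products with factors 1 + O(t^n) converge.
module InfiniteProducts {c ℓ₁ ℓ₂ ℓ₃ : Level} (ℛ : RealNumbers c ℓ₁ ℓ₂ ℓ₃)
  (exp : Analysis.ℂ ℛ → Analysis.ℂ ℛ) (isExp : Analysis.IsExp ℛ exp)
  (t : RealNumbers.Carrier ℛ) (0≤t : OrderedField._≤_ ℛ (RealNumbers.0# ℛ) t)
  (t<1 : RealNumbers._<_ ℛ t (RealNumbers.1# ℛ)) where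

  open OrderedField ℛ
  open Analysis ℛ
  open ComplexNumbers ℛ
  open Exponential ℛ exp isExp
  open GeometricLimits ℛ ℂ-normed t 0≤t t<1
  open NormedRing ℂ-normed using (∣∣-cong; ∣∣-mono; ∣*∣; ∣+∣; ∣1∣; ∣∣-0≤)
  private
    module ∑ℝ = FiniteSums ℝ-ring
    module ℂS = IntegerCoefficients.Solver ℂ-commutativeRing
  open Solver using (solve; _:=_; _:+_; _:*_; _:-_; :-_; con)

  product-converges : ∀ {u d : ℕ → ℂ} {K} → u 0 ≈ᶜ 1ᶜ → (∀ n → u (suc n) ≈ᶜ u n *ᶜ (1ᶜ +ᶜ d n)) →
    (∀ n → ∣ d n ∣≤ K * t ^ n) → ∃[ L ] (u ⇝ L)
  product-converges {u} {d} {K} u₀ u-suc ∣d∣ = ⇝-complete {K = E (K * T) * K} λ n →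
    ∣∣-cong {u n *ᶜ d n} (difference n) (∣∣-mono {u n *ᶜ d n} (≈⇒≤ (sym (*-assoc _ _ _))) (∣*∣ {u n} {d n} (uniform n) (∣d∣ n)))
    where
    E : ℝ → ℝ
    E x = re (exp (ofℝ x))
    0≤K : 0# ≤ K
    0≤K = ≤-cong refl (*-identityʳ K) (∣∣-0≤ {d 0} (∣d∣ 0))
    S : ℕ → ℝ
    S n = K * ∑ℝ.∑ n (t ^_)
    0≤∑ : ∀ n → 0# ≤ ∑ℝ.∑ n (t ^_)
    0≤∑ zero    = ≤-refl
    0≤∑ (suc n) = 0≤+ (0≤∑ n) (^-0≤ 0≤t n)
    -- The partial products are bounded by the exponential of the sum of the K t^j.
    partial : ∀ n → ∣ u n ∣≤ E (S n)
    partial zero    = ∣∣-cong {1ᶜ} (ℂ-ring.sym u₀) (∣∣-mono {1ᶜ} (≤-trans (x≤x+ (*-0≤ 0≤K ≤-refl)) (1+x≤exp (*-0≤ 0≤K ≤-refl))) ∣1∣)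
    partial (suc n) = ∣∣-cong {u n *ᶜ (1ᶜ +ᶜ d n)} (ℂ-ring.sym (u-suc n)) (∣∣-mono {u n *ᶜ (1ᶜ +ᶜ d n)}
      (≤-trans (*-monoʳ-≤ (exp-0≤ (*-0≤ 0≤K (0≤∑ n))) (1+x≤exp (*-0≤ 0≤K (^-0≤ 0≤t n))))
        (≈⇒≤ (trans (sym (exp-real-+ (S n) (K * t ^ n))) (proj₁ (exp-cong (ofℝ-cong (sym (distribˡ K _ _))))))))
      (∣*∣ {u n} {1ᶜ +ᶜ d n} (partial n) (∣+∣ {1ᶜ} {d n} ∣1∣ (∣d∣ n))))
    uniform : ∀ n → ∣ u n ∣≤ E (K * T)
    uniform n = ∣∣-mono {u n} (≤-trans
      (≤-cong (*-identityʳ _) refl (*-monoʳ-≤ (exp-0≤ (*-0≤ 0≤K (0≤∑ n))) (≤-trans (x≤x+ 0≤rest) (1+x≤exp 0≤rest))))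
      (≈⇒≤ (trans (sym (exp-real-+ (S n) rest)) (proj₁ (exp-cong (ofℝ-cong (solve 2 (λ s x → s :+ (x :- s) := x) refl (S n) (K * T)))))))) (partial n)
      where
      rest = K * T - S n
      0≤rest : 0# ≤ rest
      0≤rest = ≤⇒0≤ (*-monoʳ-≤ 0≤K (geometric-sum n))
    difference : ∀ n → u n *ᶜ d n ≈ᶜ u (suc n) -ᶜ u n
    difference n = ℂ-ring.trans (ℂS.solve 2 (λ u d → u ℂS.:* d ℂS.:= u ℂS.:* (ℂS.con (+ 1) ℂS.:+ d) ℂS.:- u) ℂ-ring.refl (u n) (d n))
      (ℂ-ring.+-congʳ { -ᶜ u n} (ℂ-ring.sym (u-suc n)))

-- Integer differences of natural numbers.
module LastFactor where

  ⊖-negative : ∀ a b → a ℕ.< b → ∃[ m ] (a ℤ.⊖ b ≡ -[1+ m ])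
  ⊖-negative zero    (suc b) _         = b , ≡.refl
  ⊖-negative (suc a) (suc b) (s≤s a<b) = let m , eq = ⊖-negative a b a<b in m , ≡.trans (ℤₚ.[1+m]⊖[1+n]≡m⊖n a b) eq

  ⊖-cancel : ∀ a b → (a ℕ.+ b) ℤ.⊖ b ≡ + a
  ⊖-cancel a b = ≡.trans (ℤₚ.⊖-≥ (ℕₚ.m≤n+m b a)) (≡.cong +_ (ℕₚ.m+n∸n≡m a b))

-- The limit of the finite identity

module Main {c ℓ₁ ℓ₂ ℓ₃ : Level} (ℛ : RealNumbers c ℓ₁ ℓ₂ ℓ₃)
  (exp : Analysis.ℂ ℛ → Analysis.ℂ ℛ) (isExp : Analysis.IsExp ℛ exp)
  (π : Analysis.ℝ ℛ) (isPi : Analysis.IsPi ℛ exp π)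
  (τ : Analysis.ℂ ℛ) (0<τ : RealNumbers._<_ ℛ (RealNumbers.0# ℛ) (Analysis.ℂ.im τ)) where

  open OrderedField ℛ
  open Analysis ℛ
  open ComplexNumbers ℛ
  open ComplexInverses ℛ
  open Embeddings ℛ
  open Exponents ℛ
  open Exponential ℛ exp isExp using (exp-cong; exp-·ℕ; exp-bound; ofℝ-*; ofℝ-cong; partialSum≈∑)
  open QSeries ℛ exp π τ
  private
    module ℂS = IntegerCoefficients.Solver ℂ-commutativeRing
    module C = ℂ-ring
  open Algebra.Properties.Semiring.Exp C.semiring using () renaming (^-homo-* to ^ᶜ-homo-*; ^-congˡ to ^ᶜ-congˡ)
  open NormedRing ℂ-normed using (∣∣-cong; ∣∣-mono; ∣*∣; ∣+∣; ∣-∣; ∣1∣; ∣∣-0≤; bounded)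
  open Solver using (solve; _:=_; _:+_; _:*_; _:-_; :-_; con)
  open FiniteSums ℂ-commutativeRing

  -- q^(1/2).
  h : ℂ
  h = q^ ℚ.½

  private
    ½ : ℝ
    ½ = fromℚ ℚ.½

    -- q^x is exp (argument x).
    argument : ℝ → ℂ
    argument x = (0# +i (π + π)) *ᶜ ofℝ x *ᶜ τ

  -- q^r is a power of h when r is half a natural number.
  q^-power : ∀ r n → fromℚ r + fromℚ r ≈ fromℕ n → q^ r ≈ᶜ h ^ᶜ n
  q^-power r n eq = C.trans (exp-cong scale) (exp-·ℕ n (argument ½))
    where
    half-value : fromℚ r ≈ fromℕ n * ½
    half-value = trans (sym (*-identityʳ _)) (trans (*-congˡ (sym fromℚ-½))
      (trans (solve 2 (λ x h → x :* (h :+ h) := (x :+ x) :* h) refl (fromℚ r) ½) (*-congʳ eq)))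
    scale : argument (fromℚ r) ≈ᶜ ofℝ (fromℕ n) *ᶜ argument ½
    scale = C.trans (C.*-congʳ {τ} (C.*-congˡ {0# +i (π + π)} (C.trans (ofℝ-cong half-value) (ofℝ-* (fromℕ n) ½))))
      (ℂS.solve 4 (λ p n r t → p ℂS.:* (n ℂS.:* r) ℂS.:* t ℂS.:= n ℂS.:* (p ℂS.:* r ℂS.:* t)) C.refl (0# +i (π + π)) (ofℝ (fromℕ n)) (ofℝ ½) τ)

  q≈h*h : q ≈ᶜ h *ᶜ h
  q≈h*h = C.trans (q^-power ℚ.1ℚ 2 (trans (+-cong (fromℚ-ℤ (+ 1)) (fromℚ-ℤ (+ 1))) (sym (fromℕ-+ 1 1)))) (C.*-congˡ {h} (C.*-identityʳ h))

  private
    0<½ : 0# < ½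
    0<½ = [ (λ ½<0 → contradiction (<-cong half+half (+-identityˡ 0#) (<-trans (+-monoˡ-< ½ ½<0) (+-monoʳ-< 0# ½<0))) (<⇒≤ 0<1))
          , (λ lt → lt) ]′ (#⇒<⊎> (invertible⇒# (1# + 1# , trans (solve 1 (λ h → (con (+ 1) :+ con (+ 1)) :* (h :- con (+ 0)) := h :+ h) refl ½) fromℚ-½
                                                      , trans (solve 1 (λ h → (h :- con (+ 0)) :* (con (+ 1) :+ con (+ 1)) := h :+ h) refl ½) fromℚ-½)))
      where half+half = fromℚ-½

    -- The argument of h is πiτ, whose real part is negative.
    re<0 : re (argument ½) < 0#
    re<0 = <-cong (sym value) (-‿inverseʳ X) (<-cong (+-identityˡ (- X)) refl (+-monoˡ-< (- X) 0<X))
      where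
      X = (π + π) * ½ * im τ
      0<X : 0# < X
      0<X = *-pos (*-pos (0<+ (IsPi.positive isPi) (<⇒≤ (IsPi.positive isPi))) 0<½) 0<τ
      value : re (argument ½) ≈ - X
      value = solve 4 (λ p r a b → (con (+ 0) :* r :- p :* con (+ 0)) :* a :- (con (+ 0) :* con (+ 0) :+ p :* r) :* b := :- (p :* r :* b)) refl (π + π) ½ (re τ) (im τ)

    opaque
      -- The norm of h is at most t² for some t < 1.
      decay : ∃[ t ] (0# < t) × (t < 1#) × (∣ h ∣≤ t * t)
      decay = exp-bound (argument ½) re<0

    t : ℝ
    t = proj₁ decay

    0≤t : 0# ≤ t
    0≤t = <⇒≤ (proj₁ (proj₂ decay))

    t<1 : t < 1#
    t<1 = proj₁ (proj₂ (proj₂ decay))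

    t≤1 : t ≤ 1#
    t≤1 = <⇒≤ t<1

    ∣h∣ : ∣ h ∣≤ t * t
    ∣h∣ = proj₂ (proj₂ (proj₂ decay))

    0≤t^ : ∀ n → 0# ≤ t ^ n
    0≤t^ = ^-0≤ 0≤t

    tt≤1 : t * t ≤ 1#
    tt≤1 = ≤-cong refl (*-identityˡ 1#) (*-mono-≤ 0≤t 0≤1 t≤1 t≤1)

  open GeometricLimits ℛ ℂ-normed t 0≤t t<1
  open InfiniteProducts ℛ exp isExp t 0≤t t<1 using (product-converges)

  private
    ∣h^∣ : ∀ {n m} → n ℕ.≤ m → ∣ h ^ᶜ m ∣≤ t ^ n * t ^ n
    ∣h^∣ {n} {m} n≤m = ∣∣-mono {h ^ᶜ m} (≤-trans (^-antitone (*-0≤ 0≤t 0≤t) tt≤1 n≤m) (≈⇒≤ (square n))) (∣^∣ {h} ∣h∣ m)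
      where
      square : ∀ n → (t * t) ^ n ≈ t ^ n * t ^ n
      square zero    = sym (*-identityˡ 1#)
      square (suc n) = trans (*-congˡ (square n)) (solve 2 (λ t x → t :* t :* (x :* x) := t :* x :* (t :* x)) refl t (t ^ n))

    ∣h^∣′ : ∀ {n m} → n ℕ.≤ m → ∣ h ^ᶜ m ∣≤ 1# * t ^ n
    ∣h^∣′ {n} {m} n≤m = ∣∣-mono {h ^ᶜ m} (*-monoˡ-≤ (0≤t^ n) (^-≤1 0≤t t≤1 n)) (∣h^∣ n≤m)

    ∣q∣ : ∣ q ∣≤ t
    ∣q∣ = ∣∣-cong {h *ᶜ h} (C.sym q≈h*h) (∣∣-mono {h *ᶜ h}
      (≤-cong refl (*-identityʳ t) (≤-cong (solve 1 (λ t → t :* (t :* (t :* t)) := t :* t :* (t :* t)) refl t) refl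
        (*-monoʳ-≤ 0≤t (≤-trans (*-mono-≤ 0≤t 0≤1 t≤1 tt≤1) (≈⇒≤ (*-identityˡ 1#))))))
      (∣*∣ {h} {h} ∣h∣ ∣h∣))

    ∣q^∣ : ∀ n → ∣ q *ᶜ q ^ᶜ n ∣≤ t * t ^ n
    ∣q^∣ n = ∣^∣ {q} ∣q∣ (suc n)

    ∣q^∣≤t : ∀ n → ∣ q *ᶜ q ^ᶜ n ∣≤ t
    ∣q^∣≤t n = ∣∣-mono {q *ᶜ q ^ᶜ n} (≤-cong refl (*-identityʳ t) (*-monoʳ-≤ 0≤t (^-≤1 0≤t t≤1 n))) (∣q^∣ n)

    ∣q^∣≤t^ : ∀ n → ∣ q *ᶜ q ^ᶜ n ∣≤ 1# * t ^ n
    ∣q^∣≤t^ n = ∣∣-mono {q *ᶜ q ^ᶜ n} (*-monoˡ-≤ (0≤t^ n) t≤1) (∣q^∣ n)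

  opaque
    qₙ≠0 : ∀ m → NonZeroᶜ (poch q m)
    qₙ≠0 zero    = invertible⇒NonZero 1ᶜ 1ᶜ (C.*-identityˡ 1ᶜ)
    qₙ≠0 (suc m) = NonZero-* (poch q m) (1ᶜ -ᶜ q *ᶜ q ^ᶜ m) (qₙ≠0 m) (1-NonZero {q *ᶜ q ^ᶜ m} t<1 (∣q^∣≤t m))

  -- The reciprocals of the q-factorials.
  e : ℕ → ℂ
  e m = 1/poch qₙ≠0 m

  private
    poch-e-inverse : ∀ m → poch q m *ᶜ e m ≈ᶜ 1ᶜ
    poch-e-inverse m = invᶜ-inverse (poch q m) (qₙ≠0 m)

    e-zero : e 0 ≈ᶜ 1ᶜ
    e-zero = C.trans (C.sym (C.*-identityˡ (e 0))) (poch-e-inverse 0)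

    e-suc : ∀ n → e n ≈ᶜ (1ᶜ -ᶜ q *ᶜ q ^ᶜ n) *ᶜ e (suc n)
    e-suc n = begin
      e n                                                       ≈⟨ C.*-identityʳ (e n) ⟨
      e n *ᶜ 1ᶜ                                                 ≈⟨ C.*-congˡ {e n} (poch-e-inverse (suc n)) ⟨
      e n *ᶜ (poch q n *ᶜ (1ᶜ -ᶜ q *ᶜ q ^ᶜ n) *ᶜ e (suc n))     ≈⟨ ℂS.solve 4 (λ x p w y → x ℂS.:* (p ℂS.:* w ℂS.:* y) ℂS.:= p ℂS.:* x ℂS.:* (w ℂS.:* y)) C.refl (e n) (poch q n) (1ᶜ -ᶜ q *ᶜ q ^ᶜ n) (e (suc n)) ⟩
      poch q n *ᶜ e n *ᶜ ((1ᶜ -ᶜ q *ᶜ q ^ᶜ n) *ᶜ e (suc n))     ≈⟨ C.*-congʳ {(1ᶜ -ᶜ q *ᶜ q ^ᶜ n) *ᶜ e (suc n)} (poch-e-inverse n) ⟩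
      1ᶜ *ᶜ ((1ᶜ -ᶜ q *ᶜ q ^ᶜ n) *ᶜ e (suc n))                  ≈⟨ C.*-identityˡ ((1ᶜ -ᶜ q *ᶜ q ^ᶜ n) *ᶜ e (suc n)) ⟩
      (1ᶜ -ᶜ q *ᶜ q ^ᶜ n) *ᶜ e (suc n)                          ∎
      where open Relation.Binary.Reasoning.Setoid C.setoid

    e-step : ∀ n → e n ≈ᶜ (1ᶜ -ᶜ (h *ᶜ h) ^ᶜ suc n) *ᶜ e (suc n)
    e-step n = C.trans (e-suc n) (C.*-congʳ {e (suc n)} (C.+-congˡ {1ᶜ} (C.-‿cong (^ᶜ-congˡ (suc n) q≈h*h))))

    reciprocals : QFactorialReciprocals ℂ-commutativeRing (h *ᶜ h)
    reciprocals = record { e = e ; e-zero = e-zero ; e-step = e-step }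

    -- The reciprocal of 1 - q^(n+1), which is 1 + q^(n+1)/(1 - q^(n+1)).
    w : ℕ → ℂ
    w n = invᶜ (1ᶜ -ᶜ q *ᶜ q ^ᶜ n) (1-NonZero {q *ᶜ q ^ᶜ n} t<1 (∣q^∣≤t n))

    w-inverse : ∀ n → (1ᶜ -ᶜ q *ᶜ q ^ᶜ n) *ᶜ w n ≈ᶜ 1ᶜ
    w-inverse n = invᶜ-inverse (1ᶜ -ᶜ q *ᶜ q ^ᶜ n) (1-NonZero {q *ᶜ q ^ᶜ n} t<1 (∣q^∣≤t n))

    ∣w∣ : ∀ n → ∣ w n ∣≤ T
    ∣w∣ n = 1-inverse-bound {q *ᶜ q ^ᶜ n} t<1 (∣q^∣≤t n) 0<T T-inverse

    ratio : ∀ x y y′ z → y ≈ᶜ (1ᶜ -ᶜ x) *ᶜ y′ → (1ᶜ -ᶜ x) *ᶜ z ≈ᶜ 1ᶜ → y′ ≈ᶜ y *ᶜ (1ᶜ +ᶜ x *ᶜ z)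
    ratio x y y′ z y≈ inverse = begin
      y′                            ≈⟨ C.*-identityʳ y′ ⟨
      y′ *ᶜ 1ᶜ                      ≈⟨ C.*-congˡ {y′} inverse ⟨
      y′ *ᶜ ((1ᶜ -ᶜ x) *ᶜ z)        ≈⟨ ℂS.solve 3 (λ y x w → y ℂS.:* ((ℂS.con (+ 1) ℂS.:- x) ℂS.:* w) ℂS.:= (ℂS.con (+ 1) ℂS.:- x) ℂS.:* y ℂS.:* w) C.refl y′ x z ⟩
      (1ᶜ -ᶜ x) *ᶜ y′ *ᶜ z          ≈⟨ C.*-congʳ {z} y≈ ⟨
      y *ᶜ z                        ≈⟨ C.*-congˡ {y} (ℂS.solve 2 (λ x w → w ℂS.:= (ℂS.con (+ 1) ℂS.:- x) ℂS.:* w ℂS.:+ x ℂS.:* w) C.refl x z) ⟩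
      y *ᶜ ((1ᶜ -ᶜ x) *ᶜ z +ᶜ x *ᶜ z) ≈⟨ C.*-congˡ {y} (C.+-congʳ {x *ᶜ z} inverse) ⟩
      y *ᶜ (1ᶜ +ᶜ x *ᶜ z)           ∎
      where open Relation.Binary.Reasoning.Setoid C.setoid

    e-ratio : ∀ n → e (suc n) ≈ᶜ e n *ᶜ (1ᶜ +ᶜ q *ᶜ q ^ᶜ n *ᶜ w n)
    e-ratio n = ratio (q *ᶜ q ^ᶜ n) (e n) (e (suc n)) (w n) (e-suc n) (w-inverse n)

    e-increment : ∀ n → ∣ q *ᶜ q ^ᶜ n *ᶜ w n ∣≤ T * t ^ n
    e-increment n = ∣∣-mono {q *ᶜ q ^ᶜ n *ᶜ w n} (≈⇒≤ (trans (*-congʳ (*-identityˡ (t ^ n))) (*-comm (t ^ n) T)))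
        (∣*∣ {q *ᶜ q ^ᶜ n} {w n} (∣q^∣≤t^ n) (∣w∣ n))

    P-increment : ∀ n → ∣ -ᶜ (-q½ *ᶜ q ^ᶜ n) ∣≤ 1# * t ^ n
    P-increment n = ∣-∣ { -q½ *ᶜ q ^ᶜ n} (∣*∣ { -q½} {q ^ᶜ n} (∣-∣ {h} (∣∣-mono {h} tt≤1 ∣h∣)) (∣^∣ {q} ∣q∣ n))

    Q-increment : ∀ n → ∣ -ᶜ (q *ᶜ q ^ᶜ n) ∣≤ 1# * t ^ n
    Q-increment n = ∣-∣ {q *ᶜ q ^ᶜ n} (∣q^∣≤t^ n)

    opaque
      -- The limits of the products and of their reciprocals.
      P-limit : ∃[ P ] (poch -q½ ⇝ P)
      P-limit = product-converges {poch -q½} {λ n → -ᶜ (-q½ *ᶜ q ^ᶜ n)} {1#} C.refl (λ n → C.refl) P-increment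

      Q-limit : ∃[ Q ] (poch q ⇝ Q)
      Q-limit = product-converges {poch q} {λ n → -ᶜ (q *ᶜ q ^ᶜ n)} {1#} C.refl (λ n → C.refl) Q-increment

      e-limit : ∃[ E ] (e ⇝ E)
      e-limit = product-converges {e} {λ n → q *ᶜ q ^ᶜ n *ᶜ w n} {T} e-zero e-ratio e-increment

  -- (-h)_∞, (q)_∞ and 1/(q)_∞.
  P Q E : ℂ
  P = proj₁ P-limit
  Q = proj₁ Q-limit
  E = proj₁ e-limit

  P-⇝ : poch -q½ ⇝ P
  P-⇝ = proj₂ P-limit

  Q-⇝ : poch q ⇝ Q
  Q-⇝ = proj₂ Q-limit

  e-⇝ : e ⇝ E
  e-⇝ = proj₂ e-limit

  P-convergent : poch -q½ ⟶ P
  P-convergent = Lim⇒⟶ (⇝⇒Lim P-⇝)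

  Q-convergent : poch q ⟶ Q
  Q-convergent = Lim⇒⟶ (⇝⇒Lim Q-⇝)

  QE : Q *ᶜ E ≈ᶜ 1ᶜ
  QE = Lim-unique (⇝⇒Lim (⇝-* Q-⇝ e-⇝)) (⇝⇒Lim (⇝-cong (λ n → C.sym (poch-e-inverse n)) (⇝-const 1ᶜ)))

  Q≠0 : NonZeroᶜ Q
  Q≠0 = invertible⇒NonZero Q E QE

  invᶜQ : invᶜ Q Q≠0 ≈ᶜ E
  invᶜQ = begin
    invᶜ Q Q≠0                 ≈⟨ C.*-identityʳ (invᶜ Q Q≠0) ⟨
    invᶜ Q Q≠0 *ᶜ 1ᶜ           ≈⟨ C.*-congˡ {invᶜ Q Q≠0} QE ⟨
    invᶜ Q Q≠0 *ᶜ (Q *ᶜ E)     ≈⟨ ℂS.solve 3 (λ x q e → x ℂS.:* (q ℂS.:* e) ℂS.:= q ℂS.:* x ℂS.:* e) C.refl (invᶜ Q Q≠0) Q E ⟩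
    Q *ᶜ invᶜ Q Q≠0 *ᶜ E       ≈⟨ C.*-congʳ {E} (invᶜ-inverse Q Q≠0) ⟩
    1ᶜ *ᶜ E                    ≈⟨ C.*-identityˡ E ⟩
    E                          ∎
    where open Relation.Binary.Reasoning.Setoid C.setoid

  module Identity (m i : ℕ) (i≤k : i ℕ.≤ suc m) (ℓ : ℤ) where

    k : ℕ
    k = suc m

    Λ : ℕ
    Λ = ∣ ℓ ∣

    open ThetaExponents k i Λ using (upper) renaming (lower to lower′)
    open MultisumExponent i Λ using (exponent; sum≤exponent)
    open PartialSums using (raise; raise-0; last; last≡⟨⟩; last-raise; N₁-raise; N₁≡sum)
    open LastFactor
    open Lowering (σ ℓ)
    private
      module F = FiniteIdentity ℂ-commutativeRing h reciprocals Λ i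
      module TF = TermFactorisation ℂ-commutativeRing h reciprocals Λ i
    open UnconditionalSums ℛ ℂ-normed t 0≤t t<1 using (unconditional)
    open Reindexing ℛ ℂ-normed (raise {m} (σ ℓ)) lower lower-raise raise-lower using (Summable; reindex)
    open import Data.Vec.Base using (sum)

    -- Both sides for ℓ are h^o times those for Λ = ∣ℓ∣.
    o : ℕ
    o = offset i ℓ

    private
      square≤ : ∀ s → s ℕ.≤ s ℕ.* s
      square≤ zero    = z≤n
      square≤ (suc s) = ℕₚ.m≤m+n (suc s) _

      s≤upper : ∀ s → s ℕ.≤ upper s
      s≤upper s = ℕₚ.≤-trans (square≤ s) (ℕₚ.≤-trans (ℕₚ.m≤m+n (s ℕ.* s) _)
        (ℕₚ.≤-trans (ℕₚ.≤-trans (ℕₚ.≤-reflexive (≡.sym (ℕₚ.*-identityˡ _))) (ℕₚ.*-monoˡ-≤ (s ℕ.* s ℕ.+ 2 ℕ.* (Λ ℕ.* s)) (ℕₚ.m≤n+m 1 (2 ℕ.* k)))) (ℕₚ.m≤m+n _ (2 ℕ.* (i ℕ.* s)))))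

      1+s≤lower : ∀ s → suc s ℕ.≤ lower′ s
      1+s≤lower s = ℕₚ.≤-trans (ℕₚ.≤-reflexive (ℕₚ.+-comm 1 s)) (ℕₚ.+-mono-≤ (s≤upper s)
        (ℕₚ.*-mono-≤ (ℕₚ.m≤n+m 1 (2 ℕ.* (k ℕ.∸ i))) (ℕₚ.m≤n+m 1 (2 ℕ.* s ℕ.+ 2 ℕ.* Λ))))

    private opaque
      S₊-limit : ∃[ S ] ((λ n → ∑ n (λ s → h ^ᶜ upper s)) ⇝ S)
      S₊-limit = ⇝-series {K = 1#} λ s → ∣h^∣′ (s≤upper s)

      S₋-limit : ∃[ S ] ((λ n → ∑ n (λ s → h ^ᶜ lower′ s)) ⇝ S)
      S₋-limit = ⇝-series {K = 1#} λ s → ∣h^∣′ (ℕₚ.<⇒≤ (1+s≤lower s))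

    private
      S₊′ S₋′ : ℂ
      S₊′ = proj₁ S₊-limit
      S₋′ = proj₁ S₋-limit

      e-bound : ∃[ K ] (∀ n → ∣ e n ∣≤ K)
      e-bound = ⇝-bounded e-⇝

      -- Sums against the Bailey kernel converge to E² times the sum of the coefficients.
      kernel-⇝ : ∀ (a r : ℕ → ℕ) {S} → (∀ s → s ℕ.≤ r s) → (∀ s → r s ℕ.≤ a s) → (λ n → ∑ n (λ s → h ^ᶜ a s)) ⇝ S →
        (λ L → ∑ (suc L) (λ s → h ^ᶜ a s *ᶜ F.U (r s) L)) ⇝ (E *ᶜ (E *ᶜ S))
      kernel-⇝ a r {S} s≤r r≤a lim = ⇝-perturb {a = λ L → E *ᶜ (E *ᶜ ∑ (suc L) (λ s → h ^ᶜ a s))} {K = (K₁ * K + B * K₂) * T}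
        near (⇝-* (⇝-const E) (⇝-* (⇝-const E) shifted))
        where
        shifted : (λ L → ∑ (suc L) (λ s → h ^ᶜ a s)) ⇝ S
        shifted = ⇝-cong (λ L → C.reflexive (≡.cong (λ n → ∑ n (λ s → h ^ᶜ a s)) (ℕₚ.+-comm L 1))) (⇝-shift 1 lim)
        K = proj₁ e-bound
        0≤K = ∣∣-0≤ {e 0} (proj₂ e-bound 0)
        K₁ = proj₁ (delay-bound e-⇝)
        0≤K₁ = proj₁ (proj₂ (delay-bound e-⇝))
        K₂ = proj₁ e-⇝
        0≤K₂ : 0# ≤ K₂
        0≤K₂ = ≤-cong refl (*-identityʳ K₂) (∣∣-0≤ {e 0 -ᶜ E} (proj₂ e-⇝ 0))
        B = proj₁ (bounded E)
        0≤B = ∣∣-0≤ {E} (proj₂ (bounded E))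
        index : ℕ → ℕ → ℕ
        index L s = L ℕ.+ (r s ℕ.+ 2 ℕ.* Λ)
        difference : ∀ L s → ℂ
        difference L s = (delay e L (r s) -ᶜ E) *ᶜ (h ^ᶜ a s *ᶜ e (index L s)) +ᶜ E *ᶜ ((e (index L s) -ᶜ E) *ᶜ h ^ᶜ a s)
        first : ∀ L s → ∣ (delay e L (r s) -ᶜ E) *ᶜ (h ^ᶜ a s *ᶜ e (index L s)) ∣≤ K₁ * K * t ^ L * t ^ s
        first L s = ∣∣-mono {(delay e L (r s) -ᶜ E) *ᶜ (h ^ᶜ a s *ᶜ e (index L s))}
          (≤-trans (≈⇒≤ (solve 4 (λ a b x y → a :* (b :* x) :* y := a :* b :* y :* x) refl K₁ K (t ^ r s) (t ^ L)))
            (*-monoʳ-≤ (*-0≤ (*-0≤ 0≤K₁ 0≤K) (0≤t^ L)) (^-antitone 0≤t t≤1 (s≤r s))))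
          (proj₂ (proj₂ (delay-bound e-⇝)) L (r s) {h ^ᶜ a s *ᶜ e (index L s)} (*-0≤ 0≤K (0≤t^ (r s)))
            (∣∣-mono {h ^ᶜ a s *ᶜ e (index L s)} (≈⇒≤ (solve 2 (λ k x → x :* x :* k := k :* x :* x) refl K (t ^ r s))) (∣*∣ {h ^ᶜ a s} {e (index L s)} (∣h^∣ (r≤a s)) (proj₂ e-bound (index L s)))))
        second : ∀ L s → ∣ E *ᶜ ((e (index L s) -ᶜ E) *ᶜ h ^ᶜ a s) ∣≤ B * K₂ * t ^ L * t ^ s
        second L s = ∣∣-mono {E *ᶜ ((e (index L s) -ᶜ E) *ᶜ h ^ᶜ a s)}
          (≤-trans (*-monoʳ-≤ 0≤B (*-monoˡ-≤ (*-0≤ 0≤1 (0≤t^ s)) (*-monoʳ-≤ 0≤K₂ (^-antitone 0≤t t≤1 (ℕₚ.m≤m+n L (r s ℕ.+ 2 ℕ.* Λ))))))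
            (≈⇒≤ (solve 4 (λ b k x y → b :* (k :* x :* (con (+ 1) :* y)) := b :* k :* x :* y) refl B K₂ (t ^ L) (t ^ s))))
          (∣*∣ {E} {(e (index L s) -ᶜ E) *ᶜ h ^ᶜ a s} (proj₂ (bounded E)) (∣*∣ {e (index L s) -ᶜ E} {h ^ᶜ a s} (proj₂ e-⇝ (index L s)) (∣h^∣′ (ℕₚ.≤-trans (s≤r s) (r≤a s)))))
        near : ∀ L → ∣ ∑ (suc L) (λ s → h ^ᶜ a s *ᶜ F.U (r s) L) -ᶜ E *ᶜ (E *ᶜ ∑ (suc L) (λ s → h ^ᶜ a s)) ∣≤ (K₁ * K + B * K₂) * T * t ^ L
        near L = ∣∣-cong {∑ (suc L) (difference L)} collect
          (∣∣-mono {∑ (suc L) (difference L)} (≈⇒≤ (solve 3 (λ k x y → k :* x :* y := k :* y :* x) refl (K₁ * K + B * K₂) (t ^ L) T))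
            (∑-geometric (suc L) (*-0≤ (0≤+ (*-0≤ 0≤K₁ 0≤K) (*-0≤ 0≤B 0≤K₂)) (0≤t^ L)) λ s →
              ∣∣-mono {difference L s} (≈⇒≤ (solve 4 (λ a b x y → a :* x :* y :+ b :* x :* y := (a :+ b) :* x :* y) refl (K₁ * K) (B * K₂) (t ^ L) (t ^ s)))
                (∣+∣ {(delay e L (r s) -ᶜ E) *ᶜ (h ^ᶜ a s *ᶜ e (index L s))} {E *ᶜ ((e (index L s) -ᶜ E) *ᶜ h ^ᶜ a s)} (first L s) (second L s))))
          where
          collect : ∑ (suc L) (difference L) ≈ᶜ ∑ (suc L) (λ s → h ^ᶜ a s *ᶜ F.U (r s) L) -ᶜ E *ᶜ (E *ᶜ ∑ (suc L) (λ s → h ^ᶜ a s))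
          collect = C.trans (∑-cong (suc L) λ s _ →
              ℂS.solve 4 (λ d E x y → (d ℂS.:- E) ℂS.:* (x ℂS.:* y) ℂS.:+ E ℂS.:* ((y ℂS.:- E) ℂS.:* x) ℂS.:= x ℂS.:* (d ℂS.:* y) ℂS.:- E ℂS.:* (E ℂS.:* x))
                C.refl (delay e L (r s)) E (h ^ᶜ a s) (e (index L s)))
            (C.trans (∑-minus (suc L) (λ s → h ^ᶜ a s *ᶜ F.U (r s) L) (λ s → E *ᶜ (E *ᶜ h ^ᶜ a s)))
              (C.+-congˡ {∑ (suc L) (λ s → h ^ᶜ a s *ᶜ F.U (r s) L)} (C.-‿cong (C.trans (∑-*ˡ (suc L) E (λ s → E *ᶜ h ^ᶜ a s)) (C.*-congˡ {E} (∑-*ˡ (suc L) E (λ s → h ^ᶜ a s)))))))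

      poch≈ : ∀ n → F.poch (-ᶜ h) n ≈ᶜ poch -q½ n
      poch≈ zero    = C.refl
      poch≈ (suc n) = C.*-cong {F.poch (-ᶜ h) n} (poch≈ n) (C.+-congˡ {1ᶜ} (C.-‿cong (C.*-congˡ { -ᶜ h} (^ᶜ-congˡ n (C.sym q≈h*h)))))

      -- The theta series for Λ, divided by (q)_∞².
      D : ℂ
      D = E *ᶜ (E *ᶜ S₊′) -ᶜ E *ᶜ (E *ᶜ S₋′)

      -- The limit of the finite identity.
      truncated-⇝ : (λ L → ∑cube k (suc L) (λ v → delay e L (sum v) *ᶜ F.term v)) ⇝ (P *ᶜ D)
      truncated-⇝ = ⇝-cong (λ L → C.sym (C.trans (F.finiteIdentity m (suc L) L i≤k (ℕₚ.n<1+n L))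
          (C.*-cong {F.poch (-ᶜ h) (L ℕ.+ Λ)} (poch≈ (L ℕ.+ Λ)) (∑-minus (suc L) (λ s → h ^ᶜ upper s *ᶜ F.U s L) (λ s → h ^ᶜ lower′ s *ᶜ F.U (suc s) L)))))
        (⇝-* (⇝-shift Λ P-⇝) (⇝-minus
          (kernel-⇝ upper (λ s → s) (λ s → ℕₚ.≤-refl) s≤upper (proj₂ S₊-limit))
          (kernel-⇝ lower′ suc ℕₚ.n≤1+n 1+s≤lower (proj₂ S₋-limit))))

      -- The norms of h^(exponent v) decay, and the other factors are bounded.
      term-bound : ∃[ K ] (0# ≤ K) × (∀ v → ∣ F.term {m} v ∣≤ K * t ^ sum v * t ^ sum v)
      term-bound = X , 0≤X , λ v →
        let f₁ = h ^ᶜ exponent v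
            f₂ = F.poch (-ᶜ h) (sum v ℕ.+ Λ)
            f₃ = TF.e-product v
            f₄ = e (last v ℕ.+ 2 ℕ.* Λ)
        in ∣∣-cong {f₁ *ᶜ (f₂ *ᶜ (f₃ *ᶜ f₄))} (C.sym (TF.term-factors v))
          (∣∣-mono {f₁ *ᶜ (f₂ *ᶜ (f₃ *ᶜ f₄))} (≈⇒≤ (solve 2 (λ x y → y :* y :* x := x :* y :* y) refl X (t ^ sum v)))
            (∣*∣ {f₁} {f₂ *ᶜ (f₃ *ᶜ f₄)} (∣h^∣ (sum≤exponent v))
              (∣*∣ {f₂} {f₃ *ᶜ f₄} (∣∣-cong {poch -q½ (sum v ℕ.+ Λ)} (C.sym (poch≈ (sum v ℕ.+ Λ))) (proj₂ (⇝-bounded P-⇝) (sum v ℕ.+ Λ)))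
                (∣*∣ {f₃} {f₄} (product-bound v) (proj₂ e-bound (last v ℕ.+ 2 ℕ.* Λ))))))
        where
        K = proj₁ e-bound
        X = proj₁ (⇝-bounded P-⇝) * (K ^ k * K)
        0≤K = ∣∣-0≤ {e 0} (proj₂ e-bound 0)
        0≤X : 0# ≤ X
        0≤X = *-0≤ (∣∣-0≤ {poch -q½ 0} (proj₂ (⇝-bounded P-⇝) 0)) (*-0≤ (^-0≤ 0≤K k) 0≤K)
        product-bound : ∀ {k} (v : Vec ℕ k) → ∣ TF.e-product v ∣≤ K ^ k
        product-bound Vec.[]      = ∣1∣
        product-bound (n Vec.∷ v) = ∣*∣ {e n} {TF.e-product v} (proj₂ e-bound n) (product-bound v)

      -- The value of the multisum for Λ.
      R′ : ℂ
      R′ = Q *ᶜ (P *ᶜ D)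

      -- Multiplication by (q)_∞ cancels the limit 1/(q)_∞ of 1/(q)_(L-N_1).
      cube-⇝ : (λ L → ∑cube k (suc L) F.term) ⇝ R′
      cube-⇝ = ⇝-cong (λ L → C.trans (C.sym (C.*-assoc Q E (∑cube k (suc L) F.term))) (C.trans (C.*-congʳ {∑cube k (suc L) F.term} QE) (C.*-identityˡ (∑cube k (suc L) F.term))))
        (⇝-* (⇝-const Q) (⇝-perturb {a = λ L → ∑cube k (suc L) (λ v → delay e L (sum v) *ᶜ F.term v)} {K = proj₁ close}
          (λ L → ∣swap∣ {∑cube k (suc L) (λ v → delay e L (sum v) *ᶜ F.term v)} {E *ᶜ ∑cube k (suc L) F.term} (proj₂ close L (suc L))) truncated-⇝))
        where
        close = dominated-cube e-⇝ k {F.term} {proj₁ term-bound} (proj₁ (proj₂ term-bound)) (proj₂ (proj₂ term-bound))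

      -- The summand for ℓ at the raised vector (multisum-inside).
      g : Vec ℕ k → ℂ
      g v = h ^ᶜ o *ᶜ F.term v

      g-Lim : Lim (λ n → ∑cube k n g) (h ^ᶜ o *ᶜ R′)
      g-Lim ε 0<ε = let M , near = ⇝⇒Lim (⇝-* (⇝-const (h ^ᶜ o)) cube-⇝) ε 0<ε in
        suc M , λ { (suc n) (s≤s M≤n) → ∣∣-cong {h ^ᶜ o *ᶜ ∑cube k (suc n) F.term -ᶜ h ^ᶜ o *ᶜ R′}
          (C.+-congʳ { -ᶜ (h ^ᶜ o *ᶜ R′)} (C.sym (∑cube-*ˡ k (suc n) (h ^ᶜ o) F.term))) (near n M≤n) }

      g-summable : Summable g (h ^ᶜ o *ᶜ R′)
      g-summable = unconditional g (proj₁ (proj₂ term-bound))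
        (λ v → ∣∣-mono {g v} (≈⇒≤ (solve 3 (λ K x y → con (+ 1) :* con (+ 1) :* (K :* x :* y) := K :* x :* y) refl (proj₁ term-bound) (t ^ sum v) (t ^ sum v)))
          (∣*∣ {h ^ᶜ o} {F.term v} (∣h^∣ {0} {o} z≤n) (proj₂ (proj₂ term-bound) v))) g-Lim

      h^-offset : ∀ r n → fromℚ r + fromℚ r ≈ fromℕ (o ℕ.+ n) → q^ r ≈ᶜ h ^ᶜ o *ᶜ h ^ᶜ n
      h^-offset r n eq = C.trans (q^-power r (o ℕ.+ n) eq) (^ᶜ-homo-* h o n)

      e-product-raise : ∀ {k} s (v : Vec ℕ (suc k)) → TF.e-product (raise s v) *ᶜ e (last v) ≈ᶜ TF.e-product v *ᶜ e (last v ℕ.+ s)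
      e-product-raise {zero}  s (n Vec.∷ Vec.[]) =
        ℂS.solve 2 (λ x y → x ℂS.:* ℂS.con (+ 1) ℂS.:* y ℂS.:= y ℂS.:* ℂS.con (+ 1) ℂS.:* x) C.refl (e (n ℕ.+ s)) (e n)
      e-product-raise {suc k} s (n Vec.∷ v) = C.trans (C.*-assoc (e n) (TF.e-product (raise s v)) (e (last v)))
        (C.trans (C.*-congˡ {e n} (e-product-raise s v)) (C.sym (C.*-assoc (e n) (TF.e-product v) (e (last v ℕ.+ s)))))

      -- For negative ℓ, raising exchanges the roles of the two factors 1/(q)_(n_k) and 1/(q)_(n_k + 2ℓ).
      last-factor : ∀ ℓ (v : Vec ℕ k) → TF.e-product (raise (σ ℓ) v) *ᶜ 1/pochℤ qₙ≠0 (+ last (raise (σ ℓ) v) ℤ.+ + 2 ℤ.* ℓ)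
                                      ≈ᶜ TF.e-product v *ᶜ e (last v ℕ.+ 2 ℕ.* ∣ ℓ ∣)
      last-factor (+ n) v = C.reflexive (≡.cong₂ (λ u x → TF.e-product u *ᶜ 1/pochℤ qₙ≠0 (+ last u ℤ.+ x)) (raise-0 v) (≡.sym (ℤₚ.pos-* 2 n)))
      last-factor -[1+ n ] v = C.trans
        (C.reflexive (≡.cong (λ x → TF.e-product (raise (2 ℕ.* suc n) v) *ᶜ 1/pochℤ qₙ≠0 x)
          (≡.trans (≡.cong (ℤ._⊖ (2 ℕ.* suc n)) (last-raise (2 ℕ.* suc n) v)) (⊖-cancel (last v) (2 ℕ.* suc n)))))
        (e-product-raise (2 ℕ.* suc n) v)

      -- If n_k < σ ℓ then n_k + 2ℓ is negative.
      outside-factor : ∀ ℓ a → a ℕ.< σ ℓ → 1/pochℤ qₙ≠0 (+ a ℤ.+ + 2 ℤ.* ℓ) ≡ 0ᶜ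
      outside-factor -[1+ n ] a a<σ = ≡.cong (1/pochℤ qₙ≠0) (proj₂ (⊖-negative a (2 ℕ.* suc n) a<σ))

      multisum-inside : ∀ v → multisumTerm qₙ≠0 k i ℓ (raise (σ ℓ) v) ≈ᶜ g v
      multisum-inside v = begin
        q^ (multisumExponent k i ℓ n) *ᶜ pochℤ -q½ (+ N n 1 ℤ.+ ℓ) *ᶜ TF.e-product n *ᶜ 1/pochℤ qₙ≠0 (+ (n ⟨ k ⟩) ℤ.+ + 2 ℤ.* ℓ)
          ≡⟨ ≡.cong₂ (λ x y → q^ (multisumExponent k i ℓ n) *ᶜ pochℤ -q½ x *ᶜ TF.e-product n *ᶜ 1/pochℤ qₙ≠0 (+ y ℤ.+ + 2 ℤ.* ℓ)) index (last≡⟨⟩ n) ⟩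
        A *ᶜ B *ᶜ TF.e-product n *ᶜ 1/pochℤ qₙ≠0 (+ last n ℤ.+ + 2 ℤ.* ℓ)
          ≈⟨ C.*-assoc (A *ᶜ B) (TF.e-product n) (1/pochℤ qₙ≠0 (+ last n ℤ.+ + 2 ℤ.* ℓ)) ⟩
        A *ᶜ B *ᶜ (TF.e-product n *ᶜ 1/pochℤ qₙ≠0 (+ last n ℤ.+ + 2 ℤ.* ℓ))
          ≈⟨ C.*-cong {A *ᶜ B} (C.*-cong {A} (h^-offset (multisumExponent k i ℓ n) (exponent v) (multisumExponent-raise m i ℓ v i≤k)) (C.sym (poch≈ (sum v ℕ.+ Λ)))) (last-factor ℓ v) ⟩
        h ^ᶜ o *ᶜ h ^ᶜ exponent v *ᶜ F.poch (-ᶜ h) (sum v ℕ.+ Λ) *ᶜ (TF.e-product v *ᶜ e (last v ℕ.+ 2 ℕ.* Λ))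
          ≈⟨ ℂS.solve 4 (λ a b p x → a ℂS.:* b ℂS.:* p ℂS.:* x ℂS.:= a ℂS.:* (b ℂS.:* (p ℂS.:* x))) C.refl
               (h ^ᶜ o) (h ^ᶜ exponent v) (F.poch (-ᶜ h) (sum v ℕ.+ Λ)) (TF.e-product v *ᶜ e (last v ℕ.+ 2 ℕ.* Λ)) ⟩
        h ^ᶜ o *ᶜ (h ^ᶜ exponent v *ᶜ (F.poch (-ᶜ h) (sum v ℕ.+ Λ) *ᶜ (TF.e-product v *ᶜ e (last v ℕ.+ 2 ℕ.* Λ))))
          ≈⟨ C.*-congˡ {h ^ᶜ o} (TF.term-factors v) ⟨
        g v ∎
        where
        open Relation.Binary.Reasoning.Setoid C.setoid
        n = raise (σ ℓ) v
        A = q^ (multisumExponent k i ℓ n)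
        B = poch -q½ (sum v ℕ.+ Λ)
        index : + N n 1 ℤ.+ ℓ ≡ + (sum v ℕ.+ Λ)
        index = ≡.trans (≡.cong (λ x → + x ℤ.+ ℓ) (≡.trans (N₁-raise (σ ℓ) v) (≡.cong (ℕ._+ σ ℓ) (N₁≡sum v))))
          (≡.trans (ℤₚ.+-assoc (+ sum v) (+ σ ℓ) ℓ) (≡.cong (λ x → + sum v ℤ.+ x) (σ-+ ℓ)))

      multisum-outside : ∀ n → lower n ≡ nothing → multisumTerm qₙ≠0 k i ℓ n ≈ᶜ 0ᶜ
      multisum-outside n eq = C.trans
        (C.reflexive (≡.cong (λ x → q^ (multisumExponent k i ℓ n) *ᶜ pochℤ -q½ (+ N n 1 ℤ.+ ℓ) *ᶜ TF.e-product n *ᶜ x)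
          (outside-factor ℓ (n ⟨ k ⟩) (≡.subst (ℕ._< σ ℓ) (≡.sym (last≡⟨⟩ n)) (lower-nothing n eq)))))
        (C.zeroʳ (q^ (multisumExponent k i ℓ n) *ᶜ pochℤ -q½ (+ N n 1 ℤ.+ ℓ) *ᶜ TF.e-product n))

      theta-sum : ∀ (f : ℕ → ℂ) (a : ℕ → ℕ) {S} → (∀ s → f s ≈ᶜ h ^ᶜ o *ᶜ h ^ᶜ a s) → (λ n → ∑ n (λ s → h ^ᶜ a s)) ⇝ S →
                  IsSeriesSum f (h ^ᶜ o *ᶜ S)
      theta-sum f a f≈ lim = Lim⇒⟶ (⇝⇒Lim (⇝-cong (λ n → C.trans
          (C.trans (C.sym (∑-*ˡ n (h ^ᶜ o) (λ s → h ^ᶜ a s))) (∑-cong n λ s _ → C.sym (f≈ s)))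
          (C.reflexive (≡.sym (partialSum≈∑ f n)))) (⇝-* (⇝-const (h ^ᶜ o)) lim)))

    S₊ S₋ : ℂ
    S₊ = h ^ᶜ o *ᶜ S₊′
    S₋ = h ^ᶜ o *ᶜ S₋′

    S₊-sum : IsSeriesSum (λ s → thetaTerm k i ℓ (+ ∣ ℓ ∣ ℤ.+ + s)) S₊
    S₊-sum = theta-sum _ upper (λ s → h^-offset (thetaExponent k i ℓ (+ ∣ ℓ ∣ ℤ.+ + s)) (upper s) (thetaExponent-upper k i ℓ s)) (proj₂ S₊-limit)

    S₋-sum : IsSeriesSum (λ s → thetaTerm k i ℓ (ℤ.- (+ ∣ ℓ ∣) ℤ.- + 1 ℤ.- + s)) S₋
    S₋-sum = theta-sum _ lower′ (λ s → h^-offset (thetaExponent k i ℓ (ℤ.- (+ ∣ ℓ ∣) ℤ.- + 1 ℤ.- + s)) (lower′ s) (thetaExponent-lower k i ℓ s i≤k)) (proj₂ S₋-limit)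

    R : ℂ
    R = h ^ᶜ o *ᶜ R′

    multisum : HasSum (multisumTerm qₙ≠0 k i ℓ) R
    multisum ε 0<ε =
      let δ , 0<δ , δ+δ = half ε 0<ε
          G₀ , near = reindex multisum-inside multisum-outside g-summable δ 0<δ
          δ<ε : δ < ε
          δ<ε = <-cong (+-identityˡ δ) δ+δ (+-monoˡ-< δ 0<δ)
      in G₀ , λ G uG G₀⊆G → ≤-<-trans (proj₂ (near G uG G₀⊆G)) (square-mono-< (<⇒≤ 0<δ) δ<ε)

    equation : P *ᶜ invᶜ Q Q≠0 *ᶜ (S₊ -ᶜ S₋) ≈ᶜ R
    equation = begin
      P *ᶜ invᶜ Q Q≠0 *ᶜ (S₊ -ᶜ S₋)
        ≈⟨ C.*-congʳ {S₊ -ᶜ S₋} (C.*-congˡ {P} invᶜQ) ⟩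
      P *ᶜ E *ᶜ (S₊ -ᶜ S₋)
        ≈⟨ C.*-identityˡ (P *ᶜ E *ᶜ (S₊ -ᶜ S₋)) ⟨
      1ᶜ *ᶜ (P *ᶜ E *ᶜ (S₊ -ᶜ S₋))
        ≈⟨ C.*-congʳ {P *ᶜ E *ᶜ (S₊ -ᶜ S₋)} QE ⟨
      Q *ᶜ E *ᶜ (P *ᶜ E *ᶜ (S₊ -ᶜ S₋))
        ≈⟨ ℂS.solve 6 (λ Q E P H s s′ → Q ℂS.:* E ℂS.:* (P ℂS.:* E ℂS.:* (H ℂS.:* s ℂS.:- H ℂS.:* s′))
             ℂS.:= H ℂS.:* (Q ℂS.:* (P ℂS.:* (E ℂS.:* (E ℂS.:* s) ℂS.:- E ℂS.:* (E ℂS.:* s′))))) C.refl Q E P (h ^ᶜ o) S₊′ S₋′ ⟩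
      R ∎
      where open Relation.Binary.Reasoning.Setoid C.setoid

proposition3p1 : {c ℓ₁ ℓ₂ ℓ₃ : Level} (ℛ : RealNumbers c ℓ₁ ℓ₂ ℓ₃) →
    let open Analysis ℛ in
    (exp : ℂ → ℂ) → IsExp exp →
    (π : ℝ) → IsPi exp π →
    (τ : ℂ) → 0# < im τ →
    (k i : ℕ) (ℓ : ℤ) → 1 ℕ.≤ k → i ℕ.≤ k →
    let open QSeries ℛ exp π τ in
    Σ (∀ m → NonZeroᶜ (poch q m)) λ qₙ≠0 →
    ∃[ P ] ∃[ Q ] ∃[ S₊ ] ∃[ S₋ ] ∃[ R ] Σ (NonZeroᶜ Q) λ Q≠0 →
    (poch -q½ ⟶ P) ×
    (poch q ⟶ Q) ×
    IsSeriesSum (λ m → thetaTerm k i ℓ (+ ∣ ℓ ∣ ℤ.+ + m)) S₊ ×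
    IsSeriesSum (λ m → thetaTerm k i ℓ (ℤ.- (+ ∣ ℓ ∣) ℤ.- + 1 ℤ.- + m)) S₋ ×
    HasSum (multisumTerm qₙ≠0 k i ℓ) R ×
    (P *ᶜ invᶜ Q Q≠0 *ᶜ (S₊ -ᶜ S₋) ≈ᶜ R)
proposition3p1 ℛ exp isExp π isPi τ 0<τ (suc m) i ℓ _ i≤k =
  qₙ≠0 , P , Q , S₊ , S₋ , R , Q≠0 , P-convergent , Q-convergent , S₊-sum , S₋-sum , multisum , equation
  where
  open Main ℛ exp isExp π isPi τ 0<τ
  open Identity m i i≤k ℓ
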